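{- Fix reals $r'>r>0$ and Young diagrams $\mu\subseteq\lambda$. Let integers $N'>N$ tend to infinity in such a way that $N'/N\to r'/r$. Regard $\lambda$ as the signature $(\lambda_1,\dots,\lambda_{N'})\in\mathbb S_{N'}$ (padded with zeros) and $\mu$ as the signature $(\mu_1,\dots,\mu_N)\in\mathbb S_N$; this makes sense once $N\ge\ell(\lambda)$. Then $$\lim\Lambda^{N'}_N(\lambda,\mu)={}^{\mathbb{YB}}\Lambda^{r'}_r(\lambda,\mu).$$
   Context: Signatures and links: - $\mathbb S_N$ is the set of integer $N$-tuples $\nu_1\ge\dots\ge\nu_N$. - $\mathrm{Dim}_N\nu=\prod_{1\le i<j\le N}\frac{\nu_i-\nu_j-i+j}{j-i}$. - For $\kappa\in\mathbb S_K$ and $\nu\in\mathbb S_N$ with $K<N$, $\mathrm{Dim}_{K,N}(\kappa,\nu)$ is the number of chains $\kappa=\lambda^{(K)}\prec\dots\prec\lambda^{(N)}=\nu$, $\lambda^{(j)}\in\mathbb S_j$. Here $\lambda\prec\nu$ means $\nu_i\ge\lambda_i\ge\nu_{i+1}$ for all $i$. - The Gelfand–Tsetlin link is $\Lambda^N_K(\nu,\kappa)=\mathrm{Dim}_K\kappa\,\mathrm{Dim}_{K,N}(\kappa,\nu)/\mathrm{Dim}_N\nu$. Young diagrams: $\ell(\lambda)$ is the number of nonzero rows of $\lambda$, and $|\lambda|$ is its number of boxes. $\dim\lambda$ (resp. $\dim\lambda/\mu$) is the number of standard Young tableaux of shape $\lambda$ (resp. skew shape $\lambda/\mu$). The Young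 bouquet link: for $r'>r>0$ and Young diagrams $\lambda,\mu$, $${}^{\mathbb{YB}}\Lambda^{r'}_r(\lambda,\mu)=\binom{|\lambda|}{|\mu|}\Big(\frac{r}{r'}\Big)^{|\mu|}\Big(1-\frac{r}{r'}\Big)^{|\lambda|-|\mu|}\frac{\dim\mu\,\dim\lambda/\mu}{\dim\lambda}$$ if $\mu\subseteq\lambda$, and $0$ otherwise. -}

module Defs where

open import Algebra.Properties.CommutativeMonoid.Sum as FiniteSum using ()
open import Algebra.Bundles using (AbelianGroup)
import Algebra.Properties.Group as GroupProperties
open import Data.Bool.Base using (if_then_else_)
open import Data.Fin.Base as Fin using (Fin; zero; suc; Fin′; toℕ; inject; inject₁)
open import Data.Fin.Properties as Fin using (toℕ<n)
open import Data.Integer.Base as ℤ using (ℤ; +_)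
open import Data.Integer.Properties as ℤ using ()
open import Data.Irrelevant using ([_])
open import Data.List.Base as List using (List; []; _∷_)
open import Data.List.Membership.Propositional using (_∈_)
open import Data.List.Membership.Propositional.Properties as ∈
open import Data.List.Relation.Unary.All as All using (All; []; _∷_)
open import Data.List.Relation.Unary.All.Properties as All using ()
open import Data.List.Relation.Unary.AllPairs as AllPairs using (AllPairs; []; _∷_)
open import Data.List.Relation.Unary.AllPairs.Properties as AllPairs using ()
open import Data.List.Relation.Unary.Any using (here; there)
open import Data.List.Relation.Unary.Linked as ListLinked using ()
open import Data.List.Relation.Unary.Unique.Propositional using (Unique)
open import Data.List.Relation.Unary.Unique.Propositional.Properties as Unique using ()
open import Data.Maybe.Base as Maybe using (Maybe; just; nothing)
open import Data.Maybe.Properties using (just-injective)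
open import Data.Nat.Base as ℕ using (ℕ; zero; suc; z≤n; s≤s)
open import Data.Nat.Combinatorics using (_C_)
open import Data.Nat.ListAction using (sum)
open import Data.Nat.Properties as ℕ using (m⊔n≤o⇒m≤o; m⊔n≤o⇒n≤o)
open import Data.Product.Base using (_×_; _,_; proj₁; proj₂; ∃-syntax)
open import Data.Rational.Base as ℚ using (ℚ; 0ℚ; 1ℚ; ½)
open import Data.Rational.Properties as ℚ using ()
open import Data.Rational.Solver using (module +-*-Solver)
open import Data.Refinement.Base using (Refinement; value; _,_)
open import Data.Sum.Base using (_⊎_; inj₁; inj₂)
open import Data.Vec.Base as Vec using (Vec; []; _∷_; lookup; tabulate)
open import Data.Vec.Properties using (≡-dec; lookup∘tabulate; lookup-allFin; ∷-injective)
open import Data.Vec.Relation.Unary.Linked as Linked using (Linked; []; [-]; _∷_)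
open import Data.Vec.Relation.Unary.Linked.Properties as Linked using ()
open import Function.Base using (_∘_; id; flip)
open import Relation.Binary.Definitions using (DecidableEquality; tri<; tri≈; tri>)
open import Relation.Binary.PropositionalEquality
open import Relation.Nullary.Decidable using (Dec; yes; no; does; map′; _×-dec_; _→-dec_; recompute)
open import Relation.Nullary.Negation using (¬_; contradiction)
open import Relation.Unary using (Decidable)

-- Real numbers: Cauchy sequences of rationals, with moduli.  Two such
-- sequences represent the same real when their difference tends to 0;
-- every operation and relation below respects that equivalence.

Cauchy : (ℕ → ℚ) → Set
Cauchy x = ∀ ε → 0ℚ ℚ.< ε →
  ∃[ M ] ∀ m n → M ℕ.≤ m → M ℕ.≤ n → ℚ.∣ x m ℚ.- x n ∣ ℚ.< ε

record ℝ : Set where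
  constructor mkℝ
  field
    seq    : ℕ → ℚ
    cauchy : Cauchy seq

open ℝ public

infix 4 _<_

_<_ : ℝ → ℝ → Set
x < y = ∃[ δ ] 0ℚ ℚ.< δ × ∃[ M ] ∀ n → M ℕ.≤ n → seq x n ℚ.+ δ ℚ.≤ seq y n

<-trans : ∀ {x y z} → x < y → y < z → x < z
<-trans {x} {y} {z} (δ , 0<δ , M , x<y) (η , 0<η , L , y<z) =
  δ , 0<δ , M ℕ.⊔ L , λ n le → begin
    seq x n ℚ.+ δ  ≤⟨ x<y n (ℕ.≤-trans (ℕ.m≤m⊔n M L) le) ⟩
    seq y n        ≡⟨ ℚ.+-identityʳ _ ⟨
    seq y n ℚ.+ 0ℚ ≤⟨ ℚ.+-monoʳ-≤ (seq y n) (ℚ.<⇒≤ 0<η) ⟩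
    seq y n ℚ.+ η  ≤⟨ y<z n (ℕ.≤-trans (ℕ.m≤n⊔m M L) le) ⟩
    seq z n        ∎
  where open ℚ.≤-Reasoning

fromℚ : ℚ → ℝ
fromℚ q = mkℝ (λ _ → q) λ ε 0<ε → 0 , λ _ _ _ _ →
  subst (ℚ._< ε) (sym (cong ℚ.∣_∣ (ℚ.+-inverseʳ q))) 0<ε

fromℕ : ℕ → ℝ
fromℕ n = fromℚ (+ n ℚ./ 1)

0ℝ 1ℝ : ℝ
0ℝ = fromℚ 0ℚ
1ℝ = fromℚ 1ℚ

open +-*-Solver using (solve; _:=_; _:+_; _:*_; :-_; _:-_)

-[p-q] : ∀ p q → ℚ.- (p ℚ.- q) ≡ q ℚ.- p
-[p-q] = solve 2 (λ p q → :- (p :- q) := q :- p) refl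

-p--q : ∀ p q → ℚ.- p ℚ.- (ℚ.- q) ≡ q ℚ.- p
-p--q = solve 2 (λ p q → :- p :- (:- q) := q :- p) refl

p-q+q : ∀ p q → p ℚ.- q ℚ.+ q ≡ p
p-q+q = solve 2 (λ p q → p :- q :+ q := p) refl

p+q-q : ∀ p q → p ℚ.+ q ℚ.- q ≡ p
p+q-q = solve 2 (λ p q → p :+ q :- q := p) refl

+-difference : ∀ a b c d → a ℚ.+ b ℚ.- (c ℚ.+ d) ≡ (a ℚ.- c) ℚ.+ (b ℚ.- d)
+-difference = solve 4 (λ a b c d → a :+ b :- (c :+ d) := (a :- c) :+ (b :- d)) refl

*-difference : ∀ a b c d → a ℚ.* b ℚ.- c ℚ.* d ≡ a ℚ.* (b ℚ.- d) ℚ.+ d ℚ.* (a ℚ.- c)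
*-difference = solve 4 (λ a b c d →
  a :* b :- c :* d := a :* (b :- d) :+ d :* (a :- c)) refl

1/-difference : ∀ a b c d →
  a ℚ.* b ℚ.* (c ℚ.- d) ≡ b ℚ.* (a ℚ.* c) ℚ.- a ℚ.* (b ℚ.* d)
1/-difference = solve 4 (λ a b c d →
  a :* b :* (c :- d) := b :* (a :* c) :- a :* (b :* d)) refl

half-pos : ∀ {ε} → 0ℚ ℚ.< ε → 0ℚ ℚ.< ½ ℚ.* ε
half-pos {ε} 0<ε = subst (ℚ._< ½ ℚ.* ε) (ℚ.*-zeroʳ ½) (ℚ.*-monoʳ-<-pos ½ 0<ε)

halves : ∀ ε → ½ ℚ.* ε ℚ.+ ½ ℚ.* ε ≡ ε
halves ε = trans (sym (ℚ.*-distribʳ-+ ε ½ ½)) (ℚ.*-identityˡ ε)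

*-pos : ∀ {p q} → 0ℚ ℚ.< p → 0ℚ ℚ.< q → 0ℚ ℚ.< p ℚ.* q
*-pos {p} {q} 0<p 0<q =
  ℚ.positive⁻¹ _ {{ℚ.pos*pos⇒pos p {{ℚ.positive 0<p}} q {{ℚ.positive 0<q}}}}

nonZero-pos : ∀ {p} → 0ℚ ℚ.< p → ℚ.NonZero p
nonZero-pos {p} 0<p = ℚ.pos⇒nonZero p {{ℚ.positive 0<p}}

divide : ∀ B → 0ℚ ℚ.< B → ∀ ε → 0ℚ ℚ.< ε → ∃[ δ ] 0ℚ ℚ.< δ × B ℚ.* δ ≡ ε
divide B 0<B ε 0<ε = B⁻¹ ℚ.* ε , *-pos 0<B⁻¹ 0<ε ,
  trans (sym (ℚ.*-assoc B B⁻¹ ε))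
    (trans (cong (ℚ._* ε) (ℚ.*-inverseʳ B {{nonZero-pos 0<B}})) (ℚ.*-identityˡ ε))
  where
  B⁻¹ = ℚ.1/_ B {{nonZero-pos 0<B}}
  0<B⁻¹ : 0ℚ ℚ.< B⁻¹
  0<B⁻¹ = ℚ.positive⁻¹ B⁻¹ {{ℚ.1/pos⇒pos B {{ℚ.positive 0<B}}}}

∣-∣-comm : ∀ p q → ℚ.∣ p ℚ.- q ∣ ≡ ℚ.∣ q ℚ.- p ∣
∣-∣-comm p q = trans (sym (ℚ.∣-p∣≡∣p∣ (p ℚ.- q)))
  (cong ℚ.∣_∣ (-[p-q] p q))

∣p∣≤ : ∀ p q → ℚ.∣ p ∣ ℚ.≤ ℚ.∣ p ℚ.- q ∣ ℚ.+ ℚ.∣ q ∣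
∣p∣≤ p q = begin
  ℚ.∣ p ∣                         ≡⟨ cong ℚ.∣_∣ (p-q+q p q) ⟨
  ℚ.∣ p ℚ.- q ℚ.+ q ∣             ≤⟨ ℚ.∣p+q∣≤∣p∣+∣q∣ (p ℚ.- q) q ⟩
  ℚ.∣ p ℚ.- q ∣ ℚ.+ ℚ.∣ q ∣       ∎
  where open ℚ.≤-Reasoning

∣p∣-∣q∣≤ : ∀ p q → ℚ.∣ p ∣ ℚ.- ℚ.∣ q ∣ ℚ.≤ ℚ.∣ p ℚ.- q ∣
∣p∣-∣q∣≤ p q = begin
  ℚ.∣ p ∣ ℚ.- ℚ.∣ q ∣
    ≤⟨ ℚ.+-monoˡ-≤ (ℚ.- ℚ.∣ q ∣) (∣p∣≤ p q) ⟩
  ℚ.∣ p ℚ.- q ∣ ℚ.+ ℚ.∣ q ∣ ℚ.- ℚ.∣ q ∣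
    ≡⟨ p+q-q ℚ.∣ p ℚ.- q ∣ ℚ.∣ q ∣ ⟩
  ℚ.∣ p ℚ.- q ∣ ∎
  where open ℚ.≤-Reasoning

∣∣p∣-∣q∣∣≤ : ∀ p q → ℚ.∣ ℚ.∣ p ∣ ℚ.- ℚ.∣ q ∣ ∣ ℚ.≤ ℚ.∣ p ℚ.- q ∣
∣∣p∣-∣q∣∣≤ p q with ℚ.∣p∣≡p∨∣p∣≡-p (ℚ.∣ p ∣ ℚ.- ℚ.∣ q ∣)
... | inj₁ eq = subst (ℚ._≤ ℚ.∣ p ℚ.- q ∣) (sym eq) (∣p∣-∣q∣≤ p q)
... | inj₂ eq = subst₂ ℚ._≤_
  (trans (sym (-[p-q] ℚ.∣ p ∣ ℚ.∣ q ∣)) (sym eq))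
  (∣-∣-comm q p) (∣p∣-∣q∣≤ q p)

bounded : ∀ x → ∃[ B ] 0ℚ ℚ.< B × ∃[ M ] ∀ n → M ℕ.≤ n → ℚ.∣ seq x n ∣ ℚ.≤ B
bounded x with cauchy x 1ℚ (ℚ.positive⁻¹ 1ℚ)
... | M , near = 1ℚ ℚ.+ ℚ.∣ seq x M ∣ ,
  ℚ.+-mono-<-≤ (ℚ.positive⁻¹ 1ℚ) (ℚ.0≤∣p∣ (seq x M)) , M , λ n M≤n →
    ℚ.≤-trans (∣p∣≤ (seq x n) (seq x M))
      (ℚ.+-monoˡ-≤ ℚ.∣ seq x M ∣ (ℚ.<⇒≤ (near n M M≤n ℕ.≤-refl)))

∣*∣< : ∀ {a B d δ ε} → 0ℚ ℚ.< B → ℚ.∣ a ∣ ℚ.≤ B → ℚ.∣ d ∣ ℚ.< δ → B ℚ.* δ ≡ ε →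
       ℚ.∣ a ℚ.* d ∣ ℚ.< ε
∣*∣< {a} {B} {d} {δ} {ε} 0<B ∣a∣≤B ∣d∣<δ eq = begin-strict
  ℚ.∣ a ℚ.* d ∣         ≡⟨ ℚ.∣p*q∣≡∣p∣*∣q∣ a d ⟩
  ℚ.∣ a ∣ ℚ.* ℚ.∣ d ∣   ≤⟨ ℚ.*-monoʳ-≤-nonNeg ℚ.∣ d ∣ {{ℚ.∣-∣-nonNeg d}} ∣a∣≤B ⟩
  B ℚ.* ℚ.∣ d ∣         <⟨ ℚ.*-monoʳ-<-pos B {{ℚ.positive 0<B}} ∣d∣<δ ⟩
  B ℚ.* δ               ≡⟨ eq ⟩
  ε                     ∎
  where open ℚ.≤-Reasoning

+-cauchy : ∀ x y → Cauchy (λ n → seq x n ℚ.+ seq y n)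
+-cauchy (mkℝ x cx) (mkℝ y cy) ε 0<ε
  with cx (½ ℚ.* ε) (half-pos 0<ε) | cy (½ ℚ.* ε) (half-pos 0<ε)
... | M , hx | L , hy = M ℕ.⊔ L , λ m n m≥ n≥ → begin-strict
  ℚ.∣ x m ℚ.+ y m ℚ.- (x n ℚ.+ y n) ∣
    ≡⟨ cong ℚ.∣_∣ (+-difference (x m) (y m) (x n) (y n)) ⟩
  ℚ.∣ (x m ℚ.- x n) ℚ.+ (y m ℚ.- y n) ∣
    ≤⟨ ℚ.∣p+q∣≤∣p∣+∣q∣ (x m ℚ.- x n) (y m ℚ.- y n) ⟩
  ℚ.∣ x m ℚ.- x n ∣ ℚ.+ ℚ.∣ y m ℚ.- y n ∣
    <⟨ ℚ.+-mono-< (hx m n (m⊔n≤o⇒m≤o M L m≥) (m⊔n≤o⇒m≤o M L n≥))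
                  (hy m n (m⊔n≤o⇒n≤o M L m≥) (m⊔n≤o⇒n≤o M L n≥)) ⟩
  ½ ℚ.* ε ℚ.+ ½ ℚ.* ε
    ≡⟨ halves ε ⟩
  ε ∎
  where open ℚ.≤-Reasoning

neg-cauchy : ∀ x → Cauchy (λ n → ℚ.- seq x n)
neg-cauchy (mkℝ x cx) ε 0<ε with cx ε 0<ε
... | M , hx = M , λ m n m≥ n≥ → subst (ℚ._< ε)
  (trans (∣-∣-comm (x m) (x n))
    (cong ℚ.∣_∣ (sym (-p--q (x m) (x n)))))
  (hx m n m≥ n≥)

∣∣-cauchy : ∀ x → Cauchy (λ n → ℚ.∣ seq x n ∣)
∣∣-cauchy (mkℝ x cx) ε 0<ε with cx ε 0<ε
... | M , hx = M , λ m n m≥ n≥ → ℚ.≤-<-trans (∣∣p∣-∣q∣∣≤ (x m) (x n)) (hx m n m≥ n≥)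

*-close : ∀ {A B a b c d α β ε} → 0ℚ ℚ.< A → 0ℚ ℚ.< B → A ℚ.* α ≡ ε → B ℚ.* β ≡ ε →
          ℚ.∣ a ∣ ℚ.≤ A → ℚ.∣ d ∣ ℚ.≤ B → ℚ.∣ b ℚ.- d ∣ ℚ.< α → ℚ.∣ a ℚ.- c ∣ ℚ.< β →
          ℚ.∣ a ℚ.* b ℚ.- c ℚ.* d ∣ ℚ.< ε ℚ.+ ε
*-close {A} {B} {a} {b} {c} {d} {α} {β} {ε} 0<A 0<B Aα Bβ a≤A d≤B b≈d a≈c = begin-strict
  ℚ.∣ a ℚ.* b ℚ.- c ℚ.* d ∣
    ≡⟨ cong ℚ.∣_∣ (*-difference a b c d) ⟩
  ℚ.∣ a ℚ.* (b ℚ.- d) ℚ.+ d ℚ.* (a ℚ.- c) ∣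
    ≤⟨ ℚ.∣p+q∣≤∣p∣+∣q∣ (a ℚ.* (b ℚ.- d)) (d ℚ.* (a ℚ.- c)) ⟩
  ℚ.∣ a ℚ.* (b ℚ.- d) ∣ ℚ.+ ℚ.∣ d ℚ.* (a ℚ.- c) ∣
    <⟨ ℚ.+-mono-< (∣*∣< {a} {A} {b ℚ.- d} {α} {ε} 0<A a≤A b≈d Aα)
                  (∣*∣< {d} {B} {a ℚ.- c} {β} {ε} 0<B d≤B a≈c Bβ) ⟩
  ε ℚ.+ ε ∎
  where open ℚ.≤-Reasoning

*-cauchy : ∀ x y → Cauchy (λ n → seq x n ℚ.* seq y n)
*-cauchy x y ε 0<ε =
  let A , 0<A , M , hA = bounded x
      B , 0<B , L , hB = bounded y
      α , 0<α , Aα     = divide A 0<A (½ ℚ.* ε) (half-pos 0<ε)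
      β , 0<β , Bβ     = divide B 0<B (½ ℚ.* ε) (half-pos 0<ε)
      P , hx           = cauchy x β 0<β
      Q , hy           = cauchy y α 0<α
      R = M ℕ.⊔ L ; S = P ℕ.⊔ Q
  in R ℕ.⊔ S , λ m n m≥ n≥ →
    subst (ℚ.∣ seq x m ℚ.* seq y m ℚ.- seq x n ℚ.* seq y n ∣ ℚ.<_) (halves ε)
      (*-close {A} {B} {seq x m} {seq y m} {seq x n} {seq y n} {α} {β} {½ ℚ.* ε}
        0<A 0<B Aα Bβ
        (hA m (m⊔n≤o⇒m≤o M L (m⊔n≤o⇒m≤o R S m≥)))
        (hB n (m⊔n≤o⇒n≤o M L (m⊔n≤o⇒m≤o R S n≥)))
        (hy m n (m⊔n≤o⇒n≤o P Q (m⊔n≤o⇒n≤o R S m≥)) (m⊔n≤o⇒n≤o P Q (m⊔n≤o⇒n≤o R S n≥)))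
        (hx m n (m⊔n≤o⇒m≤o P Q (m⊔n≤o⇒n≤o R S m≥)) (m⊔n≤o⇒m≤o P Q (m⊔n≤o⇒n≤o R S n≥))))

1/-close : ∀ {a b δ ε} .{{a≢0 : ℚ.NonZero a}} .{{b≢0 : ℚ.NonZero b}} →
           0ℚ ℚ.< δ → 0ℚ ℚ.< ε → δ ℚ.≤ a → δ ℚ.≤ b →
           ℚ.∣ b ℚ.- a ∣ ℚ.< δ ℚ.* δ ℚ.* ε → ℚ.∣ ℚ.1/ a ℚ.- ℚ.1/ b ∣ ℚ.< ε
1/-close {a} {b} {δ} {ε} 0<δ 0<ε δ≤a δ≤b near =
  ℚ.*-cancelˡ-<-nonNeg (a ℚ.* b) {{ℚ.nonNegative 0≤ab}} (begin-strict
  a ℚ.* b ℚ.* ℚ.∣ ℚ.1/ a ℚ.- ℚ.1/ b ∣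
    ≡⟨ cong (ℚ._* ℚ.∣ ℚ.1/ a ℚ.- ℚ.1/ b ∣) (ℚ.0≤p⇒∣p∣≡p 0≤ab) ⟨
  ℚ.∣ a ℚ.* b ∣ ℚ.* ℚ.∣ ℚ.1/ a ℚ.- ℚ.1/ b ∣
    ≡⟨ ℚ.∣p*q∣≡∣p∣*∣q∣ (a ℚ.* b) (ℚ.1/ a ℚ.- ℚ.1/ b) ⟨
  ℚ.∣ a ℚ.* b ℚ.* (ℚ.1/ a ℚ.- ℚ.1/ b) ∣
    ≡⟨ cong ℚ.∣_∣ (1/-difference a b (ℚ.1/ a) (ℚ.1/ b)) ⟩
  ℚ.∣ b ℚ.* (a ℚ.* ℚ.1/ a) ℚ.- a ℚ.* (b ℚ.* ℚ.1/ b) ∣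
    ≡⟨ cong₂ (λ u v → ℚ.∣ b ℚ.* u ℚ.- a ℚ.* v ∣) (ℚ.*-inverseʳ a) (ℚ.*-inverseʳ b) ⟩
  ℚ.∣ b ℚ.* 1ℚ ℚ.- a ℚ.* 1ℚ ∣
    ≡⟨ cong₂ (λ u v → ℚ.∣ u ℚ.- v ∣) (ℚ.*-identityʳ b) (ℚ.*-identityʳ a) ⟩
  ℚ.∣ b ℚ.- a ∣
    <⟨ near ⟩
  δ ℚ.* δ ℚ.* ε
    ≤⟨ ℚ.*-monoʳ-≤-nonNeg ε {{ℚ.nonNegative (ℚ.<⇒≤ 0<ε)}} (ℚ.≤-trans
         (ℚ.*-monoʳ-≤-nonNeg δ {{ℚ.nonNegative (ℚ.<⇒≤ 0<δ)}} δ≤a)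
         (ℚ.*-monoˡ-≤-nonNeg a {{ℚ.nonNegative (ℚ.<⇒≤ 0<a)}} δ≤b)) ⟩
  a ℚ.* b ℚ.* ε ∎)
  where
  open ℚ.≤-Reasoning
  0<a  = ℚ.<-≤-trans 0<δ δ≤a
  0≤ab : 0ℚ ℚ.≤ a ℚ.* b
  0≤ab = ℚ.<⇒≤ (*-pos 0<a (ℚ.<-≤-trans 0<δ δ≤b))

1/-cauchy : ∀ {x} → Cauchy x → ∀ {δ} → 0ℚ ℚ.< δ →
            (δ≤x : ∀ n → δ ℚ.≤ x n) (nz : ∀ n → ℚ.NonZero (x n)) →
            Cauchy (λ n → ℚ.1/_ (x n) {{nz n}})
1/-cauchy {x} cx {δ} 0<δ δ≤x nz ε 0<ε
  with cx (δ ℚ.* δ ℚ.* ε) (*-pos (*-pos 0<δ 0<δ) 0<ε)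
... | M , hx = M , λ m n m≥ n≥ →
  1/-close {{nz m}} {{nz n}} 0<δ 0<ε (δ≤x m) (δ≤x n) (hx n m n≥ m≥)

infixl 6 _+_ _-_
infixl 7 _*_
infix  8 -_
infixr 8 _^_

_+_ _*_ : ℝ → ℝ → ℝ
x + y = mkℝ (λ n → seq x n ℚ.+ seq y n) (+-cauchy x y)
x * y = mkℝ (λ n → seq x n ℚ.* seq y n) (*-cauchy x y)

-_ ∣_∣ : ℝ → ℝ
- x   = mkℝ (λ n → ℚ.- seq x n) (neg-cauchy x)
∣ x ∣ = mkℝ (λ n → ℚ.∣ seq x n ∣) (∣∣-cauchy x)

_-_ : ℝ → ℝ → ℝ
x - y = x + (- y)

_^_ : ℝ → ℕ → ℝ
x ^ zero  = 1ℝ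
x ^ suc n = x * x ^ n

-- The reciprocal of a positive real.  Terms of the sequence before the
-- index M, where positivity sets in, may vanish, so they are dropped.
inverse : (x : ℝ) → 0ℝ < x → ℝ
inverse x (δ , 0<δ , M , 0+δ≤x) =
  mkℝ (λ n → ℚ.1/_ (tail n) {{nz n}}) (1/-cauchy tail-cauchy 0<δ δ≤tail nz)
  where
  tail : ℕ → ℚ
  tail n = seq x (M ℕ.+ n)
  δ≤tail : ∀ n → δ ℚ.≤ tail n
  δ≤tail n = subst (ℚ._≤ tail n) (ℚ.+-identityˡ δ) (0+δ≤x (M ℕ.+ n) (ℕ.m≤m+n M n))
  nz : ∀ n → ℚ.NonZero (tail n)
  nz n = nonZero-pos (ℚ.<-≤-trans 0<δ (δ≤tail n))
  tail-cauchy : Cauchy tail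
  tail-cauchy ε 0<ε with cauchy x ε 0<ε
  ... | L , hx = L , λ m n m≥ n≥ →
    hx _ _ (ℕ.≤-trans m≥ (ℕ.m≤n+m m M)) (ℕ.≤-trans n≥ (ℕ.m≤n+m n M))

infixl 7 _÷_[_]

_÷_[_] : ℝ → (y : ℝ) → 0ℝ < y → ℝ
x ÷ y [ 0<y ] = x * inverse y 0<y

infix 4 _⟶_ _⟶∞

_⟶_ : (ℕ → ℝ) → ℝ → Set
a ⟶ L = ∀ ε → 0ℝ < ε → ∃[ K ] ∀ k → K ℕ.≤ k → ∣ a k - L ∣ < ε

_⟶∞ : (ℕ → ℕ) → Set
N ⟶∞ = ∀ M → ∃[ K ] ∀ k → K ℕ.≤ k → M ℕ.≤ N k

record Finite (A : Set) : Set where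
  field
    elements : List A
    unique   : Unique elements
    complete : ∀ a → a ∈ elements

#_ : ∀ {A} → Finite A → ℕ
# fin = List.length (Finite.elements fin)

module _ {A : Set} {P : A → Set} (P? : Decidable P) where

  restrict : List A → List (Refinement A P)
  restrict []       = []
  restrict (x ∷ xs) with P? x
  ... | yes p = (x , [ p ]) ∷ restrict xs
  ... | no  _ = restrict xs

  ∈-restrict : ∀ {y xs} → value y ∈ xs → y ∈ restrict xs
  ∈-restrict {y , [ p ]} {x ∷ xs} y∈ with P? x | y∈
  ... | yes _ | here refl = here refl
  ... | yes _ | there y∈′ = there (∈-restrict y∈′)
  ... | no ¬p | here refl = contradiction (recompute (P? y) p) ¬p
  ... | no _  | there y∈′ = ∈-restrict y∈′

  restrict-≢ : ∀ {x} .(p : P x) {xs} → All (x ≢_) xs → All ((x , [ p ]) ≢_) (restrict xs)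
  restrict-≢ p {[]}     []         = []
  restrict-≢ p {y ∷ xs} (x≢y ∷ x≢) with P? y
  ... | yes _ = x≢y ∘ cong value ∷ restrict-≢ p x≢
  ... | no  _ = restrict-≢ p x≢

  restrict-unique : ∀ {xs} → Unique xs → Unique (restrict xs)
  restrict-unique {[]}     []       = []
  restrict-unique {x ∷ xs} (x≢ ∷ u) with P? x
  ... | yes p = restrict-≢ p x≢ ∷ restrict-unique u
  ... | no  _ = restrict-unique u

module _ {A : Set} where

  choices : ∀ {n} → (Fin n → List A) → List (Vec A n)
  choices {zero}  f = [] ∷ []
  choices {suc n} f = List.cartesianProductWith _∷_ (f zero) (choices (f ∘ suc))

  choices-unique : ∀ {n} {f : Fin n → List A} → (∀ i → Unique (f i)) → Unique (choices f)
  choices-unique {zero}  u = [] ∷ []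
  choices-unique {suc n} u =
    Unique.cartesianProductWith⁺ _∷_ ∷-injective (u zero) (choices-unique (u ∘ suc))

  ∈-choices : ∀ {n} {f : Fin n → List A} v → (∀ i → lookup v i ∈ f i) → v ∈ choices f
  ∈-choices []      h = here refl
  ∈-choices (x ∷ v) h =
    ∈.∈-cartesianProductWith⁺ _∷_ (h zero) (∈-choices v (h ∘ suc))

module _ {A B : Set} {f : A → List B} where

  concatMap-unique : (∀ x → Unique (f x)) → (∀ {x y z} → z ∈ f x → z ∈ f y → x ≡ y) →
                     ∀ {xs} → Unique xs → Unique (List.concatMap f xs)
  concatMap-unique u disjoint {xs} xs! = Unique.concat⁺
    (All.map⁺ (All.universal u xs))
    (AllPairs.map⁺ (AllPairs.map (λ x≢y {_} (z∈x , z∈y) → x≢y (disjoint z∈x z∈y)) xs!))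

  ∈-concatMap : ∀ {x y xs} → x ∈ xs → y ∈ f x → y ∈ List.concatMap f xs
  ∈-concatMap x∈xs y∈fx = ∈.∈-concat⁺′ y∈fx (∈.∈-map⁺ f x∈xs)

refinement-finite : ∀ {A} {P : A → Set} → Decidable P → (xs : List A) → Unique xs →
                    (∀ x → P x → x ∈ xs) → Finite (Refinement A P)
refinement-finite {A} {P} P? xs u covers = record
  { elements = restrict P? candidates
  ; unique   = restrict-unique P? (Unique.filter⁺ P? u)
  ; complete = λ (x , [ p ]) →
      let p = recompute (P? x) p in ∈-restrict P? (∈.∈-filter⁺ P? (covers x p) p)
  }
  where candidates = List.filter P? xs

Sig : ℕ → Set
Sig N = Refinement (Vec ℤ N) (Linked ℤ._≥_)

infixl 9 _!_

_!_ : ∀ {N} → Sig N → Fin N → ℤ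
ν ! i = lookup (value ν) i

infix 4 _≺_

_≺_ : ∀ {N} → Sig N → Sig (suc N) → Set
κ ≺ ν = ∀ i → ν ! inject₁ i ℤ.≥ κ ! i × κ ! i ℤ.≥ ν ! suc i

data Chain {K} (κ : Sig K) : ∀ {N} → Sig N → Set where
  start : Chain κ κ
  step  : ∀ {N} {ρ : Sig N} {ν : Sig (suc N)} → Chain κ ρ → .(ρ ≺ ν) → Chain κ ν

_≟Sig_ : ∀ {N} → DecidableEquality (Sig N)
(u , _) ≟Sig (v , _) = map′ (λ { refl → refl }) (cong value) (≡-dec ℤ._≟_ u v)

_≺?_ : ∀ {N} (κ : Sig N) (ν : Sig (suc N)) → Dec (κ ≺ ν)
κ ≺? ν = Fin.all? λ i → (_ ℤ.≤? _) ×-dec (_ ℤ.≤? _)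

module ℤ-group = GroupProperties (AbelianGroup.group ℤ.+-0-abelianGroup)

interval : ℤ → ℤ → List ℤ
interval a b = List.map (λ k → a ℤ.+ + k) (List.upTo (suc ℤ.∣ b ℤ.- a ∣))

interval-unique : ∀ a b → Unique (interval a b)
interval-unique a b =
  Unique.map⁺ (ℤ.+-injective ∘ ℤ-group.∙-cancelˡ a _ _) (Unique.upTo⁺ _)

∈-interval : ∀ {a b c} → a ℤ.≤ c → c ℤ.≤ b → c ∈ interval a b
∈-interval {a} {b} {c} a≤c c≤b = subst (_∈ interval a b) a+k≡c
  (∈.∈-map⁺ (λ k → a ℤ.+ + k) (∈.∈-upTo⁺ (s≤s (ℤ.drop‿+≤+ k≤))))
  where
  0≤c-a = ℤ.i≤j⇒0≤j-i a≤c
  k : ℕ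
  k = ℤ.∣ c ℤ.- a ∣
  a+k≡c : a ℤ.+ + k ≡ c
  a+k≡c = begin
    a ℤ.+ + k         ≡⟨ cong (λ z → a ℤ.+ z) (ℤ.0≤i⇒+∣i∣≡i 0≤c-a) ⟩
    a ℤ.+ (c ℤ.- a)   ≡⟨ ℤ.+-comm a (c ℤ.- a) ⟩
    c ℤ.- a ℤ.+ a     ≡⟨ ℤ.+-assoc c (ℤ.- a) a ⟩
    c ℤ.+ (ℤ.- a ℤ.+ a) ≡⟨ cong (λ z → c ℤ.+ z) (ℤ.+-inverseˡ a) ⟩
    c ℤ.+ ℤ.0ℤ        ≡⟨ ℤ.+-identityʳ c ⟩
    c                 ∎
    where open ≡-Reasoning
  k≤ : + k ℤ.≤ + ℤ.∣ b ℤ.- a ∣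
  k≤ = subst₂ ℤ._≤_ (sym (ℤ.0≤i⇒+∣i∣≡i 0≤c-a))
    (sym (ℤ.0≤i⇒+∣i∣≡i (ℤ.i≤j⇒0≤j-i (ℤ.≤-trans a≤c c≤b))))
    (ℤ.+-monoˡ-≤ (ℤ.- a) c≤b)

below : ∀ {N} (ν : Sig (suc N)) → Finite (Refinement (Sig N) (_≺ ν))
below ν = refinement-finite (_≺? ν)
  (restrict decreasing? candidates)
  (restrict-unique decreasing? (choices-unique λ i → interval-unique (ν ! suc i) (ν ! inject₁ i)))
  (λ κ κ≺ν → ∈-restrict decreasing?
    (∈-choices (value κ) λ i → ∈-interval (proj₂ (κ≺ν i)) (proj₁ (κ≺ν i))))
  where
  decreasing? = Linked.linked? (flip ℤ._≤?_)
  candidates  = choices λ i → interval (ν ! suc i) (ν ! inject₁ i)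

K≤N : ∀ {K N} {κ : Sig K} {ν : Sig N} → Chain κ ν → K ℕ.≤ N
K≤N start      = ℕ.≤-refl
K≤N (step c _) = ℕ.m≤n⇒m≤1+n (K≤N c)

starts : ∀ {K} (κ : Sig K) {N} (ν : Sig N) → List (Chain κ ν)
starts {K} κ {N} ν with K ℕ.≟ N
... | no  _    = []
... | yes refl with κ ≟Sig ν
...   | no  _    = []
...   | yes refl = start ∷ []

chains : ∀ {K} (κ : Sig K) {N} (ν : Sig N) → List (Chain κ ν)
steps  : ∀ {K} (κ : Sig K) {N} (ν : Sig (suc N)) → Refinement (Sig N) (_≺ ν) → List (Chain κ ν)

chains κ {zero}  ν = starts κ ν
chains κ {suc N} ν =
  starts κ ν List.++ List.concatMap (steps κ ν) (Finite.elements (below ν))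
steps κ ν (ρ , [ ρ≺ν ]) = List.map (λ c → step c ρ≺ν) (chains κ ρ)

∈-starts : ∀ {K} (κ : Sig K) → start ∈ starts κ κ
∈-starts {K} κ with K ℕ.≟ K
... | no  K≢K  = contradiction refl K≢K
... | yes refl with κ ≟Sig κ
...   | no  κ≢κ  = contradiction refl κ≢κ
...   | yes refl = here refl

∈-starts⁻ : ∀ {K} {κ : Sig K} {N} {ν : Sig N} {c} → c ∈ starts κ ν → K ≡ N
∈-starts⁻ {K} {κ} {N} {ν} c∈ with K ℕ.≟ N
... | yes K≡N = K≡N

starts-unique : ∀ {K} (κ : Sig K) {N} (ν : Sig N) → Unique (starts κ ν)
starts-unique {K} κ {N} ν with K ℕ.≟ N
... | no  _    = []
... | yes refl with κ ≟Sig ν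
...   | no  _    = []
...   | yes refl = [] ∷ []

starts⊆chains : ∀ {K} (κ : Sig K) {N} (ν : Sig N) {c} → c ∈ starts κ ν → c ∈ chains κ ν
starts⊆chains κ {zero}  ν c∈ = c∈
starts⊆chains κ {suc N} ν c∈ = ∈.∈-++⁺ˡ c∈

∈-chains : ∀ {K} {κ : Sig K} {N} {ν : Sig N} (c : Chain κ ν) → c ∈ chains κ ν
∈-chains {κ = κ} start = starts⊆chains κ κ (∈-starts κ)
∈-chains {κ = κ} {ν = ν} (step {ρ = ρ} c ρ≺ν) = ∈.∈-++⁺ʳ (starts κ ν)
  (∈-concatMap (Finite.complete (below ν) (ρ , [ ρ≺ν ])) (∈.∈-map⁺ _ (∈-chains c)))

penultimate : ∀ {K} {κ : Sig K} {N} {ν : Sig (suc N)} → Chain κ ν → Maybe (Sig N)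
penultimate start              = nothing
penultimate (step {ρ = ρ} _ _) = just ρ

step-injective : ∀ {K} {κ : Sig K} {N} {ρ : Sig N} {ν : Sig (suc N)} {c d : Chain κ ρ}
                 .{p q : ρ ≺ ν} → step {ν = ν} c p ≡ step d q → c ≡ d
step-injective refl = refl

∈-steps⁻ : ∀ {K} {κ : Sig K} {N} {ν : Sig (suc N)} {c} ρ → c ∈ steps κ ν ρ →
           penultimate c ≡ just (value ρ) × K ℕ.≤ N
∈-steps⁻ {κ = κ} (ρ , [ p ]) c∈ with ∈.∈-map⁻ (λ c → step c p) c∈
... | d , _ , refl = refl , K≤N d

value-injective : ∀ {A : Set} {P : A → Set} {x y : Refinement A P} →
                  value x ≡ value y → x ≡ y
value-injective {x = _ , _} {_ , _} refl = refl

chains-unique : ∀ {K} (κ : Sig K) {N} (ν : Sig N) → Unique (chains κ ν)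
chains-unique κ {zero}  ν = starts-unique κ ν
chains-unique {K} κ {suc N} ν = Unique.++⁺ (starts-unique κ ν)
  (concatMap-unique {f = steps κ ν}
    (λ (ρ , [ p ]) → Unique.map⁺ step-injective (chains-unique κ ρ))
    (λ {ρ} {σ} ∈ρ ∈σ → value-injective (just-injective
      (trans (sym (proj₁ (∈-steps⁻ ρ ∈ρ))) (proj₁ (∈-steps⁻ σ ∈σ)))))
    (Finite.unique (below ν)))
  λ (c∈starts , c∈steps) →
    let ρ , c∈ρ , _ = split c∈steps
    in ℕ.<-irrefl (∈-starts⁻ c∈starts) (s≤s (proj₂ (∈-steps⁻ ρ c∈ρ)))
  where
  split : ∀ {c} → c ∈ List.concatMap (steps κ ν) (Finite.elements (below ν)) →
          ∃[ ρ ] c ∈ steps κ ν ρ × ρ ∈ Finite.elements (below ν)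
  split c∈ with ∈.∈-concat⁻′ (List.map (steps κ ν) (Finite.elements (below ν))) c∈
  ... | cs , c∈cs , cs∈ with ∈.∈-map⁻ (steps κ ν) cs∈
  ...   | ρ , ρ∈ , refl = ρ , c∈cs , ρ∈

chain-finite : ∀ {K} (κ : Sig K) {N} (ν : Sig N) → Finite (Chain κ ν)
chain-finite κ ν = record
  { elements = chains κ ν ; unique = chains-unique κ ν ; complete = ∈-chains }

Dim₂ : ∀ {K N} → Sig K → Sig N → ℕ
Dim₂ κ ν = # chain-finite κ ν

open FiniteSum ℚ.*-1-commutativeMonoid public using () renaming (sum to ∏)

-- Indices start from 0, which leaves j - i unchanged.
weylFactor : ∀ {N} → Sig N → (j : Fin N) → Fin′ j → ℚ
weylFactor ν j i =
  ℚ._/_ (ν ! inject i ℤ.- ν ! j ℤ.- + toℕ i ℤ.+ + toℕ j) (toℕ j ℕ.∸ toℕ i)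
    {{ℕ.>-nonZero (ℕ.m<n⇒0<n∸m (toℕ<n i))}}

Dim : ∀ {N} → Sig N → ℚ
Dim {N} ν = ∏ {N} λ j → ∏ {toℕ j} λ i → weylFactor ν j i

∏-positive : ∀ {n} (f : Fin n → ℚ) → (∀ i → 0ℚ ℚ.< f i) → 0ℚ ℚ.< ∏ f
∏-positive {zero}  f 0<f = ℚ.positive⁻¹ 1ℚ
∏-positive {suc n} f 0<f = *-pos (0<f zero) (∏-positive (f ∘ suc) (0<f ∘ suc))

/-positive : ∀ i n .{{_ : ℕ.NonZero n}} → ℤ.0ℤ ℤ.< i → 0ℚ ℚ.< i ℚ./ n
/-positive (+ suc m) n _ = ℚ.positive⁻¹ _ {{ℚ.normalize-pos (suc m) n}}
/-positive (+ zero)  n (ℤ.+<+ ())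

antitone : ∀ {N} (ν : Sig N) {i j} → i Fin.< j → ν ! j ℤ.≤ ν ! i
antitone (v , [ v↓ ]) =
  Linked.lookup⁺ (flip ℤ.≤-trans) (recompute (Linked.linked? (flip ℤ._≤?_) v) v↓)

Dim-positive : ∀ {N} (ν : Sig N) → 0ℚ ℚ.< Dim ν
Dim-positive ν = ∏-positive _ λ j → ∏-positive (weylFactor ν j) λ i →
  let i<j = subst (ℕ._< toℕ j) (sym (Fin.toℕ-inject i)) (toℕ<n i)
  in /-positive _ (toℕ j ℕ.∸ toℕ i) {{ℕ.>-nonZero (ℕ.m<n⇒0<n∸m (toℕ<n i))}}
    (subst (ℤ.0ℤ ℤ.<_) (sym (ℤ.+-assoc (ν ! inject i ℤ.- ν ! j) (ℤ.- + toℕ i) (+ toℕ j)))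
      (ℤ.+-mono-≤-< (ℤ.i≤j⇒0≤j-i (antitone ν i<j))
        (subst (ℤ._< ℤ.- + toℕ i ℤ.+ + toℕ j) (ℤ.+-inverseˡ (+ toℕ i))
          (ℤ.+-monoʳ-< (ℤ.- + toℕ i) (ℤ.+<+ (toℕ<n i))))))

Λ : ∀ {N K} → Sig N → Sig K → ℚ
Λ ν κ = ℚ._÷_ (Dim κ ℚ.* (+ Dim₂ κ ν ℚ./ 1)) (Dim ν) {{nonZero-pos (Dim-positive ν)}}

row : List ℕ → ℕ → ℕ
row []       _       = 0
row (x ∷ xs) zero    = x
row (x ∷ xs) (suc i) = row xs i

record YoungDiagram : Set where
  constructor diagram
  field
    rows       : List ℕ
    decreasing : ListLinked.Linked ℕ._≥_ rows
    nonzero    : All ℕ.NonZero rows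

open YoungDiagram public

∅ : YoungDiagram
∅ = diagram [] ListLinked.[] []

infixl 9 _‼_

_‼_ : YoungDiagram → ℕ → ℕ
α ‼ i = row (rows α) i

ℓ size : YoungDiagram → ℕ
ℓ α    = List.length (rows α)
size α = sum (rows α)

infix 4 _⊆_ _⊆?_

_⊆_ : YoungDiagram → YoungDiagram → Set
β ⊆ α = ∀ i → β ‼ i ℕ.≤ α ‼ i

rows⊆? : ∀ ys xs → Dec (∀ i → row ys i ℕ.≤ row xs i)
rows⊆? []       xs       = yes λ _ → z≤n
rows⊆? (y ∷ ys) []       = map′
  (λ (y≤ , ys≤) → λ { zero → y≤ ; (suc i) → ys≤ i })
  (λ le → le zero , le ∘ suc)
  (y ℕ.≤? 0 ×-dec rows⊆? ys [])
rows⊆? (y ∷ ys) (x ∷ xs) = map′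
  (λ (y≤ , ys≤) → λ { zero → y≤ ; (suc i) → ys≤ i })
  (λ le → le zero , le ∘ suc)
  (y ℕ.≤? x ×-dec rows⊆? ys xs)

_⊆?_ : ∀ β α → Dec (β ⊆ α)
β ⊆? α = rows⊆? (rows β) (rows α)

-- (α₁,…,α_N): α padded with zeros if N ≥ ℓ α, truncated otherwise.
signature : ∀ {N} → YoungDiagram → Sig N
signature {N} α = tabulate (λ i → + (α ‼ toℕ i)) ,
  [ tabulated N (λ i → + (α ‼ i)) (λ i → ℤ.+≤+ (row-antitone (decreasing α) i)) ]
  where
  row-antitone : ∀ {xs} → ListLinked.Linked ℕ._≥_ xs → ∀ i → row xs (suc i) ℕ.≤ row xs i
  row-antitone ListLinked.[]          i       = z≤n
  row-antitone ListLinked.[-]         i       = z≤n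
  row-antitone (x≥y ListLinked.∷ _)   zero    = x≥y
  row-antitone (_   ListLinked.∷ xs↓) (suc i) = row-antitone xs↓ i

  tabulated : ∀ n (f : ℕ → ℤ) → (∀ i → f i ℤ.≥ f (suc i)) →
              Linked ℤ._≥_ (tabulate {n = n} (f ∘ toℕ))
  tabulated zero          f f↓ = []
  tabulated (suc zero)    f f↓ = [-]
  tabulated (suc (suc n)) f f↓ = f↓ 0 ∷ tabulated (suc n) (f ∘ suc) (f↓ ∘ suc)

-- The boxes (i , j) of α / β, rows and columns counted from 0.
rowBoxes : YoungDiagram → YoungDiagram → ℕ → List (ℕ × ℕ)
rowBoxes α β i = List.applyUpTo (λ k → i , β ‼ i ℕ.+ k) (α ‼ i ℕ.∸ β ‼ i)

boxes : YoungDiagram → YoungDiagram → List (ℕ × ℕ)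
boxes α β = List.concatMap (rowBoxes α β) (List.upTo (ℓ α))

-- A filling assigns to the a-th box the a-th entry of a vector; the
-- numbers placed in the n boxes are 0,…,n-1 rather than 1,…,n.
record IsStandard (bs : List (ℕ × ℕ)) (T : Vec (Fin (List.length bs)) (List.length bs)) : Set where
  constructor isStandard
  field
    injective : ∀ a b → lookup T a ≡ lookup T b → a ≡ b
    along-rows : ∀ a b → proj₁ (List.lookup bs a) ≡ proj₁ (List.lookup bs b) →
      proj₂ (List.lookup bs a) ℕ.< proj₂ (List.lookup bs b) → lookup T a Fin.< lookup T b
    along-columns : ∀ a b → proj₂ (List.lookup bs a) ≡ proj₂ (List.lookup bs b) →
      proj₁ (List.lookup bs a) ℕ.< proj₁ (List.lookup bs b) → lookup T a Fin.< lookup T b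

StandardTableau : YoungDiagram → YoungDiagram → Set
StandardTableau α β = Refinement _ (IsStandard (boxes α β))

isStandard? : ∀ bs → Decidable (IsStandard bs)
isStandard? bs T = map′ (λ (p , q , r) → isStandard p q r)
  (λ (isStandard p q r) → p , q , r)
  ( Fin.all? (λ a → Fin.all? λ b → (lookup T a Fin.≟ lookup T b) →-dec (a Fin.≟ b))
  ×-dec Fin.all? (λ a → Fin.all? λ b →
    (_ ℕ.≟ _) →-dec ((_ ℕ.<? _) →-dec (_ Fin.<? _)))
  ×-dec Fin.all? (λ a → Fin.all? λ b →
    (_ ℕ.≟ _) →-dec ((_ ℕ.<? _) →-dec (_ Fin.<? _))))

tableau-finite : ∀ α β → Finite (StandardTableau α β)
tableau-finite α β = refinement-finite (isStandard? (boxes α β))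
  (choices λ _ → List.allFin _) (choices-unique λ _ → Unique.allFin⁺ _)
  λ T _ → ∈-choices T λ _ → ∈.∈-allFin _

skewDim : YoungDiagram → YoungDiagram → ℕ
skewDim α β = # tableau-finite α β

dim : YoungDiagram → ℕ
dim α = skewDim α ∅

-- dim α ≠ 0, since numbering the boxes in reading order gives a
-- standard tableau.
data _⊏_ : ℕ × ℕ → ℕ × ℕ → Set where
  row< : ∀ {i i′ j j′} → i ℕ.< i′ → (i , j) ⊏ (i′ , j′)
  col< : ∀ {i j j′} → j ℕ.< j′ → (i , j) ⊏ (i , j′)

⊏-asym : ∀ {p q} → p ⊏ q → ¬ (q ⊏ p)
⊏-asym (row< p) (row< q) = ℕ.<-asym p q
⊏-asym (row< p) (col< q) = ℕ.<-irrefl refl p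
⊏-asym (col< p) (row< q) = ℕ.<-irrefl refl q
⊏-asym (col< p) (col< q) = ℕ.<-asym p q

boxes-sorted : ∀ α β → AllPairs _⊏_ (boxes α β)
boxes-sorted α β = AllPairs.concat⁺
  (All.map⁺ (All.universal
    (λ i → AllPairs.applyUpTo⁺₁ _ _ λ k<l _ → col< (ℕ.+-monoʳ-< (β ‼ i) k<l)) (List.upTo (ℓ α))))
  (AllPairs.map⁺ (AllPairs.applyUpTo⁺₁ id (ℓ α) λ i<i′ _ →
    All.applyUpTo⁺₂ _ _ λ _ → All.applyUpTo⁺₂ _ _ λ _ → row< i<i′))

sorted-lookup : ∀ {bs} → AllPairs _⊏_ bs → ∀ {a b} → a Fin.< b →
                List.lookup bs a ⊏ List.lookup bs b
sorted-lookup (p ∷ _)  {zero}  {suc b} _         = All.lookup p (∈.∈-lookup b)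
sorted-lookup (_ ∷ ps) {suc a} {suc b} (s≤s a<b) = sorted-lookup ps a<b

reading-order : ∀ {bs} → AllPairs _⊏_ bs → IsStandard bs (Vec.allFin _)
reading-order {bs} sorted = isStandard
  (λ a b eq → trans (sym (lookup-allFin a)) (trans eq (lookup-allFin b)))
  (λ a b eq lt → ordered (subst (λ i → List.lookup bs a ⊏ (i , _)) eq (col< lt)))
  (λ a b _ lt → ordered (row< lt))
  where
  ordered : ∀ {a b} → List.lookup bs a ⊏ List.lookup bs b →
            lookup (Vec.allFin _) a Fin.< lookup (Vec.allFin _) b
  ordered {a} {b} a⊏b = subst₂ Fin._<_ (sym (lookup-allFin a)) (sym (lookup-allFin b)) a<b
    where
    a<b : a Fin.< b
    a<b with Fin.<-cmp a b
    ... | tri< lt _ _   = lt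
    ... | tri≈ _ refl _ = contradiction a⊏b (⊏-asym a⊏b)
    ... | tri> _ _ gt   = contradiction (sorted-lookup sorted gt) (⊏-asym a⊏b)

#-nonZero : ∀ {A} (fin : Finite A) → A → ℕ.NonZero (# fin)
#-nonZero fin a with Finite.elements fin | Finite.complete fin a
... | _ ∷ _ | _ = _

dim-nonZero : ∀ α → ℕ.NonZero (dim α)
dim-nonZero α = #-nonZero (tableau-finite α ∅)
  (Vec.allFin _ , [ reading-order (boxes-sorted α ∅) ])

YBΛ : (r′ r : ℝ) → 0ℝ < r → r < r′ → YoungDiagram → YoungDiagram → ℝ
YBΛ r′ r 0<r r<r′ α β = if does (β ⊆? α) then link else 0ℝ
  where
  q    = r ÷ r′ [ <-trans {0ℝ} {r} {r′} 0<r r<r′ ]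
  link = fromℕ (size α C size β) * q ^ size β * (1ℝ - q) ^ (size α ℕ.∸ size β)
       * fromℚ (ℚ._/_ (+ (dim β ℕ.* skewDim α β)) (dim α) {{dim-nonZero α}})

{-# OPTIONS --safe #-}

-- Write G(ν) = ∏_{i<j} (l_i - l_j) / ∏ l_i! with l_i = ν_i + L - i, which does
-- not depend on L ≥ ℓ(ν).  The Weyl formula for Dim_N ν is G(ν) times a product
-- of |ν| factors N + O(1), so Dim_N ν ~ G(ν) N^|ν|.  Moreover dim ν = |ν|! G(ν):
-- both sides satisfy the same recursion over the removal of a box, which for G
-- comes from the partial fraction expansion of ∏_j (1 - 1/(z - l_j)).
--
-- A chain from μ to λ of length k adds a horizontal strip at each step.  Removing
-- the boxes of λ/μ one at a time shows, with d = |λ/μ|, that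
--   dim(λ/μ) C(k,d) ≤ Dim_{N,N+k}(μ,λ) ≤ dim(λ/μ) C(k+d-1,d),
-- and both bounds are asymptotic to dim(λ/μ) k^d / d!.  With k = N' - N and
-- N/N' → r/r', the powers of N, N' - N and N' combine to the stated limit.
module Submission where

open import Defs
open import Algebra.Bundles using (CommutativeRing)
import Algebra.Properties.CommutativeMonoid.Sum as CommutativeMonoidSum
import Algebra.Properties.Semiring.Sum as SemiringSum
open import Data.Bool.Base using (true; if_then_else_)
open import Data.Empty using (⊥; ⊥-elim)
open import Data.Fin.Base as Fin using (Fin; zero; suc; toℕ; fromℕ<; inject; inject₁; punchIn;
  punchOut)
open import Data.Fin.Permutation using (↔⇒≡)
open import Data.Fin.Properties as Fin using (toℕ<n)
open import Data.Integer.Base as ℤ using (ℤ; +_)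
open import Data.Integer.Properties as ℤ using ()
open import Data.Irrelevant using (Irrelevant; [_])
open import Data.List.Base as List using (List; []; _∷_)
open import Data.List.Membership.Propositional using (_∈_)
import Data.List.Membership.Propositional.Properties as ∈
import Data.List.Properties as List
import Data.List.Relation.Unary.All as All
open import Data.List.Relation.Unary.AllPairs using (_∷_)
import Data.List.Relation.Unary.Any as Any
import Data.List.Relation.Unary.Any.Properties as Any
import Data.List.Relation.Unary.Linked as ListLinked
open import Data.List.Relation.Unary.Unique.Propositional using (Unique)
open import Data.Maybe.Base using (Maybe; just; nothing)
open import Data.Nat.Base as ℕ using (ℕ; zero; suc; z≤n; s≤s; _!)
open import Data.Nat.Combinatorics using (_C_; nCk≡n!/k![n-k]!; k![n∸k]!∣n!)
open import Data.Nat.DivMod using (m/n*n≡m)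
open import Data.Nat.ListAction using (sum)
open import Data.Nat.Properties as ℕ using ()
open import Data.Nat.Tactic.RingSolver using (solve-∀)
open import Data.Product.Base using (Σ; _×_; _,_; proj₁; proj₂; ∃; ∃-syntax)
open import Data.Product.Function.Dependent.Propositional using (Σ-↔)
open import Data.Product.Function.NonDependent.Propositional using (_×-↔_)
open import Data.Rational.Base as ℚ using (ℚ; 0ℚ; 1ℚ; ½)
open import Data.Rational.Properties as ℚ using ()
open import Data.Rational.Solver using (module +-*-Solver)
import Data.Rational.Unnormalised.Base as ℚᵘ
import Data.Rational.Unnormalised.Properties as ℚᵘ
open import Data.Refinement.Base using (Refinement; value; _,_)
open import Data.Sum.Base using (_⊎_; inj₁; inj₂)
open import Data.Sum.Function.Propositional using (_⊎-↔_)
open import Data.Unit.Base using (⊤; tt)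
open import Data.Vec.Base as Vec using (Vec; []; _∷_; lookup; tabulate)
import Data.Vec.Properties as Vec
open import Data.Vec.Relation.Unary.Linked using (Linked; []; [-]; _∷_)
open import Function.Base using (_∘_; id)
open import Function.Bundles using (_↔_; mk↔ₛ′; mk⤖; _↣_; mk↣; Inverse; Injection)
open import Function.Consequences.Propositional using (strictlySurjective⇒surjective)
open import Function.Properties.Bijection using (⤖⇒↔)
open import Function.Properties.Inverse using (↔-sym; ↔-trans; ↔⇒↣)
open import Relation.Binary.Definitions using (tri<; tri≈; tri>)
open import Relation.Binary.PropositionalEquality
open import Relation.Nullary.Decidable using (Dec; yes; no; does; recompute; dec-true; _×-dec_;
  _⊎-dec_; _→-dec_; ¬?)
open import Relation.Nullary.Negation using (¬_; contradiction)
open import Relation.Unary using (Decidable)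

open +-*-Solver using (solve; _:=_; _:+_; _:*_; :-_; _:-_; con)
open CommutativeMonoidSum ℚ.*-1-commutativeMonoid using ()
  renaming (sum-cong-≗ to ∏-cong; ∑-distrib-+ to ∏-distrib-*; sum-init-last to ∏-init-last)
open SemiringSum (CommutativeRing.semiring ℚ.+-*-commutativeRing) using ()
  renaming (sum to ∑; sum-cong-≗ to ∑-cong; *-distribˡ-sum to *-distribˡ-∑; ∑-distrib-+ to
    ∑-distrib-+)
open CommutativeMonoidSum ℕ.+-0-commutativeMonoid using ()
  renaming (sum to ∑ℕ; sum-cong-≗ to ∑ℕ-cong; ∑-distrib-+ to ∑ℕ-distrib-+)
open CommutativeMonoidSum ℕ.*-1-commutativeMonoid using () renaming (sum to ∏ℕ)

-- The definitions count fillings of boxes and chains of signatures. Both can be taken apart one box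
-- at a time, so a single number, `paths`, counts the orders in which the boxes of a skew shape can
-- be removed, and the other counts are compared with it by bijections or injections. Horizontal
-- strips are why `Dim₂` is only bracketed: how many boxes a step may add depends on the shape, but
-- to leading order in k the d boxes fall at different steps.
--
-- Shapes are functions on ℕ with a bound L on their support: dropping the first row is `a ∘ suc`,
-- and one function serves as a signature of every length.
--
-- The limit is not computed in ℝ, where `inverse` discards initial terms and equality is only up to
-- null sequences. Rational sequences are compared by `_⇝_` with the sequence underlying the real;
-- this relation is closed under products, powers and, given a bound, reciprocals. `_⟶_` is met only
-- at the two ends.

-- Opaque, as is inv, because unfolding exposes the normalisation of fractions.
opaque
  fromℤ : ℤ → ℚ
  fromℤ i = i ℚ./ 1

  fromℤ-/1 : ∀ i → i ℚ./ 1 ≡ fromℤ i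
  fromℤ-/1 i = refl

-- Integers and naturals inside the rationals

ι : ℕ → ℚ
ι n = fromℤ (+ n)

ι-0 : ι 0 ≡ 0ℚ
ι-0 = sym (fromℤ-/1 (+ 0))

ι-1 : ι 1 ≡ 1ℚ
ι-1 = sym (fromℤ-/1 (+ 1))

toℚᵘ-fromℤ : ∀ i → ℚ.toℚᵘ (fromℤ i) ℚᵘ.≃ ℚᵘ.mkℚᵘ i 0
toℚᵘ-fromℤ i = subst (λ q → ℚ.toℚᵘ q ℚᵘ.≃ ℚᵘ.mkℚᵘ i 0) (fromℤ-/1 i) (ℚ.toℚᵘ-fromℚᵘ (ℚᵘ.mkℚᵘ i 0))

fromℤ-+ : ∀ i j → fromℤ (i ℤ.+ j) ≡ fromℤ i ℚ.+ fromℤ j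
fromℤ-+ i j = ℚ.toℚᵘ-injective (begin
  ℚ.toℚᵘ (fromℤ (i ℤ.+ j))                       ≈⟨ toℚᵘ-fromℤ (i ℤ.+ j) ⟩
  ℚᵘ.mkℚᵘ (i ℤ.+ j) 0
    ≈⟨ ℚᵘ.*≡* (cong (ℤ._* ℤ.1ℤ) (sym (cong₂ ℤ._+_ (ℤ.*-identityʳ i) (ℤ.*-identityʳ j)))) ⟩
  ℚᵘ.mkℚᵘ i 0 ℚᵘ.+ ℚᵘ.mkℚᵘ j 0                   ≈⟨ ℚᵘ.+-cong (toℚᵘ-fromℤ i) (toℚᵘ-fromℤ j) ⟨
  ℚ.toℚᵘ (fromℤ i) ℚᵘ.+ ℚ.toℚᵘ (fromℤ j)         ≈⟨ ℚ.toℚᵘ-homo-+ (fromℤ i) (fromℤ j) ⟨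
  ℚ.toℚᵘ (fromℤ i ℚ.+ fromℤ j)                   ∎)
  where open ℚᵘ.≃-Reasoning

fromℤ-* : ∀ i j → fromℤ (i ℤ.* j) ≡ fromℤ i ℚ.* fromℤ j
fromℤ-* i j = ℚ.toℚᵘ-injective (begin
  ℚ.toℚᵘ (fromℤ (i ℤ.* j))                       ≈⟨ toℚᵘ-fromℤ (i ℤ.* j) ⟩
  ℚᵘ.mkℚᵘ i 0 ℚᵘ.* ℚᵘ.mkℚᵘ j 0                   ≈⟨ ℚᵘ.*-cong (toℚᵘ-fromℤ i) (toℚᵘ-fromℤ j) ⟨
  ℚ.toℚᵘ (fromℤ i) ℚᵘ.* ℚ.toℚᵘ (fromℤ j)         ≈⟨ ℚ.toℚᵘ-homo-* (fromℤ i) (fromℤ j) ⟨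
  ℚ.toℚᵘ (fromℤ i ℚ.* fromℤ j)                   ∎)
  where open ℚᵘ.≃-Reasoning

fromℤ-neg : ∀ i → fromℤ (ℤ.- i) ≡ ℚ.- fromℤ i
fromℤ-neg i = ℚ.toℚᵘ-injective (begin
  ℚ.toℚᵘ (fromℤ (ℤ.- i))     ≈⟨ toℚᵘ-fromℤ (ℤ.- i) ⟩
  ℚᵘ.- ℚᵘ.mkℚᵘ i 0           ≈⟨ ℚᵘ.-‿cong (toℚᵘ-fromℤ i) ⟨
  ℚᵘ.- ℚ.toℚᵘ (fromℤ i)      ≈⟨ ℚ.toℚᵘ-homo‿- (fromℤ i) ⟨
  ℚ.toℚᵘ (ℚ.- fromℤ i)       ∎)
  where open ℚᵘ.≃-Reasoning

/-*-cancel : ∀ i n .{{_ : ℕ.NonZero n}} → i ℚ./ n ℚ.* ι n ≡ fromℤ i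
/-*-cancel i n@(suc n-1) = ℚ.toℚᵘ-injective (begin
  ℚ.toℚᵘ (i ℚ./ n ℚ.* ι n)                  ≈⟨ ℚ.toℚᵘ-homo-* (i ℚ./ n) (ι n) ⟩
  ℚ.toℚᵘ (i ℚ./ n) ℚᵘ.* ℚ.toℚᵘ (ι n)
    ≈⟨ ℚᵘ.*-cong (ℚ.toℚᵘ-fromℚᵘ (ℚᵘ.mkℚᵘ i n-1)) (toℚᵘ-fromℤ (+ n)) ⟩
  ℚᵘ.mkℚᵘ i n-1 ℚᵘ.* ℚᵘ.mkℚᵘ (+ n) 0        ≈⟨ ℚᵘ.*≡* (ℤ.*-assoc i (+ n) ℤ.1ℤ) ⟩
  ℚᵘ.mkℚᵘ i 0                               ≈⟨ toℚᵘ-fromℤ i ⟨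
  ℚ.toℚᵘ (fromℤ i)                          ∎)
  where open ℚᵘ.≃-Reasoning

ι-+ : ∀ m n → ι (m ℕ.+ n) ≡ ι m ℚ.+ ι n
ι-+ m n = fromℤ-+ (+ m) (+ n)

ι-* : ∀ m n → ι (m ℕ.* n) ≡ ι m ℚ.* ι n
ι-* m n = trans (cong fromℤ (ℤ.pos-* m n)) (fromℤ-* (+ m) (+ n))

ι-suc : ∀ n → ι (suc n) ≡ 1ℚ ℚ.+ ι n
ι-suc n = trans (ι-+ 1 n) (cong (ℚ._+ ι n) ι-1)

0≤ι : ∀ n → 0ℚ ℚ.≤ ι n
0≤ι n = subst (0ℚ ℚ.≤_) (fromℤ-/1 (+ n)) (ℚ.nonNegative⁻¹ _ {{ℚ.normalize-nonNeg n 1}})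

ι-mono : ∀ {m n} → m ℕ.≤ n → ι m ℚ.≤ ι n
ι-mono {m} {n} m≤n = subst₂ ℚ._≤_ (ℚ.+-identityʳ (ι m))
  (trans (sym (ι-+ m (n ℕ.∸ m))) (cong ι (ℕ.m+[n∸m]≡n m≤n)))
  (ℚ.+-monoʳ-≤ (ι m) (0≤ι (n ℕ.∸ m)))

0<ι : ∀ n .{{_ : ℕ.NonZero n}} → 0ℚ ℚ.< ι n
0<ι (suc n) = ℚ.<-≤-trans (ℚ.positive⁻¹ 1ℚ) (subst (ℚ._≤ ι (suc n)) ι-1
  (ι-mono {1} {suc n} (s≤s z≤n)))

ι-mono-< : ∀ {m n} → m ℕ.< n → ι m ℚ.< ι n
ι-mono-< {m} {n} m<n = ℚ.<-≤-trans (subst₂ ℚ._<_ (ℚ.+-identityˡ (ι m)) (sym (ι-suc m))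
  (ℚ.+-monoˡ-< (ι m) (ℚ.positive⁻¹ 1ℚ))) (ι-mono m<n)

-- A total reciprocal on ℚ

opaque
  -- Total, with value 0 at 0, so that products such as `weight` can be written down before the
  -- differences in them are known to be nonzero.
  inv : ℚ → ℚ
  inv p with p ℚ.≟ 0ℚ
  ... | yes _  = 0ℚ
  ... | no p≢0 = ℚ.1/_ p {{ℚ.≢-nonZero p≢0}}

  *-inv : ∀ {p} → p ≢ 0ℚ → p ℚ.* inv p ≡ 1ℚ
  *-inv {p} p≢0 with p ℚ.≟ 0ℚ
  ... | yes p≡0 = contradiction p≡0 p≢0
  ... | no p≢0′ = ℚ.*-inverseʳ p {{ℚ.≢-nonZero p≢0′}}

>⇒≢0 : ∀ {p} → 0ℚ ℚ.< p → p ≢ 0ℚ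
>⇒≢0 0<p refl = ℚ.<-irrefl refl 0<p

ι≢0 : ∀ n .{{_ : ℕ.NonZero n}} → ι n ≢ 0ℚ
ι≢0 n = >⇒≢0 (0<ι n)

*-cancelʳ : ∀ {p q r} → r ≢ 0ℚ → p ℚ.* r ≡ q ℚ.* r → p ≡ q
*-cancelʳ {p} {q} {r} r≢0 eq = begin
  p                      ≡⟨ expand p ⟨
  p ℚ.* r ℚ.* inv r      ≡⟨ cong (ℚ._* inv r) eq ⟩
  q ℚ.* r ℚ.* inv r      ≡⟨ expand q ⟩
  q                      ∎
  where
  open ≡-Reasoning
  expand : ∀ x → x ℚ.* r ℚ.* inv r ≡ x
  expand x = trans (ℚ.*-assoc x r (inv r))
    (trans (cong (x ℚ.*_) (*-inv r≢0)) (ℚ.*-identityʳ x))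

*≢0 : ∀ {p q} → p ≢ 0ℚ → q ≢ 0ℚ → p ℚ.* q ≢ 0ℚ
*≢0 {p} {q} p≢0 q≢0 pq≡0 = p≢0 (*-cancelʳ q≢0 (trans pq≡0 (sym (ℚ.*-zeroˡ q))))

inv-unique : ∀ {p q} → p ≢ 0ℚ → p ℚ.* q ≡ 1ℚ → q ≡ inv p
inv-unique {p} {q} p≢0 eq = *-cancelʳ p≢0
  (trans (ℚ.*-comm q p) (trans eq (sym (trans (ℚ.*-comm (inv p) p) (*-inv p≢0)))))

inv-* : ∀ {p q} → p ≢ 0ℚ → q ≢ 0ℚ → inv p ℚ.* inv q ≡ inv (p ℚ.* q)
inv-* {p} {q} p≢0 q≢0 = inv-unique (*≢0 p≢0 q≢0) (begin
  p ℚ.* q ℚ.* (inv p ℚ.* inv q)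
    ≡⟨ solve 4 (λ p q p′ q′ → p :* q :* (p′ :* q′) := p :* p′ :* (q :* q′)) refl p q (inv p)
      (inv q) ⟩
  p ℚ.* inv p ℚ.* (q ℚ.* inv q)   ≡⟨ cong₂ ℚ._*_ (*-inv p≢0) (*-inv q≢0) ⟩
  1ℚ                              ∎)
  where open ≡-Reasoning

0<inv : ∀ {p} → 0ℚ ℚ.< p → 0ℚ ℚ.< inv p
0<inv {p} 0<p = subst (0ℚ ℚ.<_)
  (inv-unique (>⇒≢0 0<p) (ℚ.*-inverseʳ p {{nonZero-pos 0<p}}))
  (ℚ.positive⁻¹ _ {{ℚ.1/pos⇒pos p {{ℚ.positive 0<p}}}})

inv-1 : inv 1ℚ ≡ 1ℚ
inv-1 = sym (inv-unique (>⇒≢0 (ℚ.positive⁻¹ 1ℚ)) refl)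

-- Partial fractions and their residues

∑-linear : ∀ {n} α β γ (f g h : Fin n → ℚ) →
  ∑ (λ i → α ℚ.* f i ℚ.+ β ℚ.* g i ℚ.+ γ ℚ.* h i) ≡ α ℚ.* ∑ f ℚ.+ β ℚ.* ∑ g ℚ.+ γ ℚ.* ∑ h
∑-linear α β γ f g h = begin
  ∑ (λ i → α ℚ.* f i ℚ.+ β ℚ.* g i ℚ.+ γ ℚ.* h i)
    ≡⟨ ∑-distrib-+ (λ i → α ℚ.* f i ℚ.+ β ℚ.* g i) (λ i → γ ℚ.* h i) ⟩
  ∑ (λ i → α ℚ.* f i ℚ.+ β ℚ.* g i) ℚ.+ ∑ (λ i → γ ℚ.* h i)
    ≡⟨ cong (ℚ._+ _) (∑-distrib-+ (λ i → α ℚ.* f i) (λ i → β ℚ.* g i)) ⟩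
  ∑ (λ i → α ℚ.* f i) ℚ.+ ∑ (λ i → β ℚ.* g i) ℚ.+ ∑ (λ i → γ ℚ.* h i)
    ≡⟨ cong₂ ℚ._+_ (cong₂ ℚ._+_ (*-distribˡ-∑ α f) (*-distribˡ-∑ β g)) (*-distribˡ-∑ γ h) ⟨
  α ℚ.* ∑ f ℚ.+ β ℚ.* ∑ g ℚ.+ γ ℚ.* ∑ h ∎
  where open ≡-Reasoning

-≢0 : ∀ {p q} → p ≢ q → p ℚ.- q ≢ 0ℚ
-≢0 {p} {q} p≢q eq = p≢q (begin
  p               ≡⟨ p-q+q p q ⟨
  p ℚ.- q ℚ.+ q   ≡⟨ cong (ℚ._+ q) eq ⟩
  0ℚ ℚ.+ q        ≡⟨ ℚ.+-identityˡ q ⟩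
  q               ∎)
  where open ≡-Reasoning

Distinct : ∀ {n} → (Fin n → ℚ) → Set
Distinct l = ∀ i j → i ≢ j → l i ≢ l j

tail-distinct : ∀ {n} {l : Fin (suc n) → ℚ} → Distinct l → Distinct (l ∘ suc)
tail-distinct l! i j i≢j = l! (suc i) (suc j) (i≢j ∘ Fin.suc-injective)

shiftRatio : ∀ {n} → ℚ → (Fin n → ℚ) → ℚ
shiftRatio z l = ∏ λ j → 1ℚ ℚ.- inv (z ℚ.- l j)

-- weight l i is ∏_{j ≠ i} (l i - 1 - l j) / (l i - l j).
weight : ∀ {n} → (Fin n → ℚ) → Fin n → ℚ
weight l zero    = shiftRatio (l zero) (l ∘ suc)
weight l (suc i) = weight (l ∘ suc) i ℚ.* (1ℚ ℚ.+ inv (l zero ℚ.- l (suc i)))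

-- The partial fractions in z of 1/((z - x)(z - y)), solved for the product that does not contain z
-- - y. The proof writes z - y as (z - x) - (y - x).
inv-partial : ∀ {x y z} → x ≢ y → x ≢ z → y ≢ z →
  inv (y ℚ.- x) ℚ.* inv (z ℚ.- x) ≡ inv (z ℚ.- y) ℚ.* (inv (y ℚ.- x) ℚ.- inv (z ℚ.- x))
inv-partial {x} {y} {z} x≢y x≢z y≢z = begin
  e ℚ.* f
    ≡⟨ ℚ.*-identityˡ (e ℚ.* f) ⟨
  1ℚ ℚ.* (e ℚ.* f)
    ≡⟨ cong (ℚ._* (e ℚ.* f)) (*-inv (-≢0 (y≢z ∘ sym))) ⟨
  (z ℚ.- y) ℚ.* c ℚ.* (e ℚ.* f)
    ≡⟨ solve 6 (λ x y z c e f → (z :- y) :* c :* (e :* f) :=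
         c :* ((z :- x) :* f :* e :- (y :- x) :* e :* f)) refl x y z c e f ⟩
  c ℚ.* ((z ℚ.- x) ℚ.* f ℚ.* e ℚ.- (y ℚ.- x) ℚ.* e ℚ.* f)
    ≡⟨ cong₂ (λ u v → c ℚ.* (u ℚ.* e ℚ.- v ℚ.* f)) (*-inv (-≢0 (x≢z ∘ sym)))
      (*-inv (-≢0 (x≢y ∘ sym))) ⟩
  c ℚ.* (1ℚ ℚ.* e ℚ.- 1ℚ ℚ.* f)
    ≡⟨ cong₂ (λ u v → c ℚ.* (u ℚ.- v)) (ℚ.*-identityˡ e) (ℚ.*-identityˡ f) ⟩
  c ℚ.* (e ℚ.- f) ∎
  where
  open ≡-Reasoning
  c = inv (z ℚ.- y)
  e = inv (y ℚ.- x)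
  f = inv (z ℚ.- x)

-- Induction on the number of poles. The new pole `l zero` gets as residue the tail's product
-- evaluated there, which is `weight l zero`; by `inv-partial` each old residue is multiplied by 1 -
-- 1/(l_j - l_0), written as 1 + 1/(l_0 - l_j).
partialFractions : ∀ {n} {l : Fin n → ℚ} {z} → Distinct l → (∀ j → l j ≢ z) →
  shiftRatio z l ≡ 1ℚ ℚ.- ∑ (λ j → weight l j ℚ.* inv (z ℚ.- l j))
partialFractions {zero}      _  _   = refl
partialFractions {suc n} {l} {z} l! l≢z = begin
  (1ℚ ℚ.- c) ℚ.* shiftRatio z l′
    ≡⟨ cong ((1ℚ ℚ.- c) ℚ.*_) (partialFractions (tail-distinct l!) (l≢z ∘ suc)) ⟩
  (1ℚ ℚ.- c) ℚ.* (1ℚ ℚ.- ∑ sz)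
    -- `∑ sy` cancels on the right. It is brought in because 1 - `∑ sy` is the tail's product at
    -- `l zero`, by a second use of the induction hypothesis.
    ≡⟨ solve 3 (λ c a b → (con 1ℚ :- c) :* (con 1ℚ :- a) :=
         con 1ℚ :- ((con 1ℚ :- b) :* c :+ (con 1ℚ :* a :+ c :* b :+ (:- c) :* a)))
         refl c (∑ sz) (∑ sy) ⟩
  1ℚ ℚ.- ((1ℚ ℚ.- ∑ sy) ℚ.* c ℚ.+ (1ℚ ℚ.* ∑ sz ℚ.+ c ℚ.* ∑ sy ℚ.+ (ℚ.- c) ℚ.* ∑ sz))
    ≡⟨ cong₂ (λ u v → 1ℚ ℚ.- (u ℚ.* c ℚ.+ v))
         (partialFractions (tail-distinct l!) λ j → l! (suc j) zero λ ())
         (trans (∑-cong term) (∑-linear 1ℚ c (ℚ.- c) sz sy sz)) ⟨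
  1ℚ ℚ.- (shiftRatio (l zero) l′ ℚ.* c ℚ.+ ∑ (λ j → weight l (suc j) ℚ.* inv (z ℚ.- l (suc j)))) ∎
  where
  open ≡-Reasoning
  l′ = l ∘ suc
  c  = inv (z ℚ.- l zero)
  sz sy : Fin n → ℚ
  sz j = weight l′ j ℚ.* inv (z ℚ.- l′ j)
  sy j = weight l′ j ℚ.* inv (l zero ℚ.- l′ j)
  term : ∀ j → weight l (suc j) ℚ.* inv (z ℚ.- l (suc j)) ≡
               1ℚ ℚ.* sz j ℚ.+ c ℚ.* sy j ℚ.+ (ℚ.- c) ℚ.* sz j
  term j = begin
    w ℚ.* (1ℚ ℚ.+ e) ℚ.* f
      ≡⟨ solve 3 (λ w e f → w :* (con 1ℚ :+ e) :* f := w :* f :+ w :* (e :* f)) refl w e f ⟩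
    w ℚ.* f ℚ.+ w ℚ.* (e ℚ.* f)
      ≡⟨ cong (λ u → w ℚ.* f ℚ.+ w ℚ.* u)
           (inv-partial (l! (suc j) zero λ ()) (l≢z (suc j)) (l≢z zero)) ⟩
    w ℚ.* f ℚ.+ w ℚ.* (c ℚ.* (e ℚ.- f))
      ≡⟨ solve 4 (λ w c e f → w :* f :+ w :* (c :* (e :- f)) :=
           con 1ℚ :* (w :* f) :+ c :* (w :* e) :+ (:- c) :* (w :* f)) refl w c e f ⟩
    1ℚ ℚ.* sz j ℚ.+ c ℚ.* sy j ℚ.+ (ℚ.- c) ℚ.* sz j ∎
    where
    w = weight l′ j
    e = inv (l zero ℚ.- l′ j)
    f = inv (z ℚ.- l′ j)

-- The coefficient of 1/z at infinity in `partialFractions`. No expansion at infinity is made: the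
-- expansion of the tail at `l zero` supplies the new weight, and its sum cancels against the
-- corrections to the old weights.
∑-weight : ∀ {n} {l : Fin n → ℚ} → Distinct l → ∑ (weight l) ≡ ι n
∑-weight {zero}      _  = sym ι-0
∑-weight {suc n} {l} l! = begin
  shiftRatio (l zero) l′ ℚ.+ ∑ (λ j → weight l (suc j))
    ≡⟨ cong₂ ℚ._+_ (partialFractions (tail-distinct l!) λ j → l! (suc j) zero λ ())
         (trans (∑-cong λ j → solve 2 (λ w e → w :* (con 1ℚ :+ e) :=
                   con 1ℚ :* w :+ con 1ℚ :* (w :* e) :+ con 0ℚ :* w)
                   refl (weight l′ j) (inv (l zero ℚ.- l′ j)))
           (∑-linear 1ℚ 1ℚ 0ℚ (weight l′) s (weight l′))) ⟩
  1ℚ ℚ.- ∑ s ℚ.+ (1ℚ ℚ.* ∑ (weight l′) ℚ.+ 1ℚ ℚ.* ∑ s ℚ.+ 0ℚ ℚ.* ∑ (weight l′))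
    ≡⟨ solve 2 (λ s w → con 1ℚ :- s :+ (con 1ℚ :* w :+ con 1ℚ :* s :+ con 0ℚ :* w) :=
         con 1ℚ :+ w) refl (∑ s) (∑ (weight l′)) ⟩
  1ℚ ℚ.+ ∑ (weight l′)
    ≡⟨ cong (1ℚ ℚ.+_) (∑-weight (tail-distinct l!)) ⟩
  1ℚ ℚ.+ ι n
    ≡⟨ ι-suc n ⟨
  ι (suc n) ∎
  where
  open ≡-Reasoning
  l′ = l ∘ suc
  s : Fin n → ℚ
  s j = weight l′ j ℚ.* inv (l zero ℚ.- l′ j)

triangle : ℕ → ℕ
triangle zero    = 0
triangle (suc n) = n ℕ.+ triangle n

-- The coefficient of 1/z² at infinity, up to sign: on the product side it is the sum of the l_i
-- minus the number of pairs, which is `triangle n`.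
∑-point*weight : ∀ {n} {l : Fin n → ℚ} → Distinct l →
  ∑ (λ i → l i ℚ.* weight l i) ≡ ∑ l ℚ.- ι (triangle n)
∑-point*weight {zero}      _  = sym (cong (λ u → 0ℚ ℚ.- u) ι-0)
∑-point*weight {suc n} {l} l! = begin
  y ℚ.* shiftRatio y l′ ℚ.+ ∑ (λ j → l′ j ℚ.* weight l (suc j))
    ≡⟨ cong₂ (λ u v → y ℚ.* u ℚ.+ v) (partialFractions (tail-distinct l!) λ j →
      l! (suc j) zero λ ())
         (trans (∑-cong term) (∑-linear 1ℚ y (ℚ.- 1ℚ) xw s w)) ⟩
  y ℚ.* (1ℚ ℚ.- ∑ s) ℚ.+ (1ℚ ℚ.* ∑ xw ℚ.+ y ℚ.* ∑ s ℚ.+ (ℚ.- 1ℚ) ℚ.* ∑ w)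
    ≡⟨ solve 4 (λ y s xw w → y :* (con 1ℚ :- s) :+ (con 1ℚ :* xw :+ y :* s :+ (:- con 1ℚ) :* w) :=
         y :+ xw :- w) refl y (∑ s) (∑ xw) (∑ w) ⟩
  y ℚ.+ ∑ xw ℚ.- ∑ w
    ≡⟨ cong₂ (λ u v → y ℚ.+ u ℚ.- v) (∑-point*weight (tail-distinct l!))
      (∑-weight (tail-distinct l!)) ⟩
  y ℚ.+ (∑ l′ ℚ.- ι (triangle n)) ℚ.- ι n
    ≡⟨ solve 4 (λ y x t n → y :+ (x :- t) :- n := y :+ x :- (n :+ t)) refl
         y (∑ l′) (ι (triangle n)) (ι n) ⟩
  y ℚ.+ ∑ l′ ℚ.- (ι n ℚ.+ ι (triangle n))
    ≡⟨ cong (λ u → y ℚ.+ ∑ l′ ℚ.- u) (ι-+ n (triangle n)) ⟨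
  y ℚ.+ ∑ l′ ℚ.- ι (n ℕ.+ triangle n) ∎
  where
  open ≡-Reasoning
  y  = l zero
  l′ = l ∘ suc
  w xw s : Fin n → ℚ
  w    = weight l′
  xw j = l′ j ℚ.* w j
  s j  = w j ℚ.* inv (y ℚ.- l′ j)
  term : ∀ j → l′ j ℚ.* weight l (suc j) ≡ 1ℚ ℚ.* xw j ℚ.+ y ℚ.* s j ℚ.+ (ℚ.- 1ℚ) ℚ.* w j
  term j = begin
    x ℚ.* (w j ℚ.* (1ℚ ℚ.+ e))
      ≡⟨ solve 4 (λ x y w e → x :* (w :* (con 1ℚ :+ e)) :=
           x :* w :+ y :* (w :* e) :- (y :- x) :* e :* w) refl x y (w j) e ⟩
    x ℚ.* w j ℚ.+ y ℚ.* (w j ℚ.* e) ℚ.- (y ℚ.- x) ℚ.* e ℚ.* w j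
      ≡⟨ cong (λ u → x ℚ.* w j ℚ.+ y ℚ.* (w j ℚ.* e) ℚ.- u ℚ.* w j)
           (*-inv (-≢0 (l! zero (suc j) λ ()))) ⟩
    x ℚ.* w j ℚ.+ y ℚ.* (w j ℚ.* e) ℚ.- 1ℚ ℚ.* w j
      ≡⟨ solve 3 (λ a b w → a :+ b :- con 1ℚ :* w := con 1ℚ :* a :+ b :+ (:- con 1ℚ) :* w) refl
           (x ℚ.* w j) (y ℚ.* s j) (w j) ⟩
    1ℚ ℚ.* xw j ℚ.+ y ℚ.* s j ℚ.+ (ℚ.- 1ℚ) ℚ.* w j ∎
    where
    x = l′ j
    e = inv (y ℚ.- x)

-- Vandermonde products and lowering a point

vandermonde : ∀ {n} → (Fin n → ℚ) → ℚ
vandermonde {zero}  l = 1ℚ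
vandermonde {suc n} l = ∏ (λ j → l zero ℚ.- l (suc j)) ℚ.* vandermonde (l ∘ suc)

vandermonde-cong : ∀ {n} {l m : Fin n → ℚ} → (∀ i → l i ≡ m i) → vandermonde l ≡ vandermonde m
vandermonde-cong {zero}  l≗m = refl
vandermonde-cong {suc n} l≗m = cong₂ ℚ._*_
  (∏-cong λ j → cong₂ ℚ._-_ (l≗m zero) (l≗m (suc j))) (vandermonde-cong (l≗m ∘ suc))

lower : ∀ {n} → (Fin n → ℚ) → Fin n → Fin n → ℚ
lower l zero    zero    = l zero ℚ.- 1ℚ
lower l zero    (suc j) = l (suc j)
lower l (suc i) zero    = l zero
lower l (suc i) (suc j) = lower (l ∘ suc) i j

∏-lower : ∀ {n} {l : Fin n → ℚ} {y} i → l i ≢ y →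
  ∏ (λ j → y ℚ.- lower l i j) ≡ ∏ (λ j → y ℚ.- l j) ℚ.* (1ℚ ℚ.+ inv (y ℚ.- l i))
∏-lower {l = l} {y} zero lᵢ≢y = begin
  (y ℚ.- (x ℚ.- 1ℚ)) ℚ.* p
    ≡⟨ solve 3 (λ x y p → (y :- (x :- con 1ℚ)) :* p := (y :- x) :* p :+ con 1ℚ :* p) refl x y p ⟩
  (y ℚ.- x) ℚ.* p ℚ.+ 1ℚ ℚ.* p
    ≡⟨ cong (λ u → (y ℚ.- x) ℚ.* p ℚ.+ u ℚ.* p) (*-inv (-≢0 (lᵢ≢y ∘ sym))) ⟨
  (y ℚ.- x) ℚ.* p ℚ.+ (y ℚ.- x) ℚ.* e ℚ.* p
    ≡⟨ solve 4 (λ x y e p → (y :- x) :* p :+ (y :- x) :* e :* p := (y :- x) :* p :* (con 1ℚ :+ e))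
         refl x y e p ⟩
  (y ℚ.- x) ℚ.* p ℚ.* (1ℚ ℚ.+ e) ∎
  where
  open ≡-Reasoning
  x = l zero
  p = ∏ (λ j → y ℚ.- l (suc j))
  e = inv (y ℚ.- x)
∏-lower {l = l} {y} (suc i) lᵢ≢y =
  trans (cong ((y ℚ.- l zero) ℚ.*_) (∏-lower {l = l ∘ suc} i lᵢ≢y))
    (sym (ℚ.*-assoc (y ℚ.- l zero) _ _))

-- Only the differences involving l_i change, each by one factor of the weight. This is how residues
-- come to describe the removal of a box.
vandermonde-lower : ∀ {n} {l : Fin n → ℚ} → Distinct l → ∀ i →
  vandermonde (lower l i) ≡ vandermonde l ℚ.* weight l i
vandermonde-lower {suc n} {l} l! zero = begin
  ∏ (λ j → l zero ℚ.- 1ℚ ℚ.- l (suc j)) ℚ.* v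
    ≡⟨ cong (ℚ._* v) (trans (∏-cong factor) (∏-distrib-* (λ j → l zero ℚ.- l (suc j)) _)) ⟩
  p ℚ.* shiftRatio (l zero) (l ∘ suc) ℚ.* v
    ≡⟨ solve 3 (λ p r v → p :* r :* v := p :* v :* r) refl p (shiftRatio (l zero) (l ∘ suc)) v ⟩
  p ℚ.* v ℚ.* shiftRatio (l zero) (l ∘ suc) ∎
  where
  open ≡-Reasoning
  v = vandermonde (l ∘ suc)
  p = ∏ (λ j → l zero ℚ.- l (suc j))
  factor : ∀ j → l zero ℚ.- 1ℚ ℚ.- l (suc j) ≡
                 (l zero ℚ.- l (suc j)) ℚ.* (1ℚ ℚ.- inv (l zero ℚ.- l (suc j)))
  factor j = begin
    y ℚ.- 1ℚ ℚ.- x                  ≡⟨ solve 3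
      (λ x y u → y :- u :- x := (y :- x) :- u) refl x y 1ℚ ⟩
    (y ℚ.- x) ℚ.- 1ℚ                ≡⟨ cong (λ u → (y ℚ.- x) ℚ.- u)
      (*-inv (-≢0 (l! zero (suc j) λ ()))) ⟨
    (y ℚ.- x) ℚ.- (y ℚ.- x) ℚ.* inv (y ℚ.- x)
      ≡⟨ solve 2 (λ d e → d :- d :* e := d :* (con 1ℚ :- e)) refl (y ℚ.- x) (inv (y ℚ.- x)) ⟩
    (y ℚ.- x) ℚ.* (1ℚ ℚ.- inv (y ℚ.- x)) ∎
    where
    x = l (suc j)
    y = l zero
vandermonde-lower {suc n} {l} l! (suc i) = begin
  ∏ (λ j → l zero ℚ.- lower (l ∘ suc) i j) ℚ.* vandermonde (lower (l ∘ suc) i)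
    ≡⟨ cong₂ ℚ._*_ (∏-lower {l = l ∘ suc} i (l! (suc i) zero λ ()))
         (vandermonde-lower (tail-distinct l!) i) ⟩
  p ℚ.* (1ℚ ℚ.+ e) ℚ.* (v ℚ.* w)
    ≡⟨ solve 4 (λ p e v w → p :* (con 1ℚ :+ e) :* (v :* w) := p :* v :* (w :* (con 1ℚ :+ e)))
         refl p e v w ⟩
  p ℚ.* v ℚ.* (w ℚ.* (1ℚ ℚ.+ e)) ∎
  where
  open ≡-Reasoning
  p = ∏ (λ j → l zero ℚ.- l (suc j))
  e = inv (l zero ℚ.- l (suc i))
  v = vandermonde (l ∘ suc)
  w = weight (l ∘ suc) i

-- Removing boxes from a skew shape

removeBox : (ℕ → ℕ) → ℕ → ℕ → ℕ
removeBox a zero    zero    = ℕ.pred (a 0)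
removeBox a zero    (suc j) = a (suc j)
removeBox a (suc i) zero    = a 0
removeBox a (suc i) (suc j) = removeBox (a ∘ suc) i j

removeBox-same : ∀ a i → removeBox a i i ≡ ℕ.pred (a i)
removeBox-same a zero    = refl
removeBox-same a (suc i) = removeBox-same (a ∘ suc) i

removeBox-other : ∀ a {i j} → i ≢ j → removeBox a i j ≡ a j
removeBox-other a {zero}  {zero}  i≢j = contradiction refl i≢j
removeBox-other a {zero}  {suc j} i≢j = refl
removeBox-other a {suc i} {zero}  i≢j = refl
removeBox-other a {suc i} {suc j} i≢j = removeBox-other (a ∘ suc) (i≢j ∘ cong suc)

Removable : ℕ → (ℕ → ℕ) → (ℕ → ℕ) → ℕ → Set
Removable L b a i = i ℕ.< L × b i ℕ.< a i × a (suc i) ℕ.< a i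

removable? : ∀ L b a i → Dec (Removable L b a i)
removable? L b a i = i ℕ.<? L ×-dec b i ℕ.<? a i ×-dec a (suc i) ℕ.<? a i

-- A diagram is given by its row lengths, of which only the first L may be
-- nonzero; b is the inner diagram, which is never to be cut into.
paths : ℕ → (ℕ → ℕ) → ℕ → (ℕ → ℕ) → ℕ
paths L b zero    a = 1
paths L b (suc d) a = ∑ℕ {L} λ i →
  if does (removable? L b a (toℕ i)) then paths L b d (removeBox a (toℕ i)) else 0

Antitone : (ℕ → ℕ) → Set
Antitone a = ∀ i → a (suc i) ℕ.≤ a i

antitone-≤ : ∀ {a i j} → Antitone a → i ℕ.≤ j → a j ℕ.≤ a i
antitone-≤ {a} a↓ i≤j = go (ℕ.≤⇒≤′ i≤j)
  where
  go : ∀ {i j} → i ℕ.≤′ j → a j ℕ.≤ a i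
  go ℕ.≤′-refl       = ℕ.≤-refl
  go (ℕ.≤′-step i≤j) = ℕ.≤-trans (a↓ _) (go i≤j)

-- With `rows↓`, the field `support` empties all rows from L on, so that `excess`, a sum over the
-- first L rows, is the number of boxes between b and a.
record Skew (L : ℕ) (b : ℕ → ℕ) (d : ℕ) (a : ℕ → ℕ) : Set where
  constructor skew
  field
    rows↓    : Antitone a
    support  : a L ≡ 0
    contains : ∀ i → b i ℕ.≤ a i
    excess   : ∑ℕ {L} (λ i → a (toℕ i) ℕ.∸ b (toℕ i)) ≡ d

removeBox-antitone : ∀ {a i} → Antitone a → a (suc i) ℕ.< a i → Antitone (removeBox a i)
removeBox-antitone {a} {i} a↓ lt j with i ℕ.≟ j | i ℕ.≟ suc j
... | yes refl | yes ()
... | yes refl | no i≢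
  rewrite removeBox-same a i | removeBox-other a i≢ = ℕ.<⇒≤pred lt
... | no i≢ | yes refl
  rewrite removeBox-same a (suc j) | removeBox-other a i≢ = ℕ.≤-trans ℕ.pred[n]≤n (a↓ j)
... | no i≢ | no i≢′
  rewrite removeBox-other a i≢ | removeBox-other a i≢′ = a↓ j

∑-removeBox : ∀ {L} (a b : ℕ → ℕ) {i} → i ℕ.< L → b i ℕ.< a i →
  ∑ℕ {L} (λ j → a (toℕ j) ℕ.∸ b (toℕ j)) ≡
  suc (∑ℕ {L} (λ j → removeBox a i (toℕ j) ℕ.∸ b (toℕ j)))
∑-removeBox {suc L} a b {zero}  _ lt with a 0 | lt
... | suc x | s≤s b≤x = cong (ℕ._+ ∑ℕ {L} (λ j → a (suc (toℕ j)) ℕ.∸ b (suc (toℕ j))))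
  (ℕ.+-∸-assoc 1 b≤x)
∑-removeBox {suc L} a b {suc i} (s≤s i<L) lt =
  trans (cong (a 0 ℕ.∸ b 0 ℕ.+_) (∑-removeBox (a ∘ suc) (b ∘ suc) i<L lt)) (ℕ.+-suc (a 0 ℕ.∸ b 0) _)

skew-remove : ∀ {L b d a i} → Skew L b (suc d) a → Removable L b a i → Skew L b d (removeBox a i)
skew-remove {L} {b} {d} {a} {i} (skew a↓ aL b≤a ex) (i<L , bi<ai , lt) = skew
  (removeBox-antitone a↓ lt)
  (trans (removeBox-other a (ℕ.<⇒≢ i<L)) aL)
  contained
  (ℕ.suc-injective (trans (sym (∑-removeBox a b i<L bi<ai)) ex))
  where
  contained : ∀ j → b j ℕ.≤ removeBox a i j
  contained j with i ℕ.≟ j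
  ... | yes refl rewrite removeBox-same a i  = ℕ.<⇒≤pred bi<ai
  ... | no i≢j   rewrite removeBox-other a i≢j = b≤a j

-- The shifted rows l_i and the recursion for G

points : ∀ L → (ℕ → ℕ) → Fin L → ℚ
points L a i = ι (a (toℕ i) ℕ.+ (L ℕ.∸ suc (toℕ i)))

-- The limit of Dim a / N^|a| as N → ∞.
growth : ℕ → (ℕ → ℕ) → ℚ
growth L a = vandermonde (points L a) ℚ.*
  ∏ {L} λ i → inv (ι ((a (toℕ i) ℕ.+ (L ℕ.∸ suc (toℕ i))) !))

points-decreasing : ∀ {L a} → Antitone a → ∀ {i j : Fin L} → i Fin.< j → points L a j ℚ.<
  points L a i
points-decreasing a↓ {i} {j} i<j = ι-mono-<
  (ℕ.+-mono-≤-< (antitone-≤ a↓ (ℕ.<⇒≤ i<j)) (ℕ.∸-monoʳ-< (s≤s i<j) (toℕ<n j)))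

points-distinct : ∀ {L a} → Antitone a → Distinct (points L a)
points-distinct {L} {a} a↓ i j i≢j eq with Fin.<-cmp i j
... | tri< i<j _ _  = ℚ.<-irrefl (sym eq) (points-decreasing a↓ i<j)
... | tri≈ _ i≡j _  = i≢j i≡j
... | tri> _ _ j<i  = ℚ.<-irrefl eq (points-decreasing a↓ j<i)

-- `removeBox` and `lower` follow the same recursion. The hypothesis `0 < a i` makes `pred` a true
-- subtraction of 1.
points-lower : ∀ {L} a (i j : Fin L) → 0 ℕ.< a (toℕ i) →
  points L (removeBox a (toℕ i)) j ≡ lower (points L a) i j
points-lower {suc L} a zero zero 0<a with a 0 | 0<a
... | suc x | _ = sym (trans (cong (ℚ._- 1ℚ) (ι-suc (x ℕ.+ L)))
  (solve 1 (λ x → con 1ℚ :+ x :- con 1ℚ := x) refl (ι (x ℕ.+ L))))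
points-lower a zero    (suc j) 0<a = refl
points-lower a (suc i) zero    0<a = refl
points-lower a (suc i) (suc j) 0<a = points-lower (a ∘ suc) i j 0<a

inv-! : ∀ n → inv (ι (n !)) ≡ inv (ι (suc n !)) ℚ.* ι (suc n)
inv-! n = *-cancelʳ (ι≢0 (suc n !) {{ℕ._!≢0 (suc n)}}) (begin
  inv (ι (n !)) ℚ.* ι (suc n !)
    ≡⟨ cong (inv (ι (n !)) ℚ.*_) (ι-* (suc n) (n !)) ⟩
  inv (ι (n !)) ℚ.* (ι (suc n) ℚ.* ι (n !))
    ≡⟨ solve 3 (λ i s f → i :* (s :* f) := f :* i :* s) refl (inv (ι (n !))) (ι (suc n)) (ι (n !)) ⟩
  ι (n !) ℚ.* inv (ι (n !)) ℚ.* ι (suc n)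
    ≡⟨ cong (ℚ._* ι (suc n)) (trans (*-inv (ι≢0 (n !) {{ℕ._!≢0 n}}))
         (sym (*-inv (ι≢0 (suc n !) {{ℕ._!≢0 (suc n)}})))) ⟩
  ι (suc n !) ℚ.* inv (ι (suc n !)) ℚ.* ι (suc n)
    ≡⟨ solve 3 (λ f i s → f :* i :* s := i :* s :* f) refl (ι (suc n !)) (inv (ι (suc n !)))
      (ι (suc n)) ⟩
  inv (ι (suc n !)) ℚ.* ι (suc n) ℚ.* ι (suc n !) ∎)
  where open ≡-Reasoning

∏-factorials-remove : ∀ {L} a (i : Fin L) → 0 ℕ.< a (toℕ i) →
  ∏ {L} (λ j → inv (ι ((removeBox a (toℕ i) (toℕ j) ℕ.+ (L ℕ.∸ suc (toℕ j))) !))) ≡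
  ∏ {L} (λ j → inv (ι ((a (toℕ j) ℕ.+ (L ℕ.∸ suc (toℕ j))) !))) ℚ.* points L a i
∏-factorials-remove {suc L} a zero 0<a with a 0 | 0<a
... | suc x | _ = trans (cong (ℚ._* p) (inv-! (x ℕ.+ L)))
  (solve 3 (λ i s p → i :* s :* p := i :* p :* s) refl
    (inv (ι (suc (x ℕ.+ L) !))) (ι (suc (x ℕ.+ L))) p)
  where p = ∏ {L} λ j → inv (ι ((a (suc (toℕ j)) ℕ.+ (L ℕ.∸ suc (toℕ j))) !))
∏-factorials-remove {suc L} a (suc i) 0<a =
  trans (cong (inv (ι ((a 0 ℕ.+ L) !)) ℚ.*_) (∏-factorials-remove (a ∘ suc) i 0<a))
    (sym (ℚ.*-assoc (inv (ι ((a 0 ℕ.+ L) !))) _ _))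

-- The Vandermonde product acquires the weight, and the denominator l_i! becomes (l_i - 1)!, which
-- contributes the factor l_i.
growth-remove : ∀ {L a} → Antitone a → (i : Fin L) → 0 ℕ.< a (toℕ i) →
  growth L (removeBox a (toℕ i)) ≡ growth L a ℚ.* (points L a i ℚ.* weight (points L a) i)
growth-remove {L} {a} a↓ i 0<a = begin
  growth L (removeBox a (toℕ i))
    ≡⟨ cong₂ ℚ._*_ (trans (vandermonde-cong λ j → points-lower a i j 0<a)
                     (vandermonde-lower (points-distinct a↓) i))
         (∏-factorials-remove a i 0<a) ⟩
  vandermonde (points L a) ℚ.* weight (points L a) i ℚ.* (p ℚ.* points L a i)
    ≡⟨ solve 4 (λ v w p x → v :* w :* (p :* x) := v :* p :* (x :* w)) refl
         (vandermonde (points L a)) (weight (points L a) i) p (points L a i) ⟩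
  growth L a ℚ.* (points L a i ℚ.* weight (points L a) i) ∎
  where
  open ≡-Reasoning
  p = ∏ {L} λ i → inv (ι ((a (toℕ i) ℕ.+ (L ℕ.∸ suc (toℕ i))) !))

-- A row as long as the next one cannot lose a box, and here its term vanishes by itself. If it is
-- not the last of the L rows, then l_i - l_(i+1) = 1 and the factor 1 - 1/(l_i - l_(i+1)) of the
-- weight is 0; in the last row `a L ≡ 0` makes the point 0. Hence a sum over removable rows may run
-- over all rows.
point*weight≡0 : ∀ {L} a (i : Fin L) → a (suc (toℕ i)) ≡ a (toℕ i) → a L ≡ 0 →
  points L a i ℚ.* weight (points L a) i ≡ 0ℚ
point*weight≡0 {suc zero} a zero eq a1 rewrite sym eq | a1 | ι-0 = refl
point*weight≡0 {suc (suc L)} a zero eq _ =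
  trans (cong (points (suc (suc L)) a zero ℚ.*_) (trans (cong (ℚ._* r) vanish) (ℚ.*-zeroˡ r)))
    (ℚ.*-zeroʳ (points (suc (suc L)) a zero))
  where
  r = shiftRatio (points (suc (suc L)) a zero) (λ j → points (suc (suc L)) a (suc (suc j)))
  difference : points (suc (suc L)) a zero ℚ.- points (suc (suc L)) a (suc zero) ≡ 1ℚ
  difference = begin
    ι (a 0 ℕ.+ suc L) ℚ.- ι (a 1 ℕ.+ L)
      ≡⟨ cong₂ (λ x y → ι x ℚ.- ι (y ℕ.+ L)) (ℕ.+-suc (a 0) L) eq ⟩
    ι (suc (a 0 ℕ.+ L)) ℚ.- ι (a 0 ℕ.+ L)
      ≡⟨ cong (ℚ._- ι (a 0 ℕ.+ L)) (ι-suc (a 0 ℕ.+ L)) ⟩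
    1ℚ ℚ.+ ι (a 0 ℕ.+ L) ℚ.- ι (a 0 ℕ.+ L)
      ≡⟨ p+q-q 1ℚ (ι (a 0 ℕ.+ L)) ⟩
    1ℚ ∎
    where open ≡-Reasoning
  vanish : 1ℚ ℚ.- inv (points (suc (suc L)) a zero ℚ.- points (suc (suc L)) a (suc zero)) ≡ 0ℚ
  vanish = cong (λ x → 1ℚ ℚ.- x) (trans (cong inv difference) inv-1)
point*weight≡0 {suc L} a (suc i) eq aL = begin
  x ℚ.* (w ℚ.* u)     ≡⟨ ℚ.*-assoc x w u ⟨
  x ℚ.* w ℚ.* u       ≡⟨ cong (ℚ._* u) (point*weight≡0 (a ∘ suc) i eq aL) ⟩
  0ℚ ℚ.* u            ≡⟨ ℚ.*-zeroˡ u ⟩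
  0ℚ                  ∎
  where
  open ≡-Reasoning
  x = points L (a ∘ suc) i
  w = weight (points L (a ∘ suc)) i
  u = 1ℚ ℚ.+ inv (points (suc L) a zero ℚ.- x)

ι-∑ : ∀ {n} (f : Fin n → ℕ) → ι (∑ℕ f) ≡ ∑ (ι ∘ f)
ι-∑ {zero}  f = ι-0
ι-∑ {suc n} f = trans (ι-+ (f zero) (∑ℕ (f ∘ suc))) (cong (ι (f zero) ℚ.+_) (ι-∑ (f ∘ suc)))

-- The shifts L - 1, ..., 0 contained in the points add up to `triangle L`.
∑-points : ∀ L a → ∑ (points L a) ℚ.- ι (triangle L) ≡ ι (∑ℕ {L} (a ∘ toℕ))
∑-points zero    a = trans (cong (λ u → 0ℚ ℚ.- u) ι-0) (sym ι-0)
∑-points (suc L) a = begin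
  ι (a 0 ℕ.+ L) ℚ.+ ∑ (points L (a ∘ suc)) ℚ.- ι (L ℕ.+ triangle L)
    ≡⟨ cong₂ (λ u v → u ℚ.+ ∑ (points L (a ∘ suc)) ℚ.- v) (ι-+ (a 0) L) (ι-+ L (triangle L)) ⟩
  ι (a 0) ℚ.+ ι L ℚ.+ ∑ (points L (a ∘ suc)) ℚ.- (ι L ℚ.+ ι (triangle L))
    ≡⟨ solve 4 (λ a l p t → a :+ l :+ p :- (l :+ t) := a :+ (p :- t)) refl
         (ι (a 0)) (ι L) (∑ (points L (a ∘ suc))) (ι (triangle L)) ⟩
  ι (a 0) ℚ.+ (∑ (points L (a ∘ suc)) ℚ.- ι (triangle L))
    ≡⟨ cong (ι (a 0) ℚ.+_) (∑-points L (a ∘ suc)) ⟩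
  ι (a 0) ℚ.+ ι (∑ℕ {L} (a ∘ suc ∘ toℕ))
    ≡⟨ ι-+ (a 0) _ ⟨
  ι (∑ℕ {suc L} (a ∘ toℕ)) ∎
  where open ≡-Reasoning

-- An extra empty row raises every earlier point by 1 and adds the point 0. Differences of earlier
-- points persist, and the new difference l_i + 1 cancels against the passage from l_i! to (l_i +
-- 1)!.
growth-suc : ∀ L a → a L ≡ 0 → growth (suc L) a ≡ growth L a
growth-suc zero    a a0 rewrite a0 | ι-1 | inv-1 = refl
growth-suc (suc L) a aL = begin
  ∏ f ℚ.* v ℚ.* (inv (ι (x !)) ℚ.* q)
    ≡⟨ cong (λ u → u ℚ.* v ℚ.* (inv (ι (x !)) ℚ.* q)) peel ⟩
  ∏ g ℚ.* ι (suc (a 0 ℕ.+ L)) ℚ.* v ℚ.* (inv (ι (x !)) ℚ.* q)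
    ≡⟨ solve 5 (λ g s v i q → g :* s :* v :* (i :* q) := g :* (i :* s) :* (v :* q)) refl
         (∏ g) (ι (suc (a 0 ℕ.+ L))) v (inv (ι (x !))) q ⟩
  ∏ g ℚ.* (inv (ι (x !)) ℚ.* ι (suc (a 0 ℕ.+ L))) ℚ.* growth (suc L) (a ∘ suc)
    ≡⟨ cong₂ (λ u v → ∏ g ℚ.* u ℚ.* v)
         (trans (cong (λ y → inv (ι (y !)) ℚ.* ι (suc (a 0 ℕ.+ L))) (ℕ.+-suc (a 0) L))
           (sym (inv-! (a 0 ℕ.+ L))))
         (growth-suc L (a ∘ suc) aL) ⟩
  ∏ g ℚ.* inv (ι ((a 0 ℕ.+ L) !)) ℚ.* (v′ ℚ.* q′)
    ≡⟨ solve 4 (λ g i v q → g :* i :* (v :* q) := g :* v :* (i :* q)) refl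
         (∏ g) (inv (ι ((a 0 ℕ.+ L) !))) v′ q′ ⟩
  ∏ g ℚ.* v′ ℚ.* (inv (ι ((a 0 ℕ.+ L) !)) ℚ.* q′) ∎
  where
  open ≡-Reasoning
  x  = a 0 ℕ.+ suc L
  f : Fin (suc L) → ℚ
  f j = ι x ℚ.- points (suc L) (a ∘ suc) j
  g : Fin L → ℚ
  g j = ι (a 0 ℕ.+ L) ℚ.- points L (a ∘ suc) j
  v  = vandermonde (points (suc L) (a ∘ suc))
  q  = ∏ {suc L} λ j → inv (ι ((a (suc (toℕ j)) ℕ.+ (suc L ℕ.∸ suc (toℕ j))) !))
  v′ = vandermonde (points L (a ∘ suc))
  q′ = ∏ {L} λ j → inv (ι ((a (suc (toℕ j)) ℕ.+ (L ℕ.∸ suc (toℕ j))) !))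
  earlier : ∀ j → f (inject₁ j) ≡ g j
  earlier j = begin
    ι x ℚ.- ι (a (suc (toℕ (inject₁ j))) ℕ.+ (L ℕ.∸ toℕ (inject₁ j)))
      ≡⟨ cong₂ (λ y k → ι y ℚ.- ι (a (suc k) ℕ.+ (L ℕ.∸ k))) (ℕ.+-suc (a 0) L) (Fin.toℕ-inject₁ j) ⟩
    ι (suc (a 0 ℕ.+ L)) ℚ.- ι (a (suc (toℕ j)) ℕ.+ (L ℕ.∸ toℕ j))
      ≡⟨ cong (λ y → ι (suc (a 0 ℕ.+ L)) ℚ.- ι y)
           (trans (cong (a (suc (toℕ j)) ℕ.+_) (ℕ.+-∸-assoc 1 (toℕ<n j)))
             (ℕ.+-suc (a (suc (toℕ j))) _)) ⟩
    ι (suc (a 0 ℕ.+ L)) ℚ.- ι (suc (a (suc (toℕ j)) ℕ.+ (L ℕ.∸ suc (toℕ j))))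
      ≡⟨ cong₂ ℚ._-_ (ι-suc (a 0 ℕ.+ L)) (ι-suc (a (suc (toℕ j)) ℕ.+ (L ℕ.∸ suc (toℕ j)))) ⟩
    1ℚ ℚ.+ ι (a 0 ℕ.+ L) ℚ.- (1ℚ ℚ.+ points L (a ∘ suc) j)
      ≡⟨ solve 3 (λ u x y → u :+ x :- (u :+ y) := x :- y) refl
           1ℚ (ι (a 0 ℕ.+ L)) (points L (a ∘ suc) j) ⟩
    g j ∎
  final : f (Fin.fromℕ L) ≡ ι (suc (a 0 ℕ.+ L))
  final = begin
    ι x ℚ.- ι (a (suc (toℕ (Fin.fromℕ L))) ℕ.+ (L ℕ.∸ toℕ (Fin.fromℕ L)))
      ≡⟨ cong₂ (λ y k → ι y ℚ.- ι (a (suc k) ℕ.+ (L ℕ.∸ k))) (ℕ.+-suc (a 0) L) (Fin.toℕ-fromℕ L) ⟩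
    ι (suc (a 0 ℕ.+ L)) ℚ.- ι (a (suc L) ℕ.+ (L ℕ.∸ L))
      ≡⟨ cong₂ (λ y z → ι (suc (a 0 ℕ.+ L)) ℚ.- ι (y ℕ.+ z)) aL (ℕ.n∸n≡0 L) ⟩
    ι (suc (a 0 ℕ.+ L)) ℚ.- ι 0
      ≡⟨ trans (cong (λ u → ι (suc (a 0 ℕ.+ L)) ℚ.- u) ι-0) (ℚ.+-identityʳ (ι (suc (a 0 ℕ.+ L)))) ⟩
    ι (suc (a 0 ℕ.+ L)) ∎
  peel : ∏ f ≡ ∏ g ℚ.* ι (suc (a 0 ℕ.+ L))
  peel = trans (∏-init-last f) (cong₂ ℚ._*_ (∏-cong earlier) final)

growth-stable : ∀ {L a} → Antitone a → a L ≡ 0 → ∀ {N} → L ℕ.≤ N → growth N a ≡ growth L a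
growth-stable {L} {a} a↓ aL = go ∘ ℕ.≤⇒≤′
  where
  go : ∀ {N} → L ℕ.≤′ N → growth N a ≡ growth L a
  go ℕ.≤′-refl        = refl
  go (ℕ.≤′-step L≤N) = trans (growth-suc _ a (ℕ.n≤0⇒n≡0
    (subst (a _ ℕ.≤_) aL (antitone-≤ a↓ (ℕ.≤′⇒≤ L≤N))))) (go L≤N)

-- By `growth-remove` a removable row i contributes n! G l_i w_i, and the same expression is 0 for
-- the other rows. So the recursion of `paths` becomes the full sum of the l_i w_i, which is |a| = n
-- + 1.
paths-growth : ∀ {L n a} → Skew L (λ _ → 0) n a → ι (paths L (λ _ → 0) n a) ≡ ι (n !) ℚ.* growth L a
paths-growth {L} {zero} {a} (skew a↓ aL _ sum≡0) =
  trans ι-1 (sym (trans (cong (ℚ._* growth L a) ι-1)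
    -- Without boxes already `a 0` is 0, so G can be evaluated with no rows at all, where it
    -- computes to 1.
    (trans (ℚ.*-identityˡ (growth L a)) (growth-stable {0} a↓ (first L aL sum≡0) {L} z≤n))))
  where
  first : ∀ L → a L ≡ 0 → ∑ℕ {L} (a ∘ toℕ) ≡ 0 → a 0 ≡ 0
  first zero    aL _  = aL
  first (suc L) _  eq = ℕ.m+n≡0⇒m≡0 (a 0) eq
paths-growth {L} {suc n} {a} s@(skew a↓ aL _ sum≡n) = begin
  ι (∑ℕ {L} λ i → if does (removable? L (λ _ → 0) a (toℕ i)) then paths L (λ _ → 0) n
    (removeBox a (toℕ i)) else 0)
    ≡⟨ trans (ι-∑ {L} (λ i → if does (removable? L (λ _ → 0) a (toℕ i)) then paths L (λ _ → 0) n
      (removeBox a (toℕ i)) else 0)) (∑-cong term) ⟩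
  ∑ (λ i → ι (n !) ℚ.* growth L a ℚ.* (points L a i ℚ.* weight (points L a) i))
    ≡⟨ *-distribˡ-∑ (ι (n !) ℚ.* growth L a) (λ i → points L a i ℚ.* weight (points L a) i) ⟨
  ι (n !) ℚ.* growth L a ℚ.* ∑ (λ i → points L a i ℚ.* weight (points L a) i)
    ≡⟨ cong (ι (n !) ℚ.* growth L a ℚ.*_)
         (trans (∑-point*weight {L} {points L a} (points-distinct a↓))
           (trans (∑-points L a) (cong ι sum≡n))) ⟩
  ι (n !) ℚ.* growth L a ℚ.* ι (suc n)
    ≡⟨ solve 3 (λ f g s → f :* g :* s := s :* f :* g) refl (ι (n !)) (growth L a) (ι (suc n)) ⟩
  ι (suc n) ℚ.* ι (n !) ℚ.* growth L a
    ≡⟨ cong (ℚ._* growth L a) (ι-* (suc n) (n !)) ⟨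
  ι (suc n !) ℚ.* growth L a ∎
  where
  open ≡-Reasoning
  term : ∀ i → ι (if does (removable? L (λ _ → 0) a (toℕ i)) then paths L (λ _ → 0) n
    (removeBox a (toℕ i)) else 0)
             ≡ ι (n !) ℚ.* growth L a ℚ.* (points L a i ℚ.* weight (points L a) i)
  term i = cases (removable? L (λ _ → 0) a (toℕ i))
    where
    cases : (r? : Dec (Removable L (λ _ → 0) a (toℕ i))) →
      ι (if does r? then paths L (λ _ → 0) n (removeBox a (toℕ i)) else 0)
      ≡ ι (n !) ℚ.* growth L a ℚ.* (points L a i ℚ.* weight (points L a) i)
    cases (yes r) = begin
      ι (paths L (λ _ → 0) n (removeBox a (toℕ i)))
        ≡⟨ paths-growth (skew-remove s r) ⟩
      ι (n !) ℚ.* growth L (removeBox a (toℕ i))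
        ≡⟨ cong (ι (n !) ℚ.*_) (growth-remove a↓ i (proj₁ (proj₂ r))) ⟩
      ι (n !) ℚ.* (growth L a ℚ.* (points L a i ℚ.* weight (points L a) i))
        ≡⟨ ℚ.*-assoc (ι (n !)) (growth L a) _ ⟨
      ι (n !) ℚ.* growth L a ℚ.* (points L a i ℚ.* weight (points L a) i) ∎
    cases (no ¬r) = trans ι-0 (sym (trans
      (cong (ι (n !) ℚ.* growth L a ℚ.*_) (point*weight≡0 a i repeated aL))
      (ℚ.*-zeroʳ (ι (n !) ℚ.* growth L a))))
      where
      repeated : a (suc (toℕ i)) ≡ a (toℕ i)
      repeated = ℕ.≤-antisym (a↓ (toℕ i))
        (ℕ.≮⇒≥ λ lt → ¬r (toℕ<n i , ℕ.≤-<-trans z≤n lt , lt))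

-- The Weyl dimension formula and its size in N

dimFactor : (ℕ → ℕ) → ℕ → ℕ → ℚ
dimFactor a i j = (ι (a i) ℚ.- ι (a j) ℚ.- ι i ℚ.+ ι j) ℚ.* inv (ι (j ℕ.∸ i))

dimFactor-suc : ∀ a i j → dimFactor a (suc i) (suc j) ≡ dimFactor (a ∘ suc) i j
dimFactor-suc a i j = cong (ℚ._* inv (ι (j ℕ.∸ i))) (begin
  x ℚ.- y ℚ.- ι (suc i) ℚ.+ ι (suc j)
    ≡⟨ cong₂ (λ u v → x ℚ.- y ℚ.- u ℚ.+ v) (ι-suc i) (ι-suc j) ⟩
  x ℚ.- y ℚ.- (1ℚ ℚ.+ ι i) ℚ.+ (1ℚ ℚ.+ ι j)
    ≡⟨ solve 5 (λ x y o i j → x :- y :- (o :+ i) :+ (o :+ j) := x :- y :- i :+ j) refl x y 1ℚ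
      (ι i) (ι j) ⟩
  x ℚ.- y ℚ.- ι i ℚ.+ ι j ∎)
  where
  open ≡-Reasoning
  x = ι (a (suc i))
  y = ι (a (suc j))

weylDim : ℕ → (ℕ → ℕ) → ℚ
weylDim N a = ∏ {N} λ j → ∏ {toℕ j} λ i → dimFactor a (toℕ i) (toℕ j)

/-inv : ∀ i n .{{_ : ℕ.NonZero n}} → i ℚ./ n ≡ fromℤ i ℚ.* inv (ι n)
/-inv i n = *-cancelʳ (ι≢0 n) (trans (/-*-cancel i n) (sym (begin
  fromℤ i ℚ.* inv (ι n) ℚ.* ι n   ≡⟨ ℚ.*-assoc (fromℤ i) (inv (ι n)) (ι n) ⟩
  fromℤ i ℚ.* (inv (ι n) ℚ.* ι n) ≡⟨ cong (fromℤ i ℚ.*_)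
    (trans (ℚ.*-comm (inv (ι n)) (ι n)) (*-inv (ι≢0 n))) ⟩
  fromℤ i ℚ.* 1ℚ                  ≡⟨ ℚ.*-identityʳ (fromℤ i) ⟩
  fromℤ i                         ∎)))
  where open ≡-Reasoning

Dim≡weylDim : ∀ {N} (ν : Sig N) a → (∀ i → ν ! i ≡ + a (toℕ i)) → Dim ν ≡ weylDim N a
Dim≡weylDim {N} ν a ν≗a = ∏-cong {N} λ j → ∏-cong {toℕ j} λ i → factor j i
  where
  open ≡-Reasoning
  factor : (j : Fin N) (i : Fin (toℕ j)) → weylFactor ν j i ≡ dimFactor a (toℕ i) (toℕ j)
  factor j i = begin
    weylFactor ν j i
      ≡⟨ /-inv (ν ! inject i ℤ.- ν ! j ℤ.- + toℕ i ℤ.+ + toℕ j) (toℕ j ℕ.∸ toℕ i)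
           {{ℕ.>-nonZero (ℕ.m<n⇒0<n∸m (toℕ<n i))}} ⟩
    fromℤ (ν ! inject i ℤ.- ν ! j ℤ.- + toℕ i ℤ.+ + toℕ j) ℚ.* w
      ≡⟨ cong₂ (λ x y → fromℤ (x ℤ.- y ℤ.- + toℕ i ℤ.+ + toℕ j) ℚ.* w)
           (trans (ν≗a (inject i)) (cong (λ k → + a k) (Fin.toℕ-inject i))) (ν≗a j) ⟩
    fromℤ (x ℤ.- y ℤ.- + toℕ i ℤ.+ + toℕ j) ℚ.* w
      ≡⟨ cong (ℚ._* w) (fromℤ-+ (x ℤ.- y ℤ.- + toℕ i) (+ toℕ j)) ⟩
    (fromℤ (x ℤ.- y ℤ.- + toℕ i) ℚ.+ ι (toℕ j)) ℚ.* w
      ≡⟨ cong (λ u → (u ℚ.+ ι (toℕ j)) ℚ.* w) (trans (fromℤ-- (x ℤ.- y) (+ toℕ i))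
           (cong (ℚ._- ι (toℕ i)) (fromℤ-- x y))) ⟩
    dimFactor a (toℕ i) (toℕ j) ∎
    where
    x = + a (toℕ i)
    y = + a (toℕ j)
    w = inv (ι (toℕ j ℕ.∸ toℕ i))
    fromℤ-- : ∀ i j → fromℤ (i ℤ.- j) ≡ fromℤ i ℚ.- fromℤ j
    fromℤ-- i j = trans (fromℤ-+ i (ℤ.- j)) (cong (fromℤ i ℚ.+_) (fromℤ-neg j))

∏-inv-suc : ∀ N → ∏ {N} (λ j → inv (ι (suc (toℕ j)))) ≡ inv (ι (N !))
∏-inv-suc zero    = sym (trans (cong inv ι-1) inv-1)
∏-inv-suc (suc N) = begin
  ∏ {suc N} (λ j → inv (ι (suc (toℕ j))))
    ≡⟨ ∏-init-last {N} (λ j → inv (ι (suc (toℕ j)))) ⟩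
  ∏ {N} (λ j → inv (ι (suc (toℕ (inject₁ j))))) ℚ.* inv (ι (suc (toℕ (Fin.fromℕ N))))
    ≡⟨ cong₂ (λ u k → u ℚ.* inv (ι (suc k)))
         (trans (∏-cong {N} λ j → cong (λ k → inv (ι (suc k))) (Fin.toℕ-inject₁ j)) (∏-inv-suc N))
         (Fin.toℕ-fromℕ N) ⟩
  inv (ι (N !)) ℚ.* inv (ι (suc N))
    ≡⟨ trans (ℚ.*-comm (inv (ι (N !))) (inv (ι (suc N))))
         (inv-* (ι≢0 (suc N)) (ι≢0 (N !) {{ℕ._!≢0 N}})) ⟩
  inv (ι (suc N) ℚ.* ι (N !))
    ≡⟨ cong inv (ι-* (suc N) (N !)) ⟨
  inv (ι (suc N !)) ∎
  where open ≡-Reasoning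

-- The numerators are differences of points, since the shifts of rows i and j differ by j - i. For
-- fixed i the denominators j - i run through 1, ..., N - 1 - i and multiply to a factorial.
weylDim-vandermonde : ∀ N a →
  weylDim N a ≡ vandermonde (points N a) ℚ.* ∏ {N} λ i → inv (ι ((N ℕ.∸ suc (toℕ i)) !))
weylDim-vandermonde zero    a = refl
weylDim-vandermonde (suc N) a = begin
  -- `weylDim` groups its factors by the larger index, `vandermonde` by the smaller. The index j = 0
  -- has no smaller one, hence the leading 1; every other j splits off its factor with i = 0, and
  -- these form the first row of the Vandermonde product.
  1ℚ ℚ.* ∏ {N} (λ j → f j ℚ.* ∏ {toℕ j} λ i → dimFactor a (suc (toℕ i)) (suc (toℕ j)))
    ≡⟨ ℚ.*-identityˡ _ ⟩
  ∏ {N} (λ j → f j ℚ.* ∏ {toℕ j} λ i → dimFactor a (suc (toℕ i)) (suc (toℕ j)))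
    ≡⟨ ∏-cong {N} (λ j → cong₂ ℚ._*_ (first j)
      (∏-cong {toℕ j} λ i → dimFactor-suc a (toℕ i) (toℕ j))) ⟩
  ∏ {N} (λ j → d j ℚ.* e j ℚ.* ∏ {toℕ j} λ i → dimFactor (a ∘ suc) (toℕ i) (toℕ j))
    ≡⟨ trans (∏-distrib-* {N} (λ j → d j ℚ.* e j) _)
      (cong (ℚ._* weylDim N (a ∘ suc)) (∏-distrib-* {N} d e)) ⟩
  ∏ d ℚ.* ∏ e ℚ.* weylDim N (a ∘ suc)
    ≡⟨ cong₂ (λ u v → ∏ d ℚ.* u ℚ.* v) (∏-inv-suc N) (weylDim-vandermonde N (a ∘ suc)) ⟩
  ∏ d ℚ.* inv (ι (N !)) ℚ.* (v ℚ.* p)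
    ≡⟨ solve 4 (λ d i v p → d :* i :* (v :* p) := d :* v :* (i :* p)) refl (∏ d)
      (inv (ι (N !))) v p ⟩
  ∏ d ℚ.* v ℚ.* (inv (ι (N !)) ℚ.* p) ∎
  where
  open ≡-Reasoning
  f d e : Fin N → ℚ
  f j = dimFactor a 0 (suc (toℕ j))
  d j = points (suc N) a zero ℚ.- points (suc N) a (suc j)
  e j = inv (ι (suc (toℕ j)))
  v = vandermonde (points N (a ∘ suc))
  p = ∏ {N} λ i → inv (ι ((N ℕ.∸ suc (toℕ i)) !))
  first : ∀ j → f j ≡ d j ℚ.* e j
  first j = cong (ℚ._* e j) (begin
    ι (a 0) ℚ.- y ℚ.- ι 0 ℚ.+ ι (suc (toℕ j))
      ≡⟨ cong (λ u → ι (a 0) ℚ.- y ℚ.- u ℚ.+ ι (suc (toℕ j))) ι-0 ⟩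
    ι (a 0) ℚ.- y ℚ.- 0ℚ ℚ.+ ι (suc (toℕ j))
      ≡⟨ solve 4 (λ x y s r → x :- y :- con 0ℚ :+ s := x :+ (s :+ r) :- (y :+ r)) refl
           (ι (a 0)) y (ι (suc (toℕ j))) (ι (N ℕ.∸ suc (toℕ j))) ⟩
    ι (a 0) ℚ.+ (ι (suc (toℕ j)) ℚ.+ ι (N ℕ.∸ suc (toℕ j))) ℚ.- (y ℚ.+ ι (N ℕ.∸ suc (toℕ j)))
      ≡⟨ cong₂ (λ u v → ι (a 0) ℚ.+ u ℚ.- v)
           (trans (sym (ι-+ (suc (toℕ j)) (N ℕ.∸ suc (toℕ j)))) (cong ι (ℕ.m+[n∸m]≡n (toℕ<n j))))
           (sym (ι-+ (a (suc (toℕ j))) (N ℕ.∸ suc (toℕ j)))) ⟩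
    ι (a 0) ℚ.+ ι N ℚ.- points (suc N) a (suc j)
      ≡⟨ cong (ℚ._- points (suc N) a (suc j)) (ι-+ (a 0) N) ⟨
    d j ∎)
    where y = ι (a (suc (toℕ j)))

-- The product (k+1)(k+2)⋯(k+x), that is (x+k)!/k!.
rise : ℕ → ℕ → ℕ
rise k zero    = 1
rise k (suc x) = suc (x ℕ.+ k) ℕ.* rise k x

!-rise : ∀ k x → (x ℕ.+ k) ! ≡ rise k x ℕ.* k !
!-rise k zero    = sym (ℕ.+-identityʳ (k !))
!-rise k (suc x) = trans (cong (suc (x ℕ.+ k) ℕ.*_) (!-rise k x))
  (sym (ℕ.*-assoc (suc (x ℕ.+ k)) (rise k x) (k !)))

^≤rise : ∀ k x → suc k ℕ.^ x ℕ.≤ rise k x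
^≤rise k zero    = ℕ.≤-refl
^≤rise k (suc x) = ℕ.*-mono-≤ (s≤s (ℕ.m≤n+m k x)) (^≤rise k x)

rise≤^ : ∀ k {x c} → x ℕ.≤ c → rise k x ℕ.≤ (c ℕ.+ k) ℕ.^ x
rise≤^ k {zero}  _   = ℕ.≤-refl
rise≤^ k {suc x} x≤c = ℕ.*-mono-≤ (ℕ.+-monoˡ-≤ k x≤c) (rise≤^ k (ℕ.≤-trans (ℕ.n≤1+n x) x≤c))

rises : ℕ → (ℕ → ℕ) → ℕ
rises N a = ∏ℕ {N} λ i → rise (N ℕ.∸ suc (toℕ i)) (a (toℕ i))

ι-∏ : ∀ {n} (f : Fin n → ℕ) → ι (∏ℕ f) ≡ ∏ (ι ∘ f)
ι-∏ {zero}  f = ι-1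
ι-∏ {suc n} f = trans (ι-* (f zero) (∏ℕ (f ∘ suc))) (cong (ι (f zero) ℚ.*_) (ι-∏ (f ∘ suc)))

inv-rise : ∀ k x → inv (ι ((x ℕ.+ k) !)) ℚ.* ι (rise k x) ≡ inv (ι (k !))
inv-rise k x = *-cancelʳ (ι≢0 (k !) {{ℕ._!≢0 k}}) (begin
  inv (ι ((x ℕ.+ k) !)) ℚ.* ι (rise k x) ℚ.* ι (k !)
    ≡⟨ ℚ.*-assoc (inv (ι ((x ℕ.+ k) !))) _ _ ⟩
  inv (ι ((x ℕ.+ k) !)) ℚ.* (ι (rise k x) ℚ.* ι (k !))
    ≡⟨ cong (inv (ι ((x ℕ.+ k) !)) ℚ.*_) (trans (cong ι (!-rise k x)) (ι-* (rise k x) (k !))) ⟨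
  inv (ι ((x ℕ.+ k) !)) ℚ.* ι ((x ℕ.+ k) !)
    ≡⟨ inverse-! (x ℕ.+ k) ⟩
  1ℚ
    ≡⟨ inverse-! k ⟨
  inv (ι (k !)) ℚ.* ι (k !) ∎)
  where
  open ≡-Reasoning
  inverse-! : ∀ n → inv (ι (n !)) ℚ.* ι (n !) ≡ 1ℚ
  inverse-! n = trans (ℚ.*-comm (inv (ι (n !))) _) (*-inv (ι≢0 (n !) {{ℕ._!≢0 n}}))

-- Replacing the denominators (N - 1 - i)! by l_i! costs one `rise` for each row.
weylDim-growth : ∀ N a → weylDim N a ≡ growth N a ℚ.* ι (rises N a)
weylDim-growth N a = begin
  weylDim N a
    ≡⟨ weylDim-vandermonde N a ⟩
  v ℚ.* ∏ {N} (λ i → inv (ι ((N ℕ.∸ suc (toℕ i)) !)))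
    ≡⟨ cong (v ℚ.*_) (trans (sym (∏-cong {N} λ i → inv-rise (N ℕ.∸ suc (toℕ i)) (a (toℕ i))))
         (∏-distrib-* {N} p r)) ⟩
  v ℚ.* (∏ p ℚ.* ∏ r)
    ≡⟨ ℚ.*-assoc v (∏ p) (∏ r) ⟨
  v ℚ.* ∏ p ℚ.* ∏ r
    ≡⟨ cong (v ℚ.* ∏ p ℚ.*_) (ι-∏ {N} (λ i → rise (N ℕ.∸ suc (toℕ i)) (a (toℕ i)))) ⟨
  growth N a ℚ.* ι (rises N a) ∎
  where
  open ≡-Reasoning
  v = vandermonde (points N a)
  p r : Fin N → ℚ
  p i = inv (ι ((a (toℕ i) ℕ.+ (N ℕ.∸ suc (toℕ i))) !))
  r i = ι (rise (N ℕ.∸ suc (toℕ i)) (a (toℕ i)))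

^-∑≤∏ : ∀ {n} X (f g : Fin n → ℕ) → (∀ i → X ℕ.^ f i ℕ.≤ g i) → X ℕ.^ ∑ℕ f ℕ.≤ ∏ℕ g
^-∑≤∏ {zero}  X f g le = ℕ.≤-refl
^-∑≤∏ {suc n} X f g le = subst (ℕ._≤ ∏ℕ g) (sym (ℕ.^-distribˡ-+-* X (f zero) (∑ℕ (f ∘ suc))))
  (ℕ.*-mono-≤ (le zero) (^-∑≤∏ X (f ∘ suc) (g ∘ suc) (le ∘ suc)))

∏≤^-∑ : ∀ {n} X (f g : Fin n → ℕ) → (∀ i → g i ℕ.≤ X ℕ.^ f i) → ∏ℕ g ℕ.≤ X ℕ.^ ∑ℕ f
∏≤^-∑ {zero}  X f g le = ℕ.≤-refl
∏≤^-∑ {suc n} X f g le = subst (∏ℕ g ℕ.≤_) (sym (ℕ.^-distribˡ-+-* X (f zero) (∑ℕ (f ∘ suc))))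
  (ℕ.*-mono-≤ (le zero) (∏≤^-∑ X (f ∘ suc) (g ∘ suc) (le ∘ suc)))

vanishes : ∀ {L a} → Antitone a → a L ≡ 0 → ∀ {j} → L ℕ.≤ j → a j ≡ 0
vanishes {L} {a} a↓ aL {j} L≤j = ℕ.n≤0⇒n≡0 (subst (a j ℕ.≤_) aL (antitone-≤ a↓ L≤j))

∑-stable : ∀ {L a} → (∀ {j} → L ℕ.≤ j → a j ≡ 0) → ∀ {N} → L ℕ.≤ N →
  ∑ℕ {N} (a ∘ toℕ) ≡ ∑ℕ {L} (a ∘ toℕ)
∑-stable {zero}  z {zero}  _         = refl
∑-stable {zero} {a} z {suc N} _      = cong₂ ℕ._+_ (z z≤n)
  (∑-stable {0} {a ∘ suc} (λ _ → z z≤n) {N} z≤n)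
∑-stable {suc L} {a} z {suc N} (s≤s L≤N) = cong (a 0 ℕ.+_) (∑-stable {L} {a ∘ suc} (z ∘ s≤s) L≤N)

module _ {L n a} (s : Skew L (λ _ → 0) n a) {N} (L≤N : L ℕ.≤ N) where
  open Skew s

  private
    size-N : ∑ℕ {N} (a ∘ toℕ) ≡ n
    size-N = trans (∑-stable (vanishes rows↓ support) L≤N) excess

  ^≤rises : (N ℕ.∸ L) ℕ.^ n ℕ.≤ rises N a
  ^≤rises = subst (λ m → (N ℕ.∸ L) ℕ.^ m ℕ.≤ rises N a) size-N
    (^-∑≤∏ {N} (N ℕ.∸ L) (a ∘ toℕ) _ λ i → le (toℕ i) (toℕ<n i))
    where
    le : ∀ i → i ℕ.< N → (N ℕ.∸ L) ℕ.^ a i ℕ.≤ rise (N ℕ.∸ suc i) (a i)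
    le i i<N with i ℕ.<? L
    -- The smallest factor of row i is N - i, which is at least N - L. Rows from L on are empty and
    -- contribute 1.
    ... | yes i<L = ℕ.≤-trans (ℕ.^-monoˡ-≤ (a i)
      (subst (N ℕ.∸ L ℕ.≤_) (ℕ.+-∸-assoc 1 i<N) (ℕ.∸-monoʳ-≤ N (ℕ.<⇒≤ i<L))))
        (^≤rise (N ℕ.∸ suc i) (a i))
    ... | no i≮L rewrite vanishes {L} {a} rows↓ support (ℕ.≮⇒≥ i≮L) = ℕ.≤-refl

  rises≤^ : rises N a ℕ.≤ (N ℕ.+ a 0) ℕ.^ n
  rises≤^ = subst (λ m → rises N a ℕ.≤ (N ℕ.+ a 0) ℕ.^ m) size-N
    (∏≤^-∑ {N} (N ℕ.+ a 0) (a ∘ toℕ) _ λ i → ℕ.≤-trans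
      (rise≤^ (N ℕ.∸ suc (toℕ i)) (antitone-≤ rows↓ z≤n))
      (ℕ.^-monoˡ-≤ (a (toℕ i)) (subst (a 0 ℕ.+ (N ℕ.∸ suc (toℕ i)) ℕ.≤_) (ℕ.+-comm (a 0) N)
        (ℕ.+-monoʳ-≤ (a 0) (ℕ.m∸n≤m N (suc (toℕ i)))))))

  weylDim-rises : weylDim N a ≡ growth L a ℚ.* ι (rises N a)
  weylDim-rises = trans (weylDim-growth N a)
    (cong (ℚ._* ι (rises N a)) (growth-stable {L} {a} rows↓ support L≤N))

-- Counts as bijections

finite-↔ : ∀ {A} (fin : Finite A) → Fin (# fin) ↔ A
finite-↔ {A} fin = ⤖⇒↔ (mk⤖ (lookup-injective unique ,
  strictlySurjective⇒surjective λ a → Any.index (complete a) , sym (Any.lookup-index (complete a))))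
  where
  open Finite fin
  lookup-injective : ∀ {xs : List A} → Unique xs → ∀ {i j} → List.lookup xs i ≡ List.lookup xs j →
    i ≡ j
  lookup-injective (_ ∷ _)  {zero}  {zero}  _  = refl
  lookup-injective (x∉ ∷ _) {zero}  {suc j} eq = contradiction eq (All.lookup x∉ (∈.∈-lookup j))
  lookup-injective (x∉ ∷ _) {suc i} {zero}  eq =
    contradiction (sym eq) (All.lookup x∉ (∈.∈-lookup i))
  lookup-injective (_ ∷ u)  {suc i} {suc j} eq = cong suc (lookup-injective u eq)

-- With `Removable` for P, the conditional sum in `paths` becomes the choice of a first removal.
-- That P implies `i < L` ensures that the sum misses no index, and irrelevance of the proof of P
-- that none is counted twice.
Σ-refinement-↔ : ∀ L {P : ℕ → Set} (P? : Decidable P) → (∀ i → P i → i ℕ.< L) →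
  {B : ℕ → Set} {h : ℕ → ℕ} → (∀ i → Fin (h i) ↔ B i) →
  Fin (∑ℕ {L} λ i → if does (P? (toℕ i)) then h (toℕ i) else 0) ↔ Σ (Refinement ℕ P) (B ∘ value)
Σ-refinement-↔ zero {P} P? P⇒< B↔ =
  mk↔ₛ′ (λ ()) (λ ((i , [ p ]) , _) → ⊥-elim (impossible i p))
    (λ ((i , [ p ]) , _) → ⊥-elim (impossible i p)) (λ ())
  where
  impossible : ∀ i → .(P i) → ⊥
  impossible i p with () ← P⇒< i (recompute (P? i) p)
Σ-refinement-↔ (suc L) {P} P? P⇒< {B} {h} B↔ =
  ↔-trans Fin.+↔⊎ (↔-trans
    (head (P? 0) ⊎-↔ Σ-refinement-↔ L {P ∘ suc} (P? ∘ suc)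
      (λ i p → ℕ.s≤s⁻¹ (P⇒< (suc i) p)) {B ∘ suc} {h ∘ suc} (B↔ ∘ suc))
    split)
  where
  head : (p? : Dec (P 0)) → Fin (if does p? then h 0 else 0) ↔ (Irrelevant (P 0) × B 0)
  head (yes p) = ↔-trans (B↔ 0) (mk↔ₛ′ {B = Irrelevant (P 0) × B 0} (λ b → [ p ] , b) proj₂
    (λ _ → refl) (λ _ → refl))
  head (no ¬p) = mk↔ₛ′ (λ ()) (λ ([ p ] , _) → ⊥-elim (absurd p))
    (λ ([ p ] , _) → ⊥-elim (absurd p)) (λ ())
    where
    absurd : .(P 0) → ⊥
    absurd p = ¬p (recompute (P? 0) p)
  split : ((Irrelevant (P 0) × B 0) ⊎ Σ (Refinement ℕ (P ∘ suc)) (B ∘ suc ∘ value)) ↔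
    Σ (Refinement ℕ P) (B ∘ value)
  split = mk↔ₛ′
    (λ { (inj₁ ([ p ] , b)) → (0 , [ p ]) , b ; (inj₂ ((i , [ p ]) , b)) → (suc i , [ p ]) , b })
    (λ { ((zero , [ p ]) , b) → inj₁ ([ p ] , b) ; ((suc i , [ p ]) , b) → inj₂ ((i , [ p ]) , b) })
    (λ { ((zero , [ p ]) , b) → refl ; ((suc i , [ p ]) , b) → refl })
    (λ { (inj₁ ([ p ] , b)) → refl ; (inj₂ ((i , [ p ]) , b)) → refl })

Path : ℕ → (ℕ → ℕ) → ℕ → (ℕ → ℕ) → Set
Path L b zero    a = ⊤
Path L b (suc d) a = Σ (Refinement ℕ (Removable L b a)) λ i → Path L b d (removeBox a (value i))

paths-↔ : ∀ L b d a → Fin (paths L b d a) ↔ Path L b d a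
paths-↔ L b zero    a = Fin.1↔⊤
paths-↔ L b (suc d) a = Σ-refinement-↔ L (removable? L b a) (λ _ → proj₁)
  λ i → paths-↔ L b d (removeBox a i)

-- Standard tableaux as orders of box removal

infix 4 _◁_ _◁?_

_◁_ : ℕ × ℕ → ℕ × ℕ → Set
(i , j) ◁ (i′ , j′) = (i ≡ i′ × j ℕ.< j′) ⊎ (j ≡ j′ × i ℕ.< i′)

_◁?_ : ∀ p q → Dec (p ◁ q)
(i , j) ◁? (i′ , j′) = (i ℕ.≟ i′ ×-dec j ℕ.<? j′) ⊎-dec (j ℕ.≟ j′ ×-dec i ℕ.<? i′)

module _ {n} (c : Fin n → ℕ × ℕ) where

  -- With a family of boxes in place of the list in `IsStandard`, deleting box k is precomposition
  -- with `punchIn k`. The row and column conditions merge into `_◁_`, whose maximal elements are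
  -- the corners.
  Standard : Vec (Fin n) n → Set
  Standard T = (∀ k l → lookup T k ≡ lookup T l → k ≡ l) ×
    (∀ k l → c k ◁ c l → lookup T k Fin.< lookup T l)

  standard? : Decidable Standard
  standard? T = Fin.all? (λ k → Fin.all? λ l → (lookup T k Fin.≟ lookup T l) →-dec (k Fin.≟ l))
    ×-dec Fin.all? (λ k → Fin.all? λ l → (c k ◁? c l) →-dec (lookup T k Fin.<? lookup T l))

  Maximal : Fin n → Set
  Maximal k = ∀ l → ¬ (c k ◁ c l)

  maximal? : Decidable Maximal
  maximal? k = Fin.all? λ l → ¬? (c k ◁? c l)

  Tableau : Set
  Tableau = Refinement (Vec (Fin n) n) Standard

  Corner : Set
  Corner = Refinement (Fin n) Maximal

data PunchView {n} (k : Fin (suc n)) : Fin (suc n) → Set where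
  same  : PunchView k k
  other : ∀ l → PunchView k (punchIn k l)

punchView : ∀ {n} (k l : Fin (suc n)) → PunchView k l
punchView k l with k Fin.≟ l
... | yes refl = same
... | no k≢l   = subst (PunchView k) (Fin.punchIn-punchOut k≢l) (other (punchOut k≢l))

lookup-ext : ∀ {A : Set} {n} {u v : Vec A n} → (∀ i → lookup u i ≡ lookup v i) → u ≡ v
lookup-ext {u = u} {v} eq = trans (sym (Vec.tabulate∘lookup u))
  (trans (Vec.tabulate-cong eq) (Vec.tabulate∘lookup v))

module _ {n} (c : Fin (suc n) → ℕ × ℕ) where

  insertMax : Fin (suc n) → Vec (Fin n) n → Vec (Fin (suc n)) (suc n)
  insertMax k T = Vec.insertAt (Vec.map inject₁ T) k (Fin.fromℕ n)

  lookup-same : ∀ k T → lookup (insertMax k T) k ≡ Fin.fromℕ n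
  lookup-same k T = Vec.insertAt-lookup (Vec.map inject₁ T) k (Fin.fromℕ n)

  lookup-other : ∀ k T l → lookup (insertMax k T) (punchIn k l) ≡ inject₁ (lookup T l)
  lookup-other k T l = trans (Vec.insertAt-punchIn (Vec.map inject₁ T) k (Fin.fromℕ n) l)
    (Vec.lookup-map l inject₁ T)

  insertMax-standard : ∀ {k T} → Maximal c k → Standard (c ∘ punchIn k) T →
    Standard c (insertMax k T)
  insertMax-standard {k} {T} max (inj , mono) =
    (λ l m → injective (punchView k l) (punchView k m)) , λ l m →
      monotone (punchView k l) (punchView k m)
    where
    injective : ∀ {l m} → PunchView k l → PunchView k m → lookup (insertMax k T) l ≡
      lookup (insertMax k T) m → l ≡ m
    injective same same _ = refl
    injective same (other m) eq = contradiction
      (trans (sym (lookup-same k T)) (trans eq (lookup-other k T m))) Fin.fromℕ≢inject₁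
    injective (other l) same eq = contradiction
      (trans (sym (lookup-same k T)) (trans (sym eq) (lookup-other k T l))) Fin.fromℕ≢inject₁
    injective (other l) (other m) eq = cong (punchIn k) (inj l m (Fin.inject₁-injective
      (trans (sym (lookup-other k T l)) (trans eq (lookup-other k T m)))))
    monotone : ∀ {l m} → PunchView k l → PunchView k m → c l ◁ c m →
      lookup (insertMax k T) l Fin.< lookup (insertMax k T) m
    monotone same v lt = contradiction lt (max _)
    monotone (other l) same lt rewrite lookup-other k T l | lookup-same k T
      | Fin.toℕ-inject₁ (lookup T l) | Fin.toℕ-fromℕ n = toℕ<n (lookup T l)
    monotone (other l) (other m) lt
      rewrite lookup-other k T l | lookup-other k T m | Fin.toℕ-inject₁ (lookup T l)
        | Fin.toℕ-inject₁ (lookup T m) = mono l m lt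

  -- The largest entry of a standard tableau has no box to its right or below it, and deleting it
  -- leaves a standard tableau. `extend` undoes this deletion; iterated, it reads a tableau as an
  -- order of removing boxes.
  extend : Σ (Corner c) (λ k → Tableau (c ∘ punchIn (value k))) → Tableau c
  extend ((k , [ max ]) , (T , [ st ])) = insertMax k T , [ insertMax-standard max st ]

  insertMax-injective : ∀ {k l S T} → insertMax k S ≡ insertMax l T → k ≡ l × S ≡ T
  insertMax-injective {k} {l} {S} {T} eq with punchView l k
  ... | same = refl , lookup-ext λ i → Fin.inject₁-injective
    (trans (sym (lookup-other k S i)) (trans (cong (λ v → lookup v (punchIn k i)) eq)
      (lookup-other k T i)))
  ... | other m = contradiction
    (trans (sym (lookup-same (punchIn l m) S))
      (trans (cong (λ v → lookup v (punchIn l m)) eq) (lookup-other l T m)))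
    Fin.fromℕ≢inject₁

  extend-injective : ∀ {x y} → extend x ≡ extend y → x ≡ y
  extend-injective {(k , _) , (S , _)} {(l , _) , (T , _)} eq
    with insertMax-injective {k} {l} {S} {T} (cong value eq)
  ... | refl , refl = refl

  extend-surjective : ∀ T → ∃ λ x → extend x ≡ T
  extend-surjective (T , [ st ]) = ((k , [ maximal ]) , (T′ , [ standard ])) ,
    value-injective (lookup-ext λ l → agree (punchView k l))
    where
    std = recompute (standard? c T) st
    inj = proj₁ std
    -- Injectivity forces some entry to reach the top value: the pivot at `fromℕ n` is a box whose
    -- entry is at least `fromℕ n`.
    pivot = Fin.injective⇒existsPivot {f = lookup T} (inj _ _) (Fin.fromℕ n)
    k = proj₁ pivot
    Tk≡max : lookup T k ≡ Fin.fromℕ n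
    Tk≡max = Fin.≤-antisym (Fin.≤fromℕ (lookup T k)) (proj₂ (proj₂ pivot))
    maximal : Maximal c k
    maximal l lt = ℕ.<⇒≱ (proj₂ std k l lt) (subst (lookup T l Fin.≤_) (sym Tk≡max)
      (Fin.≤fromℕ (lookup T l)))
    small : ∀ l → n ≢ toℕ (lookup T (punchIn k l))
    small l eq = Fin.punchInᵢ≢i k l (inj _ _ (trans
      (Fin.toℕ-injective (trans (sym eq) (sym (Fin.toℕ-fromℕ n)))) (sym Tk≡max)))
    T′ : Vec (Fin n) n
    T′ = tabulate λ l → Fin.lower₁ (lookup T (punchIn k l)) (small l)
    inject-T′ : ∀ l → inject₁ (lookup T′ l) ≡ lookup T (punchIn k l)
    inject-T′ l = trans (cong inject₁ (Vec.lookup∘tabulate _ l)) (Fin.inject₁-lower₁ _ (small l))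
    toℕ-T′ : ∀ l → toℕ (lookup T′ l) ≡ toℕ (lookup T (punchIn k l))
    toℕ-T′ l = trans (sym (Fin.toℕ-inject₁ (lookup T′ l))) (cong toℕ (inject-T′ l))
    standard : Standard (c ∘ punchIn k) T′
    standard = (λ l m eq → Fin.punchIn-injective k l m (inj _ _
        (trans (sym (inject-T′ l)) (trans (cong inject₁ eq) (inject-T′ m)))))
      , λ l m lt → subst₂ ℕ._<_ (sym (toℕ-T′ l)) (sym (toℕ-T′ m))
        (proj₂ std (punchIn k l) (punchIn k m) lt)
    agree : ∀ {l} → PunchView k l → lookup (insertMax k T′) l ≡ lookup T l
    agree same      = trans (lookup-same k T′) (sym Tk≡max)
    agree (other l) = trans (lookup-other k T′ l) (inject-T′ l)

  extend-↔ : Σ (Corner c) (λ k → Tableau (c ∘ punchIn (value k))) ↔ Tableau c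
  extend-↔ = ⤖⇒↔ (mk⤖ (extend-injective , strictlySurjective⇒surjective extend-surjective))

-- What the recursion needs of the list `boxes`: every box of the shape occurs exactly once. Unlike
-- the explicit list, this passes to the shape with a corner deleted.
record Enumerates {n} (c : Fin n → ℕ × ℕ) (P : ℕ × ℕ → Set) : Set where
  field
    inside    : ∀ k → P (c k)
    index     : ∀ x → P x → Fin n
    c-index   : ∀ x p → c (index x p) ≡ x
    injective : ∀ {k l} → c k ≡ c l → k ≡ l

enumerates-remove : ∀ {n} {c : Fin (suc n) → ℕ × ℕ} {P Q} → Enumerates c P → ∀ k →
  (∀ x → Q x → P x × c k ≢ x) → (∀ x → P x → c k ≢ x → Q x) → Enumerates (c ∘ punchIn k) Q
enumerates-remove {c = c} {P} {Q} E k Q⇒P P⇒Q = record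
  { inside    = λ l → P⇒Q _ (inside _) λ eq → Fin.punchInᵢ≢i k l (sym (injective eq))
  ; index     = λ x q → punchOut (k≢ x q)
  ; c-index   = λ x q → trans (cong c (Fin.punchIn-punchOut (k≢ x q))) (c-index x _)
  ; injective = λ eq → Fin.punchIn-injective k _ _ (injective eq)
  }
  where
  open Enumerates E
  k≢ : ∀ x (q : Q x) → k ≢ index x (proj₁ (Q⇒P x q))
  k≢ x q eq = proj₂ (Q⇒P x q) (trans (cong c eq) (c-index x _))

SkewBox : ℕ → (ℕ → ℕ) → (ℕ → ℕ) → ℕ × ℕ → Set
SkewBox L b a (i , j) = i ℕ.< L × b i ℕ.≤ j × j ℕ.< a i

module _ {L : ℕ} {b : ℕ → ℕ} (b↓ : Antitone b) where

  module _ {n a} {c : Fin n → ℕ × ℕ} (a↓ : Antitone a) (aL : a L ≡ 0)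
    (E : Enumerates c (SkewBox L b a)) where
    open Enumerates E

    -- Otherwise the next box of the row would lie in the shape too. A corner is therefore
    -- determined by its row, which makes `cornerRow` injective.
    corner-column : ∀ {k} → Maximal c k → suc (proj₂ (c k)) ≡ a (proj₁ (c k))
    corner-column {k} max with inside k
    ... | i<L , b≤j , j<a with ℕ.m≤n⇒m<n∨m≡n j<a
    ...   | inj₂ eq = eq
    ...   | inj₁ lt = contradiction (inj₁ (sym (cong proj₁ eq) ,
      ℕ.≤-reflexive (sym (cong proj₂ eq)))) (max (index _ right))
      where
      right : SkewBox L b a (proj₁ (c k) , suc (proj₂ (c k)))
      right = i<L , ℕ.m≤n⇒m≤1+n b≤j , lt
      eq = c-index _ right

    -- If the next row were as long, the box under `c k` would lie in the shape: outside b because b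
    -- decreases, and within the first L rows because `a L` is 0.
    corner-removable : ∀ {k} → Maximal c k → Removable L b a (proj₁ (c k))
    corner-removable {k} max with inside k
    ... | i<L , b≤j , j<a = i<L , ℕ.≤-<-trans b≤j j<a , ℕ.≰⇒> below-empty
      where
      i = proj₁ (c k)
      below-empty : ¬ (a i ℕ.≤ a (suc i))
      below-empty le = max (index _ under) (inj₂
        (sym (cong proj₂ eq) , ℕ.≤-reflexive (sym (cong proj₁ eq))))
        where
        si<L : suc i ℕ.< L
        si<L with ℕ.m≤n⇒m<n∨m≡n i<L
        ... | inj₁ lt   = lt
        ... | inj₂ refl = contradiction (subst (proj₂ (c k) ℕ.<_) aL (ℕ.<-≤-trans j<a le)) ℕ.n≮0
        under : SkewBox L b a (suc i , proj₂ (c k))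
        under = si<L , ℕ.≤-trans (b↓ i) b≤j , ℕ.<-≤-trans j<a le
        eq = c-index _ under

    cornerRow : Corner c → Refinement ℕ (Removable L b a)
    cornerRow (k , [ max ]) = proj₁ (c k) , [ corner-removable max ]

    cornerRow-injective : ∀ {x y} → cornerRow x ≡ cornerRow y → x ≡ y
    cornerRow-injective {k , [ max-k ]} {l , [ max-l ]} eq =
      value-injective (injective (cong₂ _,_ row≡
      (ℕ.suc-injective (trans (corner-column (recompute (maximal? c k) max-k))
        (trans (cong a row≡) (sym (corner-column (recompute (maximal? c l) max-l))))))))
      where row≡ = cong value eq

    cornerRow-surjective : ∀ y → ∃ λ x → cornerRow x ≡ y
    cornerRow-surjective (i , [ r ]) = (k , [ maximal ]) , value-injective (cong proj₁ ck≡)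
      where
      removable = recompute (removable? L b a i) r
      lt = proj₂ (proj₂ removable)
      suc-pred : suc (ℕ.pred (a i)) ≡ a i
      suc-pred = ℕ.suc-pred (a i) {{ℕ.>-nonZero (ℕ.≤-<-trans z≤n lt)}}
      box : SkewBox L b a (i , ℕ.pred (a i))
      box = proj₁ removable , ℕ.<⇒≤pred (proj₁ (proj₂ removable)) , ℕ.≤-reflexive suc-pred
      k = index _ box
      ck≡ : c k ≡ (i , ℕ.pred (a i))
      ck≡ = c-index _ box
      maximal : Maximal c k
      maximal l less with subst (_◁ c l) ck≡ less | inside l
      ... | inj₁ (i≡ , j<) | _ , _ , <a = ℕ.<-irrefl (trans suc-pred (cong a i≡))
        (ℕ.≤-<-trans j< <a)
      ... | inj₂ (j≡ , i<) | _ , _ , <a = ℕ.<-irrefl refl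
        (ℕ.<-≤-trans <a (ℕ.≤-trans (antitone-≤ a↓ i<) (subst (a (suc i) ℕ.≤_) j≡ (ℕ.<⇒≤pred lt))))

    corner-↔ : Corner c ↔ Refinement ℕ (Removable L b a)
    corner-↔ = ⤖⇒↔ (mk⤖ (cornerRow-injective , strictlySurjective⇒surjective cornerRow-surjective))

  module _ {n a} {c : Fin (suc n) → ℕ × ℕ} (a↓ : Antitone a) (aL : a L ≡ 0)
    (E : Enumerates c (SkewBox L b a)) where

    corner-enumerates : ∀ {k} → Maximal c k → Enumerates (c ∘ punchIn k)
      (SkewBox L b (removeBox a (proj₁ (c k))))
    corner-enumerates {k} max = enumerates-remove E k shrink grow
      where
      i = proj₁ (c k)
      column : suc (proj₂ (c k)) ≡ a i
      column = corner-column a↓ aL E max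
      shrink : ∀ x → SkewBox L b (removeBox a i) x → SkewBox L b a x × c k ≢ x
      shrink (i′ , j) (i′<L , b≤j , j<) with i ℕ.≟ i′
      ... | yes refl = (i′<L , b≤j , ℕ.≤-trans j<a (ℕ.≤-trans (ℕ.n≤1+n _) (ℕ.≤-reflexive column)))
        , λ eq → ℕ.<-irrefl (sym (cong proj₂ eq)) j<a
        where
        j<a : j ℕ.< proj₂ (c k)
        j<a = subst (j ℕ.<_) (trans (removeBox-same a i) (cong ℕ.pred (sym column))) j<
      ... | no i≢i′ = (i′<L , b≤j , subst (j ℕ.<_) (removeBox-other a i≢i′) j<) , λ eq →
        i≢i′ (cong proj₁ eq)
      grow : ∀ x → SkewBox L b a x → c k ≢ x → SkewBox L b (removeBox a i) x
      grow (i′ , j) (i′<L , b≤j , j<) ≢x with i ℕ.≟ i′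
      ... | yes refl = i′<L , b≤j , subst (j ℕ.<_)
        (trans (cong ℕ.pred column) (sym (removeBox-same a i)))
        (ℕ.≤∧≢⇒< (ℕ.s≤s⁻¹ (subst (j ℕ.<_) (sym column) j<)) λ eq → ≢x (cong (i ,_) (sym eq)))
      ... | no i≢i′ = i′<L , b≤j , subst (j ℕ.<_) (sym (removeBox-other a i≢i′)) j<

  tableau-↔ : ∀ {n a} {c : Fin n → ℕ × ℕ} → Antitone a → a L ≡ 0 → Enumerates c (SkewBox L b a) →
    Tableau c ↔ Path L b n a
  tableau-↔ {zero}  _ _ _ = mk↔ₛ′ (λ _ → tt) (λ _ → [] , [ (λ ()) , (λ ()) ])
    (λ _ → refl) λ { ([] , _) → refl }
  tableau-↔ {suc n} {a} {c} a↓ aL E = ↔-trans (↔-sym (extend-↔ c))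
    (Σ-↔ (corner-↔ a↓ aL E) λ {x} → fibre x)
    where
    fibre : ∀ x → Tableau (c ∘ punchIn (value x)) ↔
      Path L b n (removeBox a (value (cornerRow a↓ aL E x)))
    fibre (k , [ mx ]) = tableau-↔ (removeBox-antitone a↓ (proj₂ (proj₂ removable)))
      (trans (removeBox-other a (ℕ.<⇒≢ (proj₁ removable))) aL) (corner-enumerates a↓ aL E max)
      where
      max = recompute (maximal? c k) mx
      removable = corner-removable a↓ aL E max

boxes-enumerates : ∀ α β → Enumerates (List.lookup (boxes α β)) (SkewBox (ℓ α) (β ‼_) (α ‼_))
boxes-enumerates α β = record
  { inside    = λ k → ∈⇒box (∈.∈-lookup k)
  ; index     = λ x p → Any.index (box⇒∈ x p)
  ; c-index   = λ x p → sym (Any.lookup-index (box⇒∈ x p))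
  ; injective = λ {k} {l} → injective k l
  }
  where
  ∈⇒box : ∀ {x} → x ∈ boxes α β → SkewBox (ℓ α) (β ‼_) (α ‼_) x
  ∈⇒box x∈ with ∈.∈-concat⁻′ (List.map (rowBoxes α β) (List.upTo (ℓ α))) x∈
  ... | _ , x∈row , row∈ with ∈.∈-map⁻ (rowBoxes α β) row∈
  ... | i , i∈ , refl with ∈.∈-applyUpTo⁻ (λ k → i , β ‼ i ℕ.+ k) x∈row
  ... | k , k< , refl = ∈.∈-upTo⁻ i∈ , ℕ.m≤m+n (β ‼ i) k ,
    subst (β ‼ i ℕ.+ k ℕ.<_)
      (ℕ.m+[n∸m]≡n {β ‼ i} {α ‼ i} (ℕ.<⇒≤ (ℕ.m∸n≢0⇒n<m λ eq → ℕ.n≮0 (subst (k ℕ.<_) eq k<))))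
      (ℕ.+-monoʳ-< (β ‼ i) k<)
  box⇒∈ : ∀ x → SkewBox (ℓ α) (β ‼_) (α ‼_) x → x ∈ boxes α β
  box⇒∈ (i , j) (i<L , b≤j , j<a) = ∈-concatMap (∈.∈-upTo⁺ i<L)
    (subst (λ j′ → (i , j′) ∈ rowBoxes α β i) (ℕ.m+[n∸m]≡n b≤j)
      (∈.∈-applyUpTo⁺ (λ k → i , β ‼ i ℕ.+ k) (ℕ.∸-monoˡ-< j<a b≤j)))
  injective : ∀ k l → List.lookup (boxes α β) k ≡ List.lookup (boxes α β) l → k ≡ l
  injective k l eq with Fin.<-cmp k l
  ... | tri≈ _ k≡l _ = k≡l
  ... | tri< lt _ _  = contradiction (sorted-lookup (boxes-sorted α β) lt) λ p →
    ⊏-asym p (subst₂ _⊏_ eq (sym eq) p)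
  ... | tri> _ _ gt  = contradiction (sorted-lookup (boxes-sorted α β) gt) λ p →
    ⊏-asym p (subst₂ _⊏_ (sym eq) eq p)

standardTableau-↔ : ∀ α β → StandardTableau α β ↔ Tableau (List.lookup (boxes α β))
standardTableau-↔ α β = mk↔ₛ′ (λ (T , [ p ]) → T , [ to p ]) (λ (T , [ p ]) → T , [ from p ])
  (λ _ → refl) (λ _ → refl)
  where
  bs = boxes α β
  to : ∀ {T} → IsStandard bs T → Standard (List.lookup bs) T
  to (isStandard inj rows cols) = inj , λ { k l (inj₁ (i≡ , j<)) →
    rows k l i≡ j< ; k l (inj₂ (j≡ , i<)) → cols k l j≡ i< }
  from : ∀ {T} → Standard (List.lookup bs) T → IsStandard bs T
  from (inj , mono) = isStandard inj (λ k l i≡ j< → mono k l (inj₁ (i≡ , j<)))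
    (λ k l j≡ i< → mono k l (inj₂ (j≡ , i<)))

rows-antitone : ∀ α → Antitone (α ‼_)
rows-antitone α = go (decreasing α)
  where
  go : ∀ {xs} → ListLinked.Linked ℕ._≥_ xs → ∀ i → row xs (suc i) ℕ.≤ row xs i
  go ListLinked.[]          i       = z≤n
  go ListLinked.[-]         i       = z≤n
  go (x≥y ListLinked.∷ _)   zero    = x≥y
  go (_   ListLinked.∷ xs↓) (suc i) = go xs↓ i

row-beyond : ∀ xs {i} → List.length xs ℕ.≤ i → row xs i ≡ 0
row-beyond []       _         = refl
row-beyond (x ∷ xs) (s≤s le) = row-beyond xs le

skewDim≡paths : ∀ α β → skewDim α β ≡ paths (ℓ α) (β ‼_) (List.length (boxes α β)) (α ‼_)
skewDim≡paths α β = ↔⇒≡ (↔-trans (finite-↔ (tableau-finite α β)) (↔-trans (standardTableau-↔ α β)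
  (↔-trans (tableau-↔ (rows-antitone β) (rows-antitone α) (row-beyond (rows α) ℕ.≤-refl)
    (boxes-enumerates α β))
    (↔-sym (paths-↔ (ℓ α) (β ‼_) (List.length (boxes α β)) (α ‼_))))))

-- The last step of a chain of signatures

sig : ∀ M a → .(Antitone a) → Sig M
sig M a a↓ = tabulate (λ i → + a (toℕ i)) , [ tabulated M a a↓ ]
  where
  tabulated : ∀ M a → Antitone a → Linked ℤ._≥_ (tabulate {n = M} (λ i → + a (toℕ i)))
  tabulated zero          a a↓ = []
  tabulated (suc zero)    a a↓ = [-]
  tabulated (suc (suc M)) a a↓ = ℤ.+≤+ (a↓ 0) ∷ tabulated (suc M) (a ∘ suc) (a↓ ∘ suc)

sig-! : ∀ {M a} .(a↓ : Antitone a) i → sig M a a↓ ! i ≡ + a (toℕ i)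
sig-! a↓ i = Vec.lookup∘tabulate _ i

sig-injective : ∀ {M a a′} .(a↓ : Antitone a) .(a′↓ : Antitone a′) →
  sig M a a↓ ≡ sig M a′ a′↓ → ∀ {i} → i ℕ.< M → a i ≡ a′ i
sig-injective {a = a} {a′} a↓ a′↓ eq i<M = ℤ.+-injective (begin
  + a _                          ≡⟨ cong (λ j → + a j) (Fin.toℕ-fromℕ< i<M) ⟨
  + a (toℕ (fromℕ< i<M))         ≡⟨ sig-! a↓ (fromℕ< i<M) ⟨
  sig _ a a↓ ! fromℕ< i<M        ≡⟨ cong (λ ν → ν ! fromℕ< i<M) eq ⟩
  sig _ a′ a′↓ ! fromℕ< i<M      ≡⟨ sig-! a′↓ (fromℕ< i<M) ⟩
  + a′ (toℕ (fromℕ< i<M))        ≡⟨ cong (λ j → + a′ j) (Fin.toℕ-fromℕ< i<M) ⟩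
  + a′ _                         ∎)
  where open ≡-Reasoning

≺-sig : ∀ {M r a} .(r↓ : Antitone r) .(a↓ : Antitone a) → (∀ i → r i ℕ.≤ a i) →
  (∀ i → a (suc i) ℕ.≤ r i) →
  sig M r r↓ ≺ sig (suc M) a a↓
≺-sig {r = r} {a} r↓ a↓ r≤a a≤r i =
    subst₂ ℤ._≤_ (sym (sig-! r↓ i)) (sym (trans (sig-! a↓ (inject₁ i))
      (cong (λ j → + a j) (Fin.toℕ-inject₁ i))))
      (ℤ.+≤+ (r≤a (toℕ i)))
  , subst₂ ℤ._≤_ (sym (sig-! a↓ (suc i))) (sym (sig-! r↓ i)) (ℤ.+≤+ (a≤r (toℕ i)))

-- The last step without its interlacing proof. `descend` is shown injective by recovering this from
-- its image; `K ≤ M` in `unstep-injective` excludes `start`.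
unstep : ∀ {K} {κ : Sig K} {M} {ν : Sig (suc M)} → Chain κ ν → Maybe (Σ (Sig M) (Chain κ))
unstep start              = nothing
unstep (step {ρ = ρ} c _) = just (ρ , c)

unstep-injective : ∀ {K} {κ : Sig K} {M} {ν : Sig (suc M)} → K ℕ.≤ M →
  {c d : Chain κ ν} → unstep c ≡ unstep d → c ≡ d
unstep-injective K≤M {start}    {_}        eq   = contradiction K≤M ℕ.1+n≰n
unstep-injective K≤M {step _ _} {start}    eq   = contradiction K≤M ℕ.1+n≰n
unstep-injective K≤M {step _ _} {step _ _} refl = refl

-- By the upper half of interlacing, the first K entries never decrease along a chain. This keeps
-- removed boxes from cutting into κ.
chain-≤ : ∀ {K} {κ : Sig K} {M} {ν : Sig M} → Chain κ ν → ∀ {i} (i<K : i ℕ.< K) (i<M : i ℕ.< M) →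
  κ ! fromℕ< i<K ℤ.≤ ν ! fromℕ< i<M
chain-≤ start i<K i<M = ℤ.≤-refl
chain-≤ {K} {κ} {suc M} {ν} (step {ρ = ρ} c ρ≺ν) {i} i<K i<sM = ℤ.≤-trans (chain-≤ c i<K i<M)
  (subst (λ j → ρ ! fromℕ< i<M ℤ.≤ ν ! j)
    (Fin.toℕ-injective (trans (Fin.toℕ-inject₁ (fromℕ< i<M))
      (trans (Fin.toℕ-fromℕ< i<M) (sym (Fin.toℕ-fromℕ< i<sM)))))
    (proj₁ (recompute (ρ ≺? ν) ρ≺ν (fromℕ< i<M))))
  where i<M = ℕ.<-≤-trans i<K (K≤N c)

chain-unique : ∀ {K} {κ ν : Sig K} (c d : Chain κ ν) → c ≡ d
chain-unique start      start      = refl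
chain-unique (step c _) _          = contradiction (K≤N c) ℕ.1+n≰n
chain-unique start      (step d _) = contradiction (K≤N d) ℕ.1+n≰n

chain-≡ : ∀ {K} {κ ν : Sig K} → Chain κ ν → κ ≡ ν
chain-≡ start      = refl
chain-≡ (step c _) = contradiction (K≤N c) ℕ.1+n≰n

removeBox-≤ : ∀ a i j → removeBox a i j ℕ.≤ a j
removeBox-≤ a i j with i ℕ.≟ j
... | yes refl = ℕ.≤-trans (ℕ.≤-reflexive (removeBox-same a i)) ℕ.pred[n]≤n
... | no i≢j   = ℕ.≤-reflexive (removeBox-other a i≢j)

removeBox-≥ : ∀ {a i} → Antitone a → a (suc i) ℕ.< a i → ∀ j → a (suc j) ℕ.≤ removeBox a i j
removeBox-≥ {a} {i} a↓ lt j with i ℕ.≟ j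
... | yes refl = ℕ.≤-trans (ℕ.<⇒≤pred lt) (ℕ.≤-reflexive (sym (removeBox-same a i)))
... | no i≢j   = ℕ.≤-trans (a↓ j) (ℕ.≤-reflexive (sym (removeBox-other a i≢j)))

removeBox-≢ : ∀ a {i} → 0 ℕ.< a i → removeBox a i i ≢ a i
removeBox-≢ a {i} 0<a eq = ℕ.<-irrefl (trans (sym (removeBox-same a i)) eq)
  (ℕ.≤-reflexive (ℕ.suc-pred (a i) {{ℕ.>-nonZero 0<a}}))

module _ {L : ℕ} {b : ℕ → ℕ} where

  removeSig : ∀ M a → .(Antitone a) → Refinement ℕ (Removable L b a) → Sig M
  removeSig M a a↓ (i , [ r ]) = sig M (removeBox a i) (removeBox-antitone a↓ (proj₂ (proj₂ r)))

  module _ {K} {κ : Sig K} (κ-b : ∀ i → κ ! i ≡ + b (toℕ i)) (L≤K : L ℕ.≤ K) where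

    module _ {M} (K≤M : K ℕ.≤ M) {a} (a↓ : Antitone a) where

      -- A signature ρ below a is either a or lies below a with a box removed,
      -- in any row in which they differ: hence raise and descend.
      Children : ℕ → Set
      Children M′ = Chain κ (sig M a a↓) ⊎ Σ (Refinement ℕ (Removable L b a)) λ i →
        Chain κ (removeSig M′ a a↓ i)

      -- A last step that adds no box or just one. Either way what remains ends one level lower,
      -- which is the recursion of `low`.
      raise : Children M → Chain κ (sig (suc M) a a↓)
      raise (inj₁ c)               = step c (≺-sig a↓ a↓ (λ _ → ℕ.≤-refl) a↓)
      raise (inj₂ ((i , [ r ]) , c)) = step c
        (≺-sig (removeBox-antitone a↓ (proj₂ (proj₂ r))) a↓ (removeBox-≤ a i)
          (removeBox-≥ a↓ (proj₂ (proj₂ r))))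

      previous : ∀ {ν : Sig (suc M)} {ρ σ : Sig M} {c : Chain κ ρ}
        {d : Chain κ σ} .{p : ρ ≺ ν} .{q : σ ≺ ν} →
        step {ν = ν} c p ≡ step d q → ρ ≡ σ
      previous refl = refl

      raise-injective : ∀ {x y} → raise x ≡ raise y → x ≡ y
      raise-injective {inj₁ _} {inj₁ _} eq = cong inj₁ (step-injective eq)
      raise-injective {inj₁ _} {inj₂ ((i , [ r ]) , _)} eq with recompute (removable? L b a i) r
      ... | i<L , b<a , _ = contradiction
        (sym (sig-injective a↓ (removeBox-antitone a↓ (proj₂ (proj₂ r))) (previous eq)
          (ℕ.<-≤-trans i<L (ℕ.≤-trans L≤K K≤M))))
        (removeBox-≢ a (ℕ.≤-<-trans z≤n b<a))
      raise-injective {inj₂ ((i , [ r ]) , _)} {inj₁ _} eq with recompute (removable? L b a i) r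
      ... | i<L , b<a , _ = contradiction
        (sig-injective (removeBox-antitone a↓ (proj₂ (proj₂ r))) a↓ (previous eq)
          (ℕ.<-≤-trans i<L (ℕ.≤-trans L≤K K≤M)))
        (removeBox-≢ a (ℕ.≤-<-trans z≤n b<a))
      raise-injective {inj₂ ((i , [ r ]) , _)} {inj₂ ((j , [ q ]) , _)} eq with j ℕ.≟ i
      ... | yes refl = cong (λ c → inj₂ (_ , c)) (step-injective eq)
      ... | no j≢i with recompute (removable? L b a i) r
      ...   | i<L , b<a , _ = contradiction
        (trans (sig-injective (removeBox-antitone a↓ (proj₂ (proj₂ r)))
          (removeBox-antitone a↓ (proj₂ (proj₂ q))) (previous eq)
            (ℕ.<-≤-trans i<L (ℕ.≤-trans L≤K K≤M))) (removeBox-other a j≢i))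
        (removeBox-≢ a (ℕ.≤-<-trans z≤n b<a))

      module _ (aL : a L ≡ 0) where

        differ : ∀ {ρ : Sig M} → ρ ≢ sig M a a↓ → ∃ λ i → ρ ! i ≢ sig M a a↓ ! i
        differ {ρ} ρ≢ with Fin.any? (λ i → ¬? (ρ ! i ℤ.≟ sig M a a↓ ! i))
        ... | yes diff = diff
        ... | no ¬diff = contradiction (value-injective
          (lookup-ext λ i → same-at i (ρ ! i ℤ.≟ sig M a a↓ ! i))) ρ≢
          where
          same-at : ∀ i → Dec (ρ ! i ≡ sig M a a↓ ! i) → ρ ! i ≡ sig M a a↓ ! i
          same-at i (yes eq) = eq
          same-at i (no neq) = contradiction (i , neq) ¬diff

        module _ {ρ : Sig M} (c : Chain κ ρ) (ρ≺a : ρ ≺ sig (suc M) a a↓) where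

          ρ≤a : ∀ i → ρ ! i ℤ.≤ + a (toℕ i)
          ρ≤a i = subst (ρ ! i ℤ.≤_) (trans (sig-! a↓ (inject₁ i))
            (cong (λ j → + a j) (Fin.toℕ-inject₁ i))) (proj₁ (ρ≺a i))

          a≤ρ : ∀ i → + a (suc (toℕ i)) ℤ.≤ ρ ! i
          a≤ρ i = subst (ℤ._≤ ρ ! i) (sig-! a↓ (suc i)) (proj₂ (ρ≺a i))

          module _ {i : Fin M} (ρ≢a : ρ ! i ≢ sig M a a↓ ! i) where

            ρ<a : ρ ! i ℤ.< + a (toℕ i)
            ρ<a = ℤ.≤∧≢⇒< (ρ≤a i) λ eq → ρ≢a (trans eq (sym (sig-! a↓ i)))

            a′<a : a (suc (toℕ i)) ℕ.< a (toℕ i)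
            a′<a = ℤ.drop‿+<+ (ℤ.≤-<-trans (a≤ρ i) ρ<a)

            -- A row in which ρ falls short of a has a box to give: interlacing yields a_(i+1) ≤ ρ_i
            -- < a_i, so the row is nonempty and lies before L, and b_i ≤ ρ_i comes from `chain-≤`.
            differ-removable : Removable L b a (toℕ i)
            differ-removable = i<L , b<a , a′<a
              where
              i<L : toℕ i ℕ.< L
              i<L = ℕ.≰⇒> λ L≤i → ℕ.n≮0 (subst (a (suc (toℕ i)) ℕ.<_)
                (ℕ.n≤0⇒n≡0 (subst (a (toℕ i) ℕ.≤_) aL (antitone-≤ a↓ L≤i))) a′<a)
              i<K = ℕ.<-≤-trans i<L L≤K
              b≤ρ : + b (toℕ i) ℤ.≤ ρ ! i
              b≤ρ = subst₂ ℤ._≤_ (trans (κ-b (fromℕ< i<K))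
                (cong (λ j → + b j) (Fin.toℕ-fromℕ< i<K)))
                (cong (λ j → ρ ! j) (Fin.fromℕ<-toℕ i (toℕ<n i))) (chain-≤ c i<K (toℕ<n i))
              b<a : b (toℕ i) ℕ.< a (toℕ i)
              b<a = ℤ.drop‿+<+ (ℤ.≤-<-trans b≤ρ ρ<a)

            ≺-remove : ρ ≺ removeSig (suc M) a a↓ (toℕ i , [ differ-removable ])
            ≺-remove j = subst (ρ ! j ℤ.≤_) (sym
              (trans (sig-! a⁻↓ (inject₁ j)) (cong (λ k → + removeBox a (toℕ i) k)
                (Fin.toℕ-inject₁ j)))) upper
              , subst (ℤ._≤ ρ ! j) (sym (sig-! a⁻↓ (suc j)))
                  (ℤ.≤-trans (ℤ.+≤+ (removeBox-≤ a (toℕ i) (suc (toℕ j)))) (a≤ρ j))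
              where
              a⁻↓ = removeBox-antitone a↓ a′<a
              upper : ρ ! j ℤ.≤ + removeBox a (toℕ i) (toℕ j)
              upper with i Fin.≟ j
              ... | yes refl = subst (λ k → ρ ! i ℤ.≤ + k) (sym (removeBox-same a (toℕ i)))
                (subst (ρ ! i ℤ.≤_) (pred-+ (ℕ.≤-<-trans z≤n a′<a)) (ℤ.i<j⇒i≤pred[j] ρ<a))
                where
                pred-+ : ∀ {n} → 0 ℕ.< n → ℤ.pred (+ n) ≡ + ℕ.pred n
                pred-+ (s≤s _) = refl
              ... | no i≢j = subst (λ k → ρ ! j ℤ.≤ + k)
                (sym (removeBox-other a (i≢j ∘ Fin.toℕ-injective))) (ρ≤a j)

        -- A strip is dismantled box by box. If the last step adds any box, one is taken off the
        -- final signature, in a row where it differs from ρ, while ρ and the chain to it stay. The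
        -- result has one box fewer at the same level, which is the recursion of `up`.
        lower-step : ∀ {ρ} (c : Chain κ ρ) (p : ρ ≺ sig (suc M) a a↓) → Dec (ρ ≡ sig M a a↓) →
          Children (suc M)
        lower-step c p (yes ρ≡a) = inj₁ (subst (Chain κ) ρ≡a c)
        lower-step c p (no ρ≢a)  =
          let i , ne = differ ρ≢a
          in inj₂ ((toℕ i , [ differ-removable c p ne ]) , step c (≺-remove c p ne))

        descend′ : ∀ {ν} → ν ≡ sig (suc M) a a↓ → Chain κ ν → Children (suc M)
        descend′ eq   start                   = contradiction K≤M ℕ.1+n≰n
        descend′ refl (step {ρ = ρ} c p) = lower-step c (recompute (ρ ≺? sig (suc M) a a↓) p)
          (ρ ≟Sig sig M a a↓)

        descend : Chain κ (sig (suc M) a a↓) → Children (suc M)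
        descend = descend′ refl

        -- Both kinds of child still contain ρ and the chain leading to it, since only the final
        -- signature may have changed.
        undescend : Children (suc M) → Maybe (Σ (Sig M) (Chain κ))
        undescend (inj₁ c)       = just (sig M a a↓ , c)
        undescend (inj₂ (_ , c)) = unstep c

        undescend-descend : ∀ {ν} (eq : ν ≡ sig (suc M) a a↓) (c : Chain κ ν) →
          undescend (descend′ eq c) ≡ unstep c
        undescend-descend eq   start      = contradiction K≤M ℕ.1+n≰n
        undescend-descend refl (step {ρ = ρ} c p) = go (ρ ≟Sig sig M a a↓)
          where
          go : ∀ d → undescend (lower-step c (recompute (ρ ≺? sig (suc M) a a↓) p) d) ≡ just (ρ , c)
          go (yes refl) = refl
          go (no _)     = refl

        descend-injective : ∀ {c d} → descend c ≡ descend d → c ≡ d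
        descend-injective {c} {d} eq = unstep-injective K≤M
          (trans (sym (undescend-descend refl c))
            (trans (cong undescend eq) (undescend-descend refl d)))

-- Bracketing the number of chains

Low Up : ℕ → ℕ → Set
Low k       zero    = ⊤
Low zero    (suc d) = ⊥
Low (suc k) (suc d) = Low k (suc d) ⊎ Low k d
Up k       zero    = ⊤
Up zero    (suc d) = ⊥
Up (suc k) (suc d) = Up k (suc d) ⊎ Up (suc k) d

-- low k d = C(k,d) and up k d = C(k+d-1,d), defined so as to count Low and Up.
low up : ℕ → ℕ → ℕ
low k       zero    = 1
low zero    (suc d) = 0
low (suc k) (suc d) = low k (suc d) ℕ.+ low k d
up k       zero    = 1
up zero    (suc d) = 0
up (suc k) (suc d) = up k (suc d) ℕ.+ up (suc k) d

low-↔ : ∀ k d → Fin (low k d) ↔ Low k d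
low-↔ k       zero    = Fin.1↔⊤
low-↔ zero    (suc d) = Fin.0↔⊥
low-↔ (suc k) (suc d) = ↔-trans Fin.+↔⊎ (low-↔ k (suc d) ⊎-↔ low-↔ k d)

up-↔ : ∀ k d → Fin (up k d) ↔ Up k d
up-↔ k       zero    = Fin.1↔⊤
up-↔ zero    (suc d) = Fin.0↔⊥
up-↔ (suc k) (suc d) = ↔-trans Fin.+↔⊎ (up-↔ k (suc d) ⊎-↔ up-↔ (suc k) d)

∑≡0 : ∀ {n} (f : Fin n → ℕ) → ∑ℕ f ≡ 0 → ∀ i → f i ≡ 0
∑≡0 f eq zero    = ℕ.m+n≡0⇒m≡0 (f zero) eq
∑≡0 f eq (suc i) = ∑≡0 (f ∘ suc) (ℕ.m+n≡0⇒n≡0 (f zero) eq) i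

Skew-0⇒≡ : ∀ {L b a} → Skew L b 0 a → ∀ i → a i ≡ b i
Skew-0⇒≡ {L} {b} {a} (skew a↓ aL b≤a ex) i with i ℕ.<? L
... | yes i<L = ℕ.≤-antisym (subst (λ j → a j ℕ.≤ b j) (Fin.toℕ-fromℕ< i<L)
  (ℕ.m∸n≡0⇒m≤n (∑≡0 {L} (λ j → a (toℕ j) ℕ.∸ b (toℕ j)) ex (fromℕ< i<L)))) (b≤a i)
... | no i≮L  = trans ai≡0 (sym (ℕ.n≤0⇒n≡0 (subst (b i ℕ.≤_) ai≡0 (b≤a i))))
  where
  ai≡0 : a i ≡ 0
  ai≡0 = ℕ.n≤0⇒n≡0 (subst (a i ℕ.≤_) aL (antitone-≤ a↓ (ℕ.≮⇒≥ i≮L)))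

∑-const-0 : ∀ {n} (f : Fin n → ℕ) → (∀ i → f i ≡ 0) → ∑ℕ f ≡ 0
∑-const-0 {zero}  f eq = refl
∑-const-0 {suc n} f eq = cong₂ ℕ._+_ (eq zero) (∑-const-0 (f ∘ suc) (eq ∘ suc))

module _ {L N} {b : ℕ → ℕ} {κ : Sig N} (κ-b : ∀ i → κ ! i ≡ + b (toℕ i)) (L≤N : L ℕ.≤ N) where

  open Skew

  sig-≡ : ∀ {a} (a↓ : Antitone a) → (∀ i → a i ≡ b i) → κ ≡ sig N a a↓
  sig-≡ a↓ a≡b = value-injective (lookup-ext λ i →
    trans (κ-b i) (trans (cong +_ (sym (a≡b (toℕ i)))) (sym (sig-! a↓ i))))

  -- `Low k d` tells, from the end of the chain backwards, which d of the k steps add a box, and the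
  -- path tells which box. Chains with larger strips are not reached.
  embed : ∀ k d {a} (s : Skew L b d a) → (Path L b d a × Low k d) ↣
    Chain κ (sig (k ℕ.+ N) a (rows↓ s))
  embed zero zero s = mk↣ {to = λ _ → subst (Chain κ) (sig-≡ (rows↓ s) (Skew-0⇒≡ s)) start} λ _ →
    refl
  embed zero (suc d) s = mk↣ {to = λ ()} λ { {()} }
  embed (suc k) zero s = mk↣ {to = λ x → raise {b = b} κ-b L≤N (ℕ.m≤n+m N k) (rows↓ s)
    (inj₁ (Injection.to (embed k zero s) x))} λ _ → refl
  embed (suc k) (suc d) {a} s = mk↣ {to = raise κ-b L≤N (ℕ.m≤n+m N k) (rows↓ s) ∘ spread}
    (spread-injective ∘ raise-injective κ-b L≤N (ℕ.m≤n+m N k) (rows↓ s))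
    where
    child : ∀ {i} → .(Removable L b a i) → Skew L b d (removeBox a i)
    child {i} r = skew-remove s (recompute (removable? L b a i) r)
    spread : Path L b (suc d) a × Low (suc k) (suc d) →
      Children κ-b L≤N (ℕ.m≤n+m N k) (rows↓ s) (k ℕ.+ N)
    spread (p , inj₁ l) = inj₁ (Injection.to (embed k (suc d) s) (p , l))
    spread (((i , [ r ]) , p) , inj₂ l) = inj₂
      ((i , [ r ]) , Injection.to (embed k d (child r)) (p , l))
    spread-injective : ∀ {x y} → spread x ≡ spread y → x ≡ y
    spread-injective {p , inj₁ l} {q , inj₁ m} eq
      with Injection.injective (embed k (suc d) s) (inj₁-inj eq)
      where
      inj₁-inj : ∀ {A B : Set} {x y : A} → _≡_ {A = A ⊎ B} (inj₁ x) (inj₁ y) → x ≡ y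
      inj₁-inj refl = refl
    ... | refl = refl
    spread-injective {((i , [ r ]) , p) , inj₂ l} {((j , _) , q) , inj₂ m} eq with row-≡ eq
      where
      row-≡ : ∀ {A : Set} {B : Refinement ℕ (Removable L b a) → Set} {x y} {u : B x} {v : B y} →
        _≡_ {A = A ⊎ Σ _ B} (inj₂ (x , u)) (inj₂ (y , v)) → value x ≡ value y
      row-≡ refl = refl
    ... | refl with Injection.injective (embed k d (child r)) (inj₂-inj eq)
      where
      inj₂-inj : ∀ {A X : Set} {B : X → Set} {x} {u v : B x} →
        _≡_ {A = A ⊎ Σ _ B} (inj₂ (x , u)) (inj₂ (x , v)) → u ≡ v
      inj₂-inj refl = refl
    ...   | refl = refl

  -- `Up k d` distributes d boxes over k steps with repetition, as one strip may hold several. The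
  -- recursion is lexicographic: passing a step lowers k, removing a box lowers d and keeps k. The
  -- map need not be onto, since boxes assigned to one step need not form a horizontal strip.
  compress : ∀ k d {a} (s : Skew L b d a) → Chain κ (sig (k ℕ.+ N) a (rows↓ s)) ↣
    (Path L b d a × Up k d)
  compress zero zero s = mk↣ {to = λ _ → tt , tt} λ {c} {d} _ → chain-unique c d
  compress zero (suc d) {a} s = mk↣ {to = ⊥-elim ∘ absurd} λ {c} → ⊥-elim (absurd c)
    where
    absurd : ¬ Chain κ (sig N a (rows↓ s))
    absurd c = ℕ.0≢1+n (trans (sym (∑-const-0 {L} (λ i → a (toℕ i) ℕ.∸ b (toℕ i)) λ i →
      trans (cong (ℕ._∸ b (toℕ i)) (a≡b (ℕ.<-≤-trans (toℕ<n i) L≤N))) (ℕ.n∸n≡0 (b (toℕ i)))))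
        (excess s))
      where
      a≡b : ∀ {i} → i ℕ.< N → a i ≡ b i
      a≡b {i} i<N = ℤ.+-injective (begin
        + a i                            ≡⟨ cong (λ j → + a j) (Fin.toℕ-fromℕ< i<N) ⟨
        + a (toℕ (fromℕ< i<N))           ≡⟨ sig-! (rows↓ s) (fromℕ< i<N) ⟨
        sig N a (rows↓ s) ! fromℕ< i<N   ≡⟨ cong (λ ν → ν ! fromℕ< i<N) (chain-≡ c) ⟨
        κ ! fromℕ< i<N                   ≡⟨ κ-b (fromℕ< i<N) ⟩
        + b (toℕ (fromℕ< i<N))           ≡⟨ cong (λ j → + b j) (Fin.toℕ-fromℕ< i<N) ⟩
        + b i                            ∎)
        where open ≡-Reasoning
  compress (suc k) d {a} s = mk↣ {to = gather d s ∘
    descend κ-b L≤N (ℕ.m≤n+m N k) (rows↓ s) (support s)}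
    (descend-injective κ-b L≤N (ℕ.m≤n+m N k) (rows↓ s) (support s) ∘ gather-injective d s)
    where
    no-child : ∀ {i} → Skew L b 0 a → .(Removable L b a i) → ⊥
    no-child {i} s r = ℕ.<⇒≢ (proj₁ (proj₂ (recompute (removable? L b a i) r))) (sym (Skew-0⇒≡ s i))
    child : ∀ {d i} → Skew L b (suc d) a → .(Removable L b a i) → Skew L b d (removeBox a i)
    child {d} {i} s r = skew-remove s (recompute (removable? L b a i) r)
    gather : ∀ d (s : Skew L b d a) → Children κ-b L≤N (ℕ.m≤n+m N k) (rows↓ s) (suc k ℕ.+ N) →
      Path L b d a × Up (suc k) d
    -- With no box left only the summand `inj₁` can occur; `no-child` rules out the other one.
    gather zero    s _ = tt , tt
    gather (suc d) s (inj₁ c) = let p , u = Injection.to (compress k (suc d) s) c in p , inj₁ u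
    gather (suc d) s (inj₂ ((i , [ r ]) , c)) =
      let p , u = Injection.to (compress (suc k) d (child s r)) c in ((i , [ r ]) , p) , inj₂ u
    gather-injective : ∀ d (s : Skew L b d a) {x y} → gather d s x ≡ gather d s y → x ≡ y
    gather-injective zero    s {inj₁ c} {inj₁ d} eq =
      cong inj₁ (Injection.injective (compress k zero s) refl)
    gather-injective zero    s {inj₂ ((i , [ r ]) , _)} {_} eq = ⊥-elim (no-child s r)
    gather-injective zero    s {_} {inj₂ ((i , [ r ]) , _)} eq = ⊥-elim (no-child s r)
    gather-injective (suc d) s {inj₁ c} {inj₁ c′} eq =
      cong inj₁ (Injection.injective (compress k (suc d) s) (split eq))
      where
      split : ∀ {A B C : Set} {x y : A} {u v : B} →
        _≡_ {A = A × (B ⊎ C)} (x , inj₁ u) (y , inj₁ v) → _≡_ {A = A × B} (x , u) (y , v)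
      split refl = refl
    gather-injective (suc d) s {inj₂ ((i , [ r ]) , c)} {inj₂ ((j , _) , c′)} eq
      with cong (value ∘ proj₁ ∘ proj₁) eq
    ... | refl = cong (λ c → inj₂ (_ , c)) (Injection.injective (compress (suc k) d (child s r))
      (split eq))
      where
      split : ∀ {A X C : Set} {B : X → Set} {x} {y z : B x} {u v : A} →
        _≡_ {A = Σ X B × (C ⊎ A)} ((x , y) , inj₂ u) ((x , z) , inj₂ v) →
          _≡_ {A = B x × A} (y , u) (z , v)
      split refl = refl

  ↣⇒≤ : ∀ {A B : Set} {m n} → Fin m ↔ A → Fin n ↔ B → A ↣ B → m ℕ.≤ n
  ↣⇒≤ m↔A n↔B A↣B = Fin.injective⇒≤ {f = Inverse.from n↔B ∘ Injection.to A↣B ∘ Inverse.to m↔A}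
    (Injection.injective (↔⇒↣ m↔A) ∘ Injection.injective A↣B ∘
      Injection.injective (↔⇒↣ (↔-sym n↔B)))

  module _ {d a} (s : Skew L b d a) where

    paths*low≤Dim₂ : ∀ k → paths L b d a ℕ.* low k d ℕ.≤ Dim₂ κ (sig (k ℕ.+ N) a (rows↓ s))
    paths*low≤Dim₂ k = ↣⇒≤ (↔-trans Fin.*↔× (paths-↔ L b d a ×-↔ low-↔ k d))
      (finite-↔ (chain-finite κ (sig (k ℕ.+ N) a (rows↓ s)))) (embed k d s)

    Dim₂≤paths*up : ∀ k → Dim₂ κ (sig (k ℕ.+ N) a (rows↓ s)) ℕ.≤ paths L b d a ℕ.* up k d
    Dim₂≤paths*up k = ↣⇒≤ (finite-↔ (chain-finite κ (sig (k ℕ.+ N) a (rows↓ s))))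
      (↔-trans Fin.*↔× (paths-↔ L b d a ×-↔ up-↔ k d)) (compress k d s)

-- Power bounds for the two binomial counts

suc-^≤ : ∀ x d → suc x ℕ.^ suc d ℕ.≤ x ℕ.^ suc d ℕ.+ suc d ℕ.* suc x ℕ.^ d
suc-^≤ x zero    = ℕ.≤-reflexive (identity x)
  where
  identity : ∀ x → suc (x ℕ.* 1) ≡ x ℕ.* 1 ℕ.+ 1
  identity = solve-∀
suc-^≤ x (suc d) = begin
  suc x ℕ.* s′
    ≡⟨⟩
  s′ ℕ.+ x ℕ.* s′
    ≤⟨ ℕ.+-monoʳ-≤ s′ (ℕ.*-monoʳ-≤ x (suc-^≤ x d)) ⟩
  s′ ℕ.+ x ℕ.* (x ℕ.^ suc d ℕ.+ suc d ℕ.* s)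
    ≡⟨ expand x s′ (x ℕ.^ suc d) (suc d) s ⟩
  x ℕ.* x ℕ.^ suc d ℕ.+ (s′ ℕ.+ suc d ℕ.* (x ℕ.* s))
    ≤⟨ ℕ.+-monoʳ-≤ (x ℕ.* x ℕ.^ suc d) (ℕ.+-monoʳ-≤ s′
      (ℕ.*-monoʳ-≤ (suc d) (ℕ.*-monoˡ-≤ s (ℕ.n≤1+n x)))) ⟩
  x ℕ.* x ℕ.^ suc d ℕ.+ (s′ ℕ.+ suc d ℕ.* s′) ∎
  where
  open ℕ.≤-Reasoning
  s  = suc x ℕ.^ d
  s′ = suc x ℕ.^ suc d
  expand : ∀ x s′ p d s → s′ ℕ.+ x ℕ.* (p ℕ.+ d ℕ.* s) ≡ x ℕ.* p ℕ.+ (s′ ℕ.+ d ℕ.* (x ℕ.* s))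
  expand = solve-∀

-- With `suc-^≤`, a discrete mean value estimate: the increment of the power d + 1 from x to x + 1
-- is (d + 1) times a d-th power of something between. This is what turns the recursions of `up` and
-- `low` into bounds by pure powers.
≤suc-^ : ∀ x d → x ℕ.^ suc d ℕ.+ suc d ℕ.* x ℕ.^ d ℕ.≤ suc x ℕ.^ suc d
≤suc-^ x zero    = ℕ.≤-reflexive (identity x)
  where
  identity : ∀ x → x ℕ.* 1 ℕ.+ 1 ≡ suc (x ℕ.* 1)
  identity = solve-∀
≤suc-^ x (suc d) = begin
  x ℕ.* (x ℕ.* p) ℕ.+ (x ℕ.* p ℕ.+ suc d ℕ.* (x ℕ.* p))
    ≤⟨ ℕ.m≤m+n _ (suc d ℕ.* p) ⟩
  x ℕ.* (x ℕ.* p) ℕ.+ (x ℕ.* p ℕ.+ suc d ℕ.* (x ℕ.* p)) ℕ.+ suc d ℕ.* p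
    ≡⟨ expand x p (suc d) ⟩
  suc x ℕ.* (x ℕ.* p ℕ.+ suc d ℕ.* p)
    ≤⟨ ℕ.*-monoʳ-≤ (suc x) (≤suc-^ x d) ⟩
  suc x ℕ.* suc x ℕ.^ suc d ∎
  where
  open ℕ.≤-Reasoning
  p = x ℕ.^ d
  expand : ∀ x p d → x ℕ.* (x ℕ.* p) ℕ.+ (x ℕ.* p ℕ.+ d ℕ.* (x ℕ.* p)) ℕ.+ d ℕ.* p ≡
                     suc x ℕ.* (x ℕ.* p ℕ.+ d ℕ.* p)
  expand = solve-∀

!-distrib : ∀ d l m → suc d ! ℕ.* (l ℕ.+ m) ≡ suc d ! ℕ.* l ℕ.+ suc d ℕ.* (d ! ℕ.* m)
!-distrib d l m = identity (suc d) (d !) l m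
  where
  identity : ∀ s f l m → s ℕ.* f ℕ.* (l ℕ.+ m) ≡ s ℕ.* f ℕ.* l ℕ.+ s ℕ.* (f ℕ.* m)
  identity = solve-∀

-- For y = k - d the two terms of the recursion give (y - 1)^(d+1) and (d + 1) y^d, which `suc-^≤`
-- adds up. The base k - d is cruder than k - d + 1, but a bounded shift is invisible in the limit.
^≤!*low : ∀ k d → (k ℕ.∸ d) ℕ.^ d ℕ.≤ d ! ℕ.* low k d
^≤!*low k       zero    = ℕ.≤-refl
^≤!*low zero    (suc d) = z≤n
^≤!*low (suc k) (suc d) = begin
  (k ℕ.∸ d) ℕ.^ suc d
    ≤⟨ descend-^ (k ℕ.∸ d) ⟩
  ℕ.pred (k ℕ.∸ d) ℕ.^ suc d ℕ.+ suc d ℕ.* (k ℕ.∸ d) ℕ.^ d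
    ≡⟨ cong (λ x → x ℕ.^ suc d ℕ.+ suc d ℕ.* (k ℕ.∸ d) ℕ.^ d) (ℕ.pred[m∸n]≡m∸[1+n] k d) ⟩
  (k ℕ.∸ suc d) ℕ.^ suc d ℕ.+ suc d ℕ.* (k ℕ.∸ d) ℕ.^ d
    ≤⟨ ℕ.+-mono-≤ (^≤!*low k (suc d)) (ℕ.*-monoʳ-≤ (suc d) (^≤!*low k d)) ⟩
  suc d ! ℕ.* low k (suc d) ℕ.+ suc d ℕ.* (d ! ℕ.* low k d)
    ≡⟨ !-distrib d (low k (suc d)) (low k d) ⟨
  suc d ! ℕ.* (low k (suc d) ℕ.+ low k d) ∎
  where
  open ℕ.≤-Reasoning
  descend-^ : ∀ y → y ℕ.^ suc d ℕ.≤ ℕ.pred y ℕ.^ suc d ℕ.+ suc d ℕ.* y ℕ.^ d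
  descend-^ zero    = z≤n
  descend-^ (suc x) = suc-^≤ x d

!*up≤^ : ∀ k d → d ! ℕ.* up k d ℕ.≤ (k ℕ.+ d) ℕ.^ d
!*up≤^ k       zero    = ℕ.≤-refl
!*up≤^ zero    (suc d) = subst (ℕ._≤ suc d ℕ.^ suc d) (sym (ℕ.*-zeroʳ (suc d !))) z≤n
!*up≤^ (suc k) (suc d) = begin
  suc d ! ℕ.* (up k (suc d) ℕ.+ up (suc k) d)
    ≡⟨ !-distrib d (up k (suc d)) (up (suc k) d) ⟩
  suc d ! ℕ.* up k (suc d) ℕ.+ suc d ℕ.* (d ! ℕ.* up (suc k) d)
    ≤⟨ ℕ.+-mono-≤ (!*up≤^ k (suc d)) (ℕ.*-monoʳ-≤ (suc d) (!*up≤^ (suc k) d)) ⟩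
  (k ℕ.+ suc d) ℕ.^ suc d ℕ.+ suc d ℕ.* (suc k ℕ.+ d) ℕ.^ d
    ≡⟨ cong (λ x → (k ℕ.+ suc d) ℕ.^ suc d ℕ.+ suc d ℕ.* x ℕ.^ d) (ℕ.+-suc k d) ⟨
  (k ℕ.+ suc d) ℕ.^ suc d ℕ.+ suc d ℕ.* (k ℕ.+ suc d) ℕ.^ d
    ≤⟨ ≤suc-^ (k ℕ.+ suc d) d ⟩
  (suc k ℕ.+ suc d) ℕ.^ suc d ∎
  where open ℕ.≤-Reasoning

module _ {L N} {b : ℕ → ℕ} {κ : Sig N} (κ-b : ∀ i → κ ! i ≡ + b (toℕ i)) (L≤N : L ℕ.≤ N)
         {d a} (s : Skew L b d a) {M} (N≤M : N ℕ.≤ M) where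
  open Skew s
  private
    A = Dim₂ κ (sig M a rows↓)
    bounds : ∀ k → k ℕ.+ N ≡ M → paths L b d a ℕ.* low k d ℕ.≤ A × A ℕ.≤ paths L b d a ℕ.* up k d
    bounds k refl = paths*low≤Dim₂ κ-b L≤N s k , Dim₂≤paths*up κ-b L≤N s k
    p = paths L b d a
    k = M ℕ.∸ N
    swap : ∀ f p l → p ℕ.* (f ℕ.* l) ≡ f ℕ.* (p ℕ.* l)
    swap = solve-∀
    open ℕ.≤-Reasoning

  ^≤!*Dim₂ : p ℕ.* (k ℕ.∸ d) ℕ.^ d ℕ.≤ d ! ℕ.* A
  ^≤!*Dim₂ = begin
    p ℕ.* (k ℕ.∸ d) ℕ.^ d      ≤⟨ ℕ.*-monoʳ-≤ p (^≤!*low k d) ⟩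
    p ℕ.* (d ! ℕ.* low k d)    ≡⟨ swap (d !) p (low k d) ⟩
    d ! ℕ.* (p ℕ.* low k d)    ≤⟨ ℕ.*-monoʳ-≤ (d !) (proj₁ (bounds k (ℕ.m∸n+n≡m N≤M))) ⟩
    d ! ℕ.* A                  ∎

  !*Dim₂≤^ : d ! ℕ.* A ℕ.≤ p ℕ.* (k ℕ.+ d) ℕ.^ d
  !*Dim₂≤^ = begin
    d ! ℕ.* A                  ≤⟨ ℕ.*-monoʳ-≤ (d !) (proj₂ (bounds k (ℕ.m∸n+n≡m N≤M))) ⟩
    d ! ℕ.* (p ℕ.* up k d)     ≡⟨ swap (d !) p (up k d) ⟨
    p ℕ.* (d ! ℕ.* up k d)     ≤⟨ ℕ.*-monoʳ-≤ p (!*up≤^ k d) ⟩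
    p ℕ.* (k ℕ.+ d) ℕ.^ d      ∎

-- Sizes and dimensions of Young diagrams

size≡∑ : ∀ α → size α ≡ ∑ℕ {ℓ α} (λ i → α ‼ toℕ i)
size≡∑ α = go (rows α)
  where
  go : ∀ xs → sum xs ≡ ∑ℕ {List.length xs} (row xs ∘ toℕ)
  go []       = refl
  go (x ∷ xs) = cong (x ℕ.+_) (go xs)

length-concatMap : ∀ {A : Set} (f : ℕ → List A) (g : ℕ → ℕ) n →
  List.length (List.concatMap f (List.applyUpTo g n)) ≡ ∑ℕ {n} (λ i → List.length (f (g (toℕ i))))
length-concatMap f g zero    = refl
length-concatMap f g (suc n) = trans (List.length-++ (f (g 0)))
  (cong (List.length (f (g 0)) ℕ.+_) (length-concatMap f (g ∘ suc) n))

length-boxes : ∀ α β → List.length (boxes α β) ≡ ∑ℕ {ℓ α} (λ i → α ‼ toℕ i ℕ.∸ β ‼ toℕ i)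
length-boxes α β = trans (length-concatMap (rowBoxes α β) id (ℓ α))
  (∑ℕ-cong {ℓ α} λ i → List.length-applyUpTo _ (α ‼ toℕ i ℕ.∸ β ‼ toℕ i))

straight-skew : ∀ α → Skew (ℓ α) (λ _ → 0) (size α) (α ‼_)
straight-skew α = skew (rows-antitone α) (row-beyond (rows α) ℕ.≤-refl) (λ _ → z≤n) (sym (size≡∑ α))

dim≡paths : ∀ α → dim α ≡ paths (ℓ α) (λ _ → 0) (size α) (α ‼_)
dim≡paths α = trans (skewDim≡paths α ∅)
  (cong (λ n → paths (ℓ α) (λ _ → 0) n (α ‼_)) (trans (length-boxes α ∅) (sym (size≡∑ α))))

dim-growth : ∀ α → ι (dim α) ≡ ι (size α !) ℚ.* growth (ℓ α) (α ‼_)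
dim-growth α = trans (cong ι (dim≡paths α)) (paths-growth (straight-skew α))

module _ (α β : YoungDiagram) (β⊆α : β ⊆ α) where

  private
    d = List.length (boxes α β)

    vanishes-α : ∀ {i} → ℓ α ℕ.≤ i → β ‼ i ≡ 0
    vanishes-α {i} le = ℕ.n≤0⇒n≡0 (subst (β ‼ i ℕ.≤_) (row-beyond (rows α) le) (β⊆α i))

    size-β : size β ≡ ∑ℕ {ℓ α} (λ i → β ‼ toℕ i)
    size-β with ℕ.≤-total (ℓ α) (ℓ β)
    ... | inj₁ le = trans (size≡∑ β) (∑-stable {ℓ α} {β ‼_} vanishes-α le)
    ... | inj₂ ge = trans (size≡∑ β) (sym (∑-stable {ℓ β} {β ‼_} (row-beyond (rows β)) ge))

  size-+ : size β ℕ.+ d ≡ size α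
  size-+ = begin
    size β ℕ.+ d
      ≡⟨ cong₂ ℕ._+_ size-β (length-boxes α β) ⟩
    ∑ℕ {ℓ α} (λ i → β ‼ toℕ i) ℕ.+ ∑ℕ {ℓ α} (λ i → α ‼ toℕ i ℕ.∸ β ‼ toℕ i)
      ≡⟨ ∑ℕ-distrib-+ {ℓ α} (λ i → β ‼ toℕ i) (λ i → α ‼ toℕ i ℕ.∸ β ‼ toℕ i) ⟨
    ∑ℕ {ℓ α} (λ i → β ‼ toℕ i ℕ.+ (α ‼ toℕ i ℕ.∸ β ‼ toℕ i))
      ≡⟨ ∑ℕ-cong {ℓ α} (λ i → ℕ.m+[n∸m]≡n (β⊆α (toℕ i))) ⟩
    ∑ℕ {ℓ α} (λ i → α ‼ toℕ i)
      ≡⟨ size≡∑ α ⟨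
    size α ∎
    where open ≡-Reasoning

  skew-skew : Skew (ℓ α) (β ‼_) d (α ‼_)
  skew-skew = skew (rows-antitone α) (row-beyond (rows α) ℕ.≤-refl) β⊆α (sym (length-boxes α β))

-- Limits of rational sequences

infix 4 _⇝_

-- q and x are Cauchy with the same limit; x will be the sequence of a real.
record _⇝_ (q x : ℕ → ℚ) : Set where
  field approach : ∀ ε → 0ℚ ℚ.< ε → ∃[ K ] ∀ k n → K ℕ.≤ k → K ℕ.≤ n → ℚ.∣ q k ℚ.- x n ∣ ℚ.< ε

open _⇝_

Eventually : (ℕ → Set) → Set
Eventually P = ∃[ K ] ∀ k → K ℕ.≤ k → P k

p≤∣p∣ : ∀ p → p ℚ.≤ ℚ.∣ p ∣
p≤∣p∣ p with ℚ.≤-total 0ℚ p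
... | inj₁ 0≤p = ℚ.≤-reflexive (sym (ℚ.0≤p⇒∣p∣≡p 0≤p))
... | inj₂ p≤0 = ℚ.≤-trans p≤0 (ℚ.0≤∣p∣ p)

∣∣<-intro : ∀ {p ε} → p ℚ.< ε → ℚ.- p ℚ.< ε → ℚ.∣ p ∣ ℚ.< ε
∣∣<-intro {p} p<ε -p<ε with ℚ.∣p∣≡p∨∣p∣≡-p p
... | inj₁ eq = subst (ℚ._< _) (sym eq) p<ε
... | inj₂ eq = subst (ℚ._< _) (sym eq) -p<ε

∣-∣-triangle : ∀ p q r → ℚ.∣ p ℚ.- r ∣ ℚ.≤ ℚ.∣ p ℚ.- q ∣ ℚ.+ ℚ.∣ q ℚ.- r ∣
∣-∣-triangle p q r = subst (λ u → ℚ.∣ u ∣ ℚ.≤ ℚ.∣ p ℚ.- q ∣ ℚ.+ ℚ.∣ q ℚ.- r ∣)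
  (solve 3 (λ p q r → (p :- q) :+ (q :- r) := p :- r) refl p q r)
    (ℚ.∣p+q∣≤∣p∣+∣q∣ (p ℚ.- q) (q ℚ.- r))

∣-∣-halves : ∀ p q r {ε} → ℚ.∣ p ℚ.- q ∣ ℚ.< ½ ℚ.* ε → ℚ.∣ q ℚ.- r ∣ ℚ.< ½ ℚ.* ε →
  ℚ.∣ p ℚ.- r ∣ ℚ.< ε
∣-∣-halves p q r {ε} pq qr = ℚ.≤-<-trans (∣-∣-triangle p q r)
  (subst (ℚ.∣ p ℚ.- q ∣ ℚ.+ ℚ.∣ q ℚ.- r ∣ ℚ.<_) (halves ε) (ℚ.+-mono-< pq qr))

⇝-sym : ∀ {q x} → q ⇝ x → x ⇝ q
approach (⇝-sym {q} {x} qx) ε 0<ε with approach qx ε 0<ε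
... | K , h = K , λ k n k≥ n≥ → subst (ℚ._< ε) (∣-∣-comm (q n) (x k)) (h n k n≥ k≥)

⇝-trans : ∀ {p q x} → p ⇝ q → q ⇝ x → p ⇝ x
approach (⇝-trans {p} {q} {x} pq qx) ε 0<ε with approach pq (½ ℚ.* ε) (half-pos 0<ε)
  | approach qx (½ ℚ.* ε) (half-pos 0<ε)
... | K , h | L , g = K ℕ.⊔ L , λ k n k≥ n≥ → ∣-∣-halves (p k) (q (K ℕ.⊔ L)) (x n)
  (h k (K ℕ.⊔ L) (ℕ.m⊔n≤o⇒m≤o K L k≥) (ℕ.m≤m⊔n K L))
  (g (K ℕ.⊔ L) n (ℕ.m≤n⊔m K L) (ℕ.m⊔n≤o⇒n≤o K L n≥))

⇝-close : ∀ {p q x} → (∀ ε → 0ℚ ℚ.< ε → Eventually λ k → ℚ.∣ p k ℚ.- q k ∣ ℚ.< ε) → q ⇝ x → p ⇝ x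
approach (⇝-close {p} {q} {x} pq qx) ε 0<ε with pq (½ ℚ.* ε) (half-pos 0<ε)
  | approach qx (½ ℚ.* ε) (half-pos 0<ε)
... | K , h | L , g = K ℕ.⊔ L , λ k n k≥ n≥ → ∣-∣-halves (p k) (q k) (x n)
  (h k (ℕ.m⊔n≤o⇒m≤o K L k≥)) (g k n (ℕ.m⊔n≤o⇒n≤o K L k≥) (ℕ.m⊔n≤o⇒n≤o K L n≥))

⇝-const : ∀ c → (λ _ → c) ⇝ (λ _ → c)
approach (⇝-const c) ε 0<ε = 0 , λ _ _ _ _ → subst (ℚ._< ε) (sym (cong ℚ.∣_∣ (ℚ.+-inverseʳ c))) 0<ε

⇝-cong : ∀ {p q x y} → (∀ k → p k ≡ q k) → (∀ n → x n ≡ y n) → p ⇝ x → q ⇝ y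
approach (⇝-cong p≗q x≗y px) ε 0<ε with approach px ε 0<ε
... | K , h = K , λ k n k≥ n≥ → subst₂ (λ u v → ℚ.∣ u ℚ.- v ∣ ℚ.< ε) (p≗q k) (x≗y n) (h k n k≥ n≥)

⇝-bounded : ∀ {q x} → q ⇝ x → ∃[ B ] 0ℚ ℚ.< B × Eventually λ k → ℚ.∣ q k ∣ ℚ.≤ B
⇝-bounded {q} {x} qx with approach qx 1ℚ (ℚ.positive⁻¹ 1ℚ)
... | K , h = 1ℚ ℚ.+ ℚ.∣ x K ∣ , ℚ.+-mono-<-≤ (ℚ.positive⁻¹ 1ℚ) (ℚ.0≤∣p∣ (x K)) , K , λ k k≥ →
  ℚ.≤-trans (∣p∣≤ (q k) (x K)) (ℚ.+-monoˡ-≤ ℚ.∣ x K ∣ (ℚ.<⇒≤ (h k K k≥ ℕ.≤-refl)))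

⇝-* : ∀ {p q x y} → p ⇝ x → q ⇝ y → (λ k → p k ℚ.* q k) ⇝ (λ n → x n ℚ.* y n)
approach (⇝-* {p} {q} {x} {y} px qy) ε 0<ε =
  let A , 0<A , I , hA = ⇝-bounded px
      B , 0<B , J , hB = ⇝-bounded (⇝-sym qy)
      α , 0<α , Aα     = divide A 0<A (½ ℚ.* ε) (half-pos 0<ε)
      β , 0<β , Bβ     = divide B 0<B (½ ℚ.* ε) (half-pos 0<ε)
      K , hp           = approach px β 0<β
      L , hq           = approach qy α 0<α
      R = I ℕ.⊔ J ; S = K ℕ.⊔ L
  in R ℕ.⊔ S , λ k n k≥ n≥ →
    subst (ℚ.∣ p k ℚ.* q k ℚ.- x n ℚ.* y n ∣ ℚ.<_) (halves ε)
      (*-close {A} {B} {p k} {q k} {x n} {y n} {α} {β} {½ ℚ.* ε} 0<A 0<B Aα Bβ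
        (hA k (ℕ.m⊔n≤o⇒m≤o I J (ℕ.m⊔n≤o⇒m≤o R S k≥)))
        (hB n (ℕ.m⊔n≤o⇒n≤o I J (ℕ.m⊔n≤o⇒m≤o R S n≥)))
        (hq k n (ℕ.m⊔n≤o⇒n≤o K L (ℕ.m⊔n≤o⇒n≤o R S k≥)) (ℕ.m⊔n≤o⇒n≤o K L (ℕ.m⊔n≤o⇒n≤o R S n≥)))
        (hp k n (ℕ.m⊔n≤o⇒m≤o K L (ℕ.m⊔n≤o⇒n≤o R S k≥)) (ℕ.m⊔n≤o⇒m≤o K L (ℕ.m⊔n≤o⇒n≤o R S n≥))))

⇝-1- : ∀ {q x} → q ⇝ x → (λ k → 1ℚ ℚ.- q k) ⇝ (λ n → 1ℚ ℚ.- x n)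
approach (⇝-1- {q} {x} qx) ε 0<ε with approach qx ε 0<ε
... | K , h = K , λ k n k≥ n≥ → subst (ℚ._< ε)
  (trans (∣-∣-comm (q k) (x n)) (cong ℚ.∣_∣
    (solve 3 (λ o q x → x :- q := (o :- q) :- (o :- x)) refl 1ℚ (q k) (x n)))) (h k n k≥ n≥)

⇝-squeeze : ∀ {p q r x} → p ⇝ x → r ⇝ x → Eventually (λ k → p k ℚ.≤ q k × q k ℚ.≤ r k) → q ⇝ x
approach (⇝-squeeze {p} {q} {r} {x} px rx (J , pqr)) ε 0<ε with approach px ε 0<ε
  | approach rx ε 0<ε
... | K , h | L , g = J ℕ.⊔ (K ℕ.⊔ L) , λ k n k≥ n≥ →
  let k≥′ = ℕ.m⊔n≤o⇒n≤o J (K ℕ.⊔ L) k≥ ; n≥′ = ℕ.m⊔n≤o⇒n≤o J (K ℕ.⊔ L) n≥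
      p≤q , q≤r = pqr k (ℕ.m⊔n≤o⇒m≤o J (K ℕ.⊔ L) k≥)
  in ∣∣<-intro
    (ℚ.≤-<-trans (ℚ.≤-trans (ℚ.+-monoˡ-≤ (ℚ.- x n) q≤r) (p≤∣p∣ (r k ℚ.- x n)))
      (g k n (ℕ.m⊔n≤o⇒n≤o K L k≥′) (ℕ.m⊔n≤o⇒n≤o K L n≥′)))
    (ℚ.≤-<-trans (ℚ.≤-trans (subst₂ ℚ._≤_ (sym (-[p-q] (q k) (x n))) (sym (-[p-q] (p k) (x n)))
        (ℚ.+-monoʳ-≤ (x n) (ℚ.neg-antimono-≤ p≤q)))
        (ℚ.≤-trans (p≤∣p∣ (ℚ.- (p k ℚ.- x n))) (ℚ.≤-reflexive (ℚ.∣-p∣≡∣p∣ (p k ℚ.- x n)))))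
      (h k n (ℕ.m⊔n≤o⇒m≤o K L k≥′) (ℕ.m⊔n≤o⇒m≤o K L n≥′)))

-- From p q = 1 follows p - y = p (1 - q y), where the last factor tends to 0 because q y and x y
-- have the same limit 1. A bound on p takes the place of a positive lower bound on q.
⇝-inverse : ∀ {p q x y B} → 0ℚ ℚ.< B → Eventually (λ k → ℚ.∣ p k ∣ ℚ.≤ B × p k ℚ.* q k ≡ 1ℚ) →
  q ⇝ x → y ⇝ y → (λ _ → 1ℚ) ⇝ (λ n → x n ℚ.* y n) → p ⇝ y
⇝-inverse {p} {q} {x} {y} {B} 0<B (J , bound) qx yy xy = ⇝-close close yy
  where
  1⇝qy : (λ _ → 1ℚ) ⇝ (λ k → q k ℚ.* y k)
  1⇝qy = ⇝-trans xy (⇝-sym (⇝-* qx yy))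
  close : ∀ ε → 0ℚ ℚ.< ε → Eventually λ k → ℚ.∣ p k ℚ.- y k ∣ ℚ.< ε
  rearrange : ∀ p q y → p ℚ.* q ≡ 1ℚ → p ℚ.* (1ℚ ℚ.- q ℚ.* y) ≡ p ℚ.- y
  rearrange p q y pq≡1 = begin
    p ℚ.* (1ℚ ℚ.- q ℚ.* y)
      ≡⟨ solve 4 (λ o p q y → p :* (o :- q :* y) := p :* o :- p :* q :* y) refl 1ℚ p q y ⟩
    p ℚ.* 1ℚ ℚ.- p ℚ.* q ℚ.* y
      ≡⟨ cong₂ (λ u v → u ℚ.- v ℚ.* y) (ℚ.*-identityʳ p) pq≡1 ⟩
    p ℚ.- 1ℚ ℚ.* y
      ≡⟨ cong (λ u → p ℚ.- u) (ℚ.*-identityˡ y) ⟩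
    p ℚ.- y ∎
    where open ≡-Reasoning
  close ε 0<ε =
    let δ , 0<δ , Bδ = divide B 0<B ε 0<ε
        K , h        = approach 1⇝qy δ 0<δ
    in J ℕ.⊔ K , λ k k≥ →
      let p≤B , pq≡1 = bound k (ℕ.m⊔n≤o⇒m≤o J K k≥) ; k≥K = ℕ.m⊔n≤o⇒n≤o J K k≥
      in subst (λ u → ℚ.∣ u ∣ ℚ.< ε) (rearrange (p k) (q k) (y k) pq≡1)
        (∣*∣< {p k} {B} {1ℚ ℚ.- q k ℚ.* y k} {δ} {ε} 0<B p≤B (h k k k≥K k≥K) Bδ)

pow : ℚ → ℕ → ℚ
pow p zero    = 1ℚ
pow p (suc n) = p ℚ.* pow p n

⇝-pow : ∀ {q x} → q ⇝ x → ∀ m → (λ k → pow (q k) m) ⇝ (λ n → pow (x n) m)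
⇝-pow qx zero    = ⇝-const 1ℚ
⇝-pow qx (suc m) = ⇝-* qx (⇝-pow qx m)

ι-^ : ∀ m n → ι (m ℕ.^ n) ≡ pow (ι m) n
ι-^ m zero    = ι-1
ι-^ m (suc n) = trans (ι-* m (m ℕ.^ n)) (cong (ι m ℚ.*_) (ι-^ m n))

pow-* : ∀ p q n → pow (p ℚ.* q) n ≡ pow p n ℚ.* pow q n
pow-* p q zero    = refl
pow-* p q (suc n) = trans (cong (p ℚ.* q ℚ.*_) (pow-* p q n))
  (solve 4 (λ p q x y → p :* q :* (x :* y) := p :* x :* (q :* y)) refl p q (pow p n) (pow q n))

pow-+ : ∀ p m n → pow p (m ℕ.+ n) ≡ pow p m ℚ.* pow p n
pow-+ p zero    n = sym (ℚ.*-identityˡ (pow p n))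
pow-+ p (suc m) n = trans (cong (p ℚ.*_) (pow-+ p m n)) (sym (ℚ.*-assoc p (pow p m) (pow p n)))

pow-1 : ∀ n → pow 1ℚ n ≡ 1ℚ
pow-1 zero    = refl
pow-1 (suc n) = trans (ℚ.*-identityˡ (pow 1ℚ n)) (pow-1 n)

pow-positive : ∀ {p} → 0ℚ ℚ.< p → ∀ n → 0ℚ ℚ.< pow p n
pow-positive 0<p zero    = ℚ.positive⁻¹ 1ℚ
pow-positive 0<p (suc n) = *-pos 0<p (pow-positive 0<p n)

archimedean : ∀ {ε} → 0ℚ ℚ.< ε → ∀ c → ∃[ M ] ι c ℚ.< ε ℚ.* ι M
-- A positive ε is at least the reciprocal of its denominator, so (c + 1) times the denominator
-- makes the product at least c + 1.
archimedean {ε@(ℚ.mkℚ (+ suc n) d-1 _)} 0<ε c = suc c ℕ.* suc d-1 , (begin-strict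
  ι c                           <⟨ ι-mono-< {c} {suc c} ℕ.≤-refl ⟩
  ι (suc c)                     ≤⟨ ι-mono (ℕ.m≤m*n (suc c) (suc n)) ⟩
  ι (suc c ℕ.* suc n)           ≡⟨ ι-* (suc c) (suc n) ⟩
  ι (suc c) ℚ.* ι (suc n)       ≡⟨ cong (ι (suc c) ℚ.*_) ε*d ⟨
  ι (suc c) ℚ.* (ε ℚ.* ι (suc d-1))
    ≡⟨ solve 3 (λ c e d → c :* (e :* d) := e :* (c :* d)) refl (ι (suc c)) ε (ι (suc d-1)) ⟩
  ε ℚ.* (ι (suc c) ℚ.* ι (suc d-1)) ≡⟨ cong (ε ℚ.*_) (ι-* (suc c) (suc d-1)) ⟨
  ε ℚ.* ι (suc c ℕ.* suc d-1)   ∎)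
  where
  open ℚ.≤-Reasoning
  ε*d : ε ℚ.* ι (suc d-1) ≡ ι (suc n)
  ε*d = trans (cong (ℚ._* ι (suc d-1)) (sym (ℚ.↥p/↧p≡p ε))) (/-*-cancel (+ suc n) (suc d-1))
archimedean {ℚ.mkℚ (+ zero) _ _} (ℚ.*<* (ℤ.+<+ ())) c
archimedean {ℚ.mkℚ (ℤ.-[1+ _ ]) _ _} (ℚ.*<* ()) c

∣ι-ι∣≤ : ∀ {m n c} → m ℕ.≤ n ℕ.+ c → n ℕ.≤ m ℕ.+ c → ℚ.∣ ι m ℚ.- ι n ∣ ℚ.≤ ι c
∣ι-ι∣≤ {m} {n} {c} m≤ n≤ with ℚ.∣p∣≡p∨∣p∣≡-p (ι m ℚ.- ι n)
... | inj₁ eq = subst (ℚ._≤ ι c) (sym eq) (difference m≤)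
  where
  difference : ∀ {m n} → m ℕ.≤ n ℕ.+ c → ι m ℚ.- ι n ℚ.≤ ι c
  difference {m} {n} m≤ = subst (ι m ℚ.- ι n ℚ.≤_)
    (solve 2 (λ n c → n :+ c :- n := c) refl (ι n) (ι c))
    (ℚ.+-monoˡ-≤ (ℚ.- ι n) (subst (ι m ℚ.≤_) (ι-+ n c) (ι-mono m≤)))
... | inj₂ eq = subst (ℚ._≤ ι c) (sym (trans eq (-[p-q] (ι m) (ι n)))) (difference n≤)
  where
  difference : ∀ {m n} → m ℕ.≤ n ℕ.+ c → ι m ℚ.- ι n ℚ.≤ ι c
  difference {m} {n} m≤ = subst (ι m ℚ.- ι n ℚ.≤_)
    (solve 2 (λ n c → n :+ c :- n := c) refl (ι n) (ι c))
    (ℚ.+-monoˡ-≤ (ℚ.- ι n) (subst (ι m ℚ.≤_) (ι-+ n c) (ι-mono m≤)))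

-- Counts relative to powers of a divergent sequence

module _ {N : ℕ → ℕ} (N∞ : N ⟶∞) (N≢0 : ∀ k → ℕ.NonZero (N k)) where

  private
    0<X : ∀ k → 0ℚ ℚ.< ι (N k)
    0<X k = 0<ι (N k) {{N≢0 k}}

  -- Divided by N, which diverges, a change of the numerator by at most c disappears: c < ε N
  -- eventually.
  ⇝-perturb : ∀ (f g : ℕ → ℕ) {x} c → (∀ k → f k ℕ.≤ g k ℕ.+ c) → (∀ k → g k ℕ.≤ f k ℕ.+ c) →
    (λ k → ι (g k) ℚ.* inv (ι (N k))) ⇝ x → (λ k → ι (f k) ℚ.* inv (ι (N k))) ⇝ x
  ⇝-perturb f g c f≤ g≤ = ⇝-close close
    where
    close : ∀ ε → 0ℚ ℚ.< ε → Eventually λ k →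
      ℚ.∣ ι (f k) ℚ.* inv (ι (N k)) ℚ.- ι (g k) ℚ.* inv (ι (N k)) ∣ ℚ.< ε
    close ε 0<ε with archimedean 0<ε c
    ... | M , c<εM with N∞ M
    ...   | K , M≤N = K , λ k k≥ → begin-strict
      ℚ.∣ ι (f k) ℚ.* i k ℚ.- ι (g k) ℚ.* i k ∣
        ≡⟨ cong ℚ.∣_∣ (solve 3 (λ f g i → f :* i :- g :* i := (f :- g) :* i) refl (ι (f k))
          (ι (g k)) (i k)) ⟩
      ℚ.∣ (ι (f k) ℚ.- ι (g k)) ℚ.* i k ∣
        ≡⟨ ℚ.∣p*q∣≡∣p∣*∣q∣ (ι (f k) ℚ.- ι (g k)) (i k) ⟩
      ℚ.∣ ι (f k) ℚ.- ι (g k) ∣ ℚ.* ℚ.∣ i k ∣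
        ≡⟨ cong (ℚ.∣ ι (f k) ℚ.- ι (g k) ∣ ℚ.*_) (ℚ.0≤p⇒∣p∣≡p (ℚ.<⇒≤ (0<i k))) ⟩
      ℚ.∣ ι (f k) ℚ.- ι (g k) ∣ ℚ.* i k
        ≤⟨ ℚ.*-monoʳ-≤-nonNeg (i k) {{ℚ.nonNegative (ℚ.<⇒≤ (0<i k))}}
          (∣ι-ι∣≤ {f k} {g k} (f≤ k) (g≤ k)) ⟩
      ι c ℚ.* i k
        <⟨ ℚ.*-monoˡ-<-pos (i k) {{ℚ.positive (0<i k)}} (ℚ.<-≤-trans c<εM
             (ℚ.*-monoˡ-≤-nonNeg ε {{ℚ.nonNegative (ℚ.<⇒≤ 0<ε)}} (ι-mono (M≤N k k≥)))) ⟩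
      ε ℚ.* ι (N k) ℚ.* i k
        ≡⟨ trans (ℚ.*-assoc ε (ι (N k)) (i k))
          (trans (cong (ε ℚ.*_) (*-inv (>⇒≢0 (0<X k)))) (ℚ.*-identityʳ ε)) ⟩
      ε ∎
      where
      open ℚ.≤-Reasoning
      i : ℕ → ℚ
      i k = inv (ι (N k))
      0<i : ∀ k → 0ℚ ℚ.< i k
      0<i k = 0<inv (0<X k)

  -- The common shape of the three asymptotics, for the two `rises` and for the chains. The shifts c
  -- and D in the bounds are absorbed by `⇝-perturb`.
  ⇝-squeeze-^ : ∀ (f g : ℕ → ℕ) {x} p c D m →
    (λ k → ι (g k) ℚ.* inv (ι (N k))) ⇝ x →
    Eventually (λ k → p ℕ.* (g k ℕ.∸ c) ℕ.^ m ℕ.≤ f k × f k ℕ.≤ p ℕ.* (g k ℕ.+ D) ℕ.^ m) →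
    (λ k → ι (f k) ℚ.* pow (inv (ι (N k))) m) ⇝ (λ n → ι p ℚ.* pow (x n) m)
  ⇝-squeeze-^ f g {x} p c D m gx (K , bounds) = ⇝-squeeze
    (⇝-* (⇝-const (ι p)) (⇝-pow (⇝-perturb (λ k → g k ℕ.∸ c) g c
      (λ k → ℕ.≤-trans (ℕ.m∸n≤m (g k) c) (ℕ.m≤m+n (g k) c))
      (λ k → subst (g k ℕ.≤_) (ℕ.+-comm c (g k ℕ.∸ c)) (ℕ.m≤n+m∸n (g k) c)) gx) m))
    (⇝-* (⇝-const (ι p)) (⇝-pow (⇝-perturb (λ k → g k ℕ.+ D) g D
      (λ k → ℕ.≤-refl)
      (λ k → ℕ.≤-trans (ℕ.m≤m+n (g k) D) (ℕ.m≤m+n (g k ℕ.+ D) D)) gx) m))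
    (K , λ k k≥ → let lo , hi = bounds k k≥ in
      subst (ℚ._≤ ι (f k) ℚ.* pow (i k) m) (powers k (g k ℕ.∸ c)) (scale k lo) ,
      subst (ι (f k) ℚ.* pow (i k) m ℚ.≤_) (powers k (g k ℕ.+ D)) (scale k hi))
    where
    i : ℕ → ℚ
    i k = inv (ι (N k))
    scale : ∀ k {h n} → h ℕ.≤ n → ι h ℚ.* pow (i k) m ℚ.≤ ι n ℚ.* pow (i k) m
    scale k le = ℚ.*-monoʳ-≤-nonNeg (pow (i k) m)
      {{ℚ.nonNegative (ℚ.<⇒≤ (pow-positive (0<inv (0<X k)) m))}} (ι-mono le)
    powers : ∀ k h → ι (p ℕ.* h ℕ.^ m) ℚ.* pow (i k) m ≡ ι p ℚ.* pow (ι h ℚ.* i k) m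
    powers k h = begin
      ι (p ℕ.* h ℕ.^ m) ℚ.* pow (i k) m
        ≡⟨ cong (ℚ._* pow (i k) m) (trans (ι-* p (h ℕ.^ m)) (cong (ι p ℚ.*_) (ι-^ h m))) ⟩
      ι p ℚ.* pow (ι h) m ℚ.* pow (i k) m
        ≡⟨ ℚ.*-assoc (ι p) (pow (ι h) m) (pow (i k) m) ⟩
      ι p ℚ.* (pow (ι h) m ℚ.* pow (i k) m)
        ≡⟨ cong (ι p ℚ.*_) (pow-* (ι h) (i k) m) ⟨
      ι p ℚ.* pow (ι h ℚ.* i k) m ∎
      where open ≡-Reasoning

-- Passing between ℝ and approximating sequences

⇝-cauchy : ∀ x → seq x ⇝ seq x
approach (⇝-cauchy x) ε 0<ε = cauchy x ε 0<ε

-- The index from which x is seen to be near `q k` depends on k. A late term `seq x j` mediates, and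
-- the Cauchy modulus makes the threshold for n uniform in k.
⟶⇒⇝ : ∀ {q : ℕ → ℚ} {x} → (λ k → fromℚ (q k)) ⟶ x → q ⇝ seq x
approach (⟶⇒⇝ {q} {x} qx) ε 0<ε
  with qx (fromℚ (½ ℚ.* ε)) (½ ℚ.* ε , half-pos 0<ε , 0 , λ _ _ →
    ℚ.≤-reflexive (ℚ.+-identityˡ (½ ℚ.* ε)))
     | cauchy x (½ ℚ.* ε) (half-pos 0<ε)
... | K , h | M , c = K ℕ.⊔ M , near
  where
  near : ∀ k n → K ℕ.⊔ M ℕ.≤ k → K ℕ.⊔ M ℕ.≤ n → ℚ.∣ q k ℚ.- seq x n ∣ ℚ.< ε
  near k n k≥ n≥ with h k (ℕ.m⊔n≤o⇒m≤o K M k≥)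
  ... | δ , 0<δ , L , g = ∣-∣-halves (q k) (seq x j) (seq x n)
    (ℚ.<-≤-trans (subst (ℚ._< ℚ.∣ q k ℚ.- seq x j ∣ ℚ.+ δ) (ℚ.+-identityʳ ℚ.∣ q k ℚ.- seq x j ∣)
      (ℚ.+-monoʳ-< ℚ.∣ q k ℚ.- seq x j ∣ 0<δ)) (g j (ℕ.m≤n⊔m M L)))
    (c j n (ℕ.m≤m⊔n M L) (ℕ.m⊔n≤o⇒n≤o K M n≥))
    where j = M ℕ.⊔ L

⇝⇒⟶ : ∀ {q : ℕ → ℚ} {x} → q ⇝ seq x → (λ k → fromℚ (q k)) ⟶ x
⇝⇒⟶ {q} {x} qx ε (δ , 0<δ , M , δ≤ε) with approach qx (½ ℚ.* δ) (half-pos 0<δ)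
... | K , h = K , λ k k≥ → ½ ℚ.* δ , half-pos 0<δ , K ℕ.⊔ M , λ n n≥ → begin
  ℚ.∣ q k ℚ.- seq x n ∣ ℚ.+ ½ ℚ.* δ
    ≤⟨ ℚ.+-monoˡ-≤ (½ ℚ.* δ) (ℚ.<⇒≤ (h k n k≥ (ℕ.m⊔n≤o⇒m≤o K M n≥))) ⟩
  ½ ℚ.* δ ℚ.+ ½ ℚ.* δ   ≡⟨ halves δ ⟩
  δ                     ≡⟨ ℚ.+-identityˡ δ ⟨
  0ℚ ℚ.+ δ              ≤⟨ δ≤ε n (ℕ.m⊔n≤o⇒n≤o K M n≥) ⟩
  seq ε n               ∎
  where open ℚ.≤-Reasoning

-- `inverse` divides by the terms from an index M on, so the product is x_n / x_(M+n) and not 1. The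
-- error is the bounded `i n` times the null sequence x_n - x_(M+n).
1⇝*-inverse : ∀ x (0<x : 0ℝ < x) → (λ _ → 1ℚ) ⇝ (λ n → seq x n ℚ.* seq (inverse x 0<x) n)
1⇝*-inverse x 0<x@(δ , 0<δ , M , 0+δ≤x) = ⇝-sym (⇝-close close (⇝-const 1ℚ))
  where
  i : ℕ → ℚ
  i = seq (inverse x 0<x)
  shifted : ∀ n → seq x (M ℕ.+ n) ℚ.* i n ≡ 1ℚ
  shifted n = ℚ.*-inverseʳ (seq x (M ℕ.+ n)) {{nonZero-pos (ℚ.<-≤-trans 0<δ
    (subst (ℚ._≤ seq x (M ℕ.+ n)) (ℚ.+-identityˡ δ) (0+δ≤x (M ℕ.+ n) (ℕ.m≤m+n M n))))}}
  rearrange : ∀ x y i → y ℚ.* i ≡ 1ℚ → i ℚ.* (x ℚ.- y) ≡ x ℚ.* i ℚ.- 1ℚ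
  rearrange x y i yi≡1 = trans (solve 3 (λ x y i → i :* (x :- y) := x :* i :- y :* i) refl x y i)
    (cong (λ u → x ℚ.* i ℚ.- u) yi≡1)
  close : ∀ ε → 0ℚ ℚ.< ε → Eventually λ n → ℚ.∣ seq x n ℚ.* i n ℚ.- 1ℚ ∣ ℚ.< ε
  close ε 0<ε =
    let B , 0<B , K , bound = bounded (inverse x 0<x)
        η , 0<η , Bη        = divide B 0<B ε 0<ε
        L , near            = cauchy x η 0<η
    in K ℕ.⊔ L , λ n n≥ → let n≥L = ℕ.m⊔n≤o⇒n≤o K L n≥ in
      subst (λ u → ℚ.∣ u ∣ ℚ.< ε) (rearrange (seq x n) (seq x (M ℕ.+ n)) (i n) (shifted n))
        (∣*∣< {i n} {B} {seq x n ℚ.- seq x (M ℕ.+ n)} {η} {ε} 0<B (bound n (ℕ.m⊔n≤o⇒m≤o K L n≥))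
          (near n (M ℕ.+ n) n≥L (ℕ.≤-trans n≥L (ℕ.m≤n+m n M))) Bη)

1⇝÷*÷ : ∀ x y (0<x : 0ℝ < x) (0<y : 0ℝ < y) →
  (λ _ → 1ℚ) ⇝ (λ n → seq (x ÷ y [ 0<y ]) n ℚ.* seq (y ÷ x [ 0<x ]) n)
1⇝÷*÷ x y 0<x 0<y = ⇝-cong (λ _ → refl)
  (λ n → solve 4 (λ x x′ y y′ → x :* x′ :* (y :* y′) := x :* y′ :* (y :* x′)) refl
    (seq x n) (seq (inverse x 0<x) n) (seq y n) (seq (inverse y 0<y) n))
  (⇝-* (1⇝*-inverse x 0<x) (1⇝*-inverse y 0<y))

seq-^ : ∀ x m n → seq (x ^ m) n ≡ pow (seq x n) m
seq-^ x zero    n = refl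
seq-^ x (suc m) n = cong (seq x n ℚ.*_) (seq-^ x m n)

-- The link as a product of convergent factors

Dim-signature : ∀ α {N} → ℓ α ℕ.≤ N → Dim (signature {N} α) ≡ growth (ℓ α) (α ‼_) ℚ.*
  ι (rises N (α ‼_))
Dim-signature α {N} le = trans
  (Dim≡weylDim (signature {N} α) (α ‼_) (Vec.lookup∘tabulate (λ i → + (α ‼ toℕ i))))
  (weylDim-rises (straight-skew α) le)

-- Counting gives this: |α|! G(α) is `dim α`, which is not 0.
growth≢0 : ∀ α → growth (ℓ α) (α ‼_) ≢ 0ℚ
growth≢0 α eq = ι≢0 (dim α) {{dim-nonZero α}}
  (trans (dim-growth α) (trans (cong (ι (size α !) ℚ.*_) eq) (ℚ.*-zeroʳ (ι (size α !)))))

÷≡*inv : ∀ p {q} (0<q : 0ℚ ℚ.< q) → (p ℚ.÷ q) {{nonZero-pos 0<q}} ≡ p ℚ.* inv q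
÷≡*inv p {q} 0<q = cong (p ℚ.*_) (inv-unique (>⇒≢0 0<q) (ℚ.*-inverseʳ q {{nonZero-pos 0<q}}))

binomial-! : ∀ m d → ((m ℕ.+ d) C m) ℕ.* (m ! ℕ.* d !) ≡ (m ℕ.+ d) !
binomial-! m d = begin
  (n C m) ℕ.* (m ! ℕ.* d !)
    ≡⟨ cong (λ e → (n C m) ℕ.* (m ! ℕ.* e !)) (ℕ.m+n∸m≡n m d) ⟨
  (n C m) ℕ.* f
    ≡⟨ cong (ℕ._* f) (nCk≡n!/k![n-k]! m≤n) ⟩
  ℕ._/_ (n !) f {{m ℕ.!* (n ℕ.∸ m) !≢0}} ℕ.* f
    ≡⟨ m/n*n≡m {{m ℕ.!* (n ℕ.∸ m) !≢0}} (k![n∸k]!∣n! m≤n) ⟩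
  n ! ∎
  where
  open ≡-Reasoning
  n = m ℕ.+ d
  f = m ! ℕ.* (n ℕ.∸ m) !
  m≤n = ℕ.m≤m+n m d

if-true : ∀ {A : Set} {b} {x y : A} → b ≡ true → (if b then x else y) ≡ x
if-true refl = refl

link : YoungDiagram → YoungDiagram → ℝ → ℝ
link α β q = fromℕ (size α C size β) * q ^ size β * (1ℝ - q) ^ (size α ℕ.∸ size β)
  * fromℚ (ℚ._/_ (+ (dim β ℕ.* skewDim α β)) (dim α) {{dim-nonZero α}})

-- The parameter of the link is left to unification: comparing the two
-- expressions with it filled in makes Agda unfold rational arithmetic.
YBΛ-link : ∀ r′ r 0<r r<r′ α β → β ⊆ α → ∃ λ q → YBΛ r′ r 0<r r<r′ α β ≡ link α β q
YBΛ-link r′ r 0<r r<r′ α β β⊆α = _ , if-true {y = 0ℝ} (dec-true (β ⊆? α) β⊆α)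

YBΛ-⊆ : ∀ r′ r 0<r r<r′ α β → β ⊆ α →
  YBΛ r′ r 0<r r<r′ α β ≡ link α β (r ÷ r′ [ <-trans {0ℝ} {r} {r′} 0<r r<r′ ])
YBΛ-⊆ r′ r 0<r r<r′ α β β⊆α = subst (λ q → YBΛ r′ r 0<r r<r′ α β ≡ link α β q) q≡
  (proj₂ (YBΛ-link r′ r 0<r r<r′ α β β⊆α))
  where
  q≡ : proj₁ (YBΛ-link r′ r 0<r r<r′ α β β⊆α) ≡ r ÷ r′ [ <-trans {0ℝ} {r} {r′} 0<r r<r′ ]
  q≡ = refl

^-distribʳ-* : ∀ m n k → (m ℕ.* n) ℕ.^ k ≡ m ℕ.^ k ℕ.* n ℕ.^ k
^-distribʳ-* m n zero    = refl
^-distribʳ-* m n (suc k) = trans (cong (m ℕ.* n ℕ.*_) (^-distribʳ-* m n k))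
  (ℕ.[m*n]*[o*p]≡[m*o]*[n*p] m n (m ℕ.^ k) (n ℕ.^ k))

module _ (α β : YoungDiagram) (β⊆α : β ⊆ α) where

  private
    m = size β
    d = List.length (boxes α β)
    n = size α
    L = ℓ α ℕ.⊔ ℓ β
    gα = growth (ℓ α) (α ‼_)
    gβ = growth (ℓ β) (β ‼_)
    c = gβ ℚ.* inv gα ℚ.* inv (ι (d !))

    !≢0 : ∀ k → ι (k !) ≢ 0ℚ
    !≢0 k = ι≢0 (k !) {{ℕ._!≢0 k}}

  -- Writing both dimensions as size! times G leaves C(n,m) m!/n!, which is 1/d! because n = m + d.
  constant : ι (n C m) ℚ.* (ι (dim β ℕ.* skewDim α β) ℚ.* inv (ι (dim α))) ≡ c ℚ.* ι (skewDim α β)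
  constant = begin
    ι (n C m) ℚ.* (ι (dim β ℕ.* skewDim α β) ℚ.* inv (ι (dim α)))
      ≡⟨ cong₂ (λ u v → ι (n C m) ℚ.* (u ℚ.* v))
           (trans (ι-* (dim β) (skewDim α β)) (cong (ℚ._* s) (dim-growth β)))
           (trans (cong inv (dim-growth α)) (sym (inv-* (!≢0 n) (growth≢0 α)))) ⟩
    b ℚ.* (M ℚ.* gβ ℚ.* s ℚ.* (inv (ι (n !)) ℚ.* inv gα))
      ≡⟨ solve 6 (λ b M g s i j → b :* (M :* g :* s :* (i :* j)) := b :* M :* i :* (g :* j :* s))
        refl
           b M gβ s (inv (ι (n !))) (inv gα) ⟩
    b ℚ.* M ℚ.* inv (ι (n !)) ℚ.* (gβ ℚ.* inv gα ℚ.* s)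
      ≡⟨ cong (ℚ._* (gβ ℚ.* inv gα ℚ.* s)) (*-cancelʳ {b ℚ.* M ℚ.* inv (ι (n !))} {inv D}
        (!≢0 d) reciprocal) ⟩
    inv D ℚ.* (gβ ℚ.* inv gα ℚ.* s)
      ≡⟨ solve 4 (λ e g j s → e :* (g :* j :* s) := g :* j :* e :* s) refl (inv D) gβ (inv gα) s ⟩
    c ℚ.* s ∎
    where
    open ≡-Reasoning
    b = ι (n C m)
    M = ι (m !)
    D = ι (d !)
    s = ι (skewDim α β)
    b*M*D : b ℚ.* M ℚ.* D ≡ ι (n !)
    b*M*D = begin
      b ℚ.* M ℚ.* D
        ≡⟨ ℚ.*-assoc b M D ⟩
      b ℚ.* (M ℚ.* D)
        ≡⟨ trans (ι-* (n C m) (m ! ℕ.* d !)) (cong (b ℚ.*_) (ι-* (m !) (d !))) ⟨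
      ι ((n C m) ℕ.* (m ! ℕ.* d !))
        ≡⟨ cong (λ n → ι ((n C m) ℕ.* (m ! ℕ.* d !))) (size-+ α β β⊆α) ⟨
      ι (((m ℕ.+ d) C m) ℕ.* (m ! ℕ.* d !))
        ≡⟨ cong ι (trans (binomial-! m d) (cong _! (size-+ α β β⊆α))) ⟩
      ι (n !) ∎
    reciprocal : b ℚ.* M ℚ.* inv (ι (n !)) ℚ.* D ≡ inv D ℚ.* D
    reciprocal = begin
      b ℚ.* M ℚ.* inv (ι (n !)) ℚ.* D
        ≡⟨ solve 4 (λ b M i D → b :* M :* i :* D := b :* M :* D :* i) refl b M (inv (ι (n !))) D ⟩
      b ℚ.* M ℚ.* D ℚ.* inv (ι (n !))
        ≡⟨ cong (ℚ._* inv (ι (n !))) b*M*D ⟩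
      ι (n !) ℚ.* inv (ι (n !))
        ≡⟨ trans (*-inv (!≢0 n)) (sym (*-inv (!≢0 d))) ⟩
      D ℚ.* inv D
        ≡⟨ ℚ.*-comm D (inv D) ⟩
      inv D ℚ.* D ∎

  module _ (N N′ : ℕ) where

    chainCount : ℕ
    chainCount = Dim₂ (signature {N} β) (signature {N′} α)

    -- Arranged so that every bracket has a limit of its own. Inserted are d!/d! and N′^n · N′^(-m)
    -- · N′^(-d), the latter being 1 because n = m + d.
    Λ-factors : L ℕ.≤ N → N ℕ.< N′ →
      Λ {N′} {N} (signature α) (signature β) ≡
      c ℚ.* (ι (rises N (β ‼_)) ℚ.* pow (inv (ι N′)) m
        ℚ.* (ι (d ! ℕ.* chainCount) ℚ.* pow (inv (ι N′)) d)
        ℚ.* (pow (ι N′) n ℚ.* inv (ι (rises N′ (α ‼_)))))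
    Λ-factors L≤N N<N′ = begin
      Λ {N′} {N} (signature α) (signature β)
        ≡⟨ ÷≡*inv (Dim κ ℚ.* (+ chainCount ℚ./ 1)) (Dim-positive ν) ⟩
      Dim κ ℚ.* (+ chainCount ℚ./ 1) ℚ.* inv (Dim ν)
        ≡⟨ cong₂ (λ u v → u ℚ.* v ℚ.* inv (Dim ν))
          (Dim-signature β (ℕ.≤-trans (ℕ.m≤n⊔m (ℓ α) (ℓ β)) L≤N))
             (fromℤ-/1 (+ chainCount)) ⟩
      gβ ℚ.* R ℚ.* a ℚ.* inv (Dim ν)
        ≡⟨ cong (λ u → gβ ℚ.* R ℚ.* a ℚ.* u) (trans (cong inv Dim-ν)
          (sym (inv-* (growth≢0 α) R′≢0))) ⟩
      gβ ℚ.* R ℚ.* a ℚ.* (inv gα ℚ.* inv R′)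
        ≡⟨ solve 5 (λ g R a j S → g :* R :* a :* (j :* S) := g :* j :* (R :* a :* S)) refl gβ R a
          (inv gα) (inv R′) ⟩
      gβ ℚ.* inv gα ℚ.* (R ℚ.* a ℚ.* inv R′)
        ≡⟨ solve 3 (λ g j p → g :* j :* p := g :* j :* (p :* con 1ℚ :* con 1ℚ)) refl gβ (inv gα)
          (R ℚ.* a ℚ.* inv R′) ⟩
      gβ ℚ.* inv gα ℚ.* (R ℚ.* a ℚ.* inv R′ ℚ.* 1ℚ ℚ.* 1ℚ)
        ≡⟨ cong₂ (λ u v → gβ ℚ.* inv gα ℚ.* (R ℚ.* a ℚ.* inv R′ ℚ.* u ℚ.* v)) D*i≡1 X*i≡1 ⟨
      gβ ℚ.* inv gα ℚ.* (R ℚ.* a ℚ.* inv R′ ℚ.* (D ℚ.* inv D) ℚ.*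
        (pow X n ℚ.* (pow i m ℚ.* pow i d)))
        ≡⟨ solve 10 (λ g j R a S D E X I J →
             g :* j :* (R :* a :* S :* (D :* E) :* (X :* (I :* J))) :=
             g :* j :* E :* (R :* I :* (D :* a :* J) :* (X :* S))) refl
             gβ (inv gα) R a (inv R′) D (inv D) (pow X n) (pow i m) (pow i d) ⟩
      c ℚ.* (R ℚ.* pow i m ℚ.* (D ℚ.* a ℚ.* pow i d) ℚ.* (pow X n ℚ.* inv R′))
        ≡⟨ cong (λ u → c ℚ.* (R ℚ.* pow i m ℚ.* (u ℚ.* pow i d) ℚ.* (pow X n ℚ.* inv R′)))
          (ι-* (d !) chainCount) ⟨
      c ℚ.* (R ℚ.* pow i m ℚ.* (ι (d ! ℕ.* chainCount) ℚ.* pow i d) ℚ.* (pow X n ℚ.* inv R′)) ∎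
      where
      open ≡-Reasoning
      ν = signature {N′} α
      κ = signature {N} β
      R  = ι (rises N (β ‼_))
      R′ = ι (rises N′ (α ‼_))
      a  = ι chainCount
      D  = ι (d !)
      X  = ι N′
      i  = inv X
      L≤N′ : ℓ α ℕ.≤ N′
      L≤N′ = ℕ.≤-trans (ℕ.m≤m⊔n (ℓ α) (ℓ β)) (ℕ.≤-trans L≤N (ℕ.<⇒≤ N<N′))
      Dim-ν : Dim ν ≡ gα ℚ.* R′
      Dim-ν = Dim-signature α L≤N′
      R′≢0 : R′ ≢ 0ℚ
      R′≢0 eq = >⇒≢0 (Dim-positive ν) (trans Dim-ν (trans (cong (gα ℚ.*_) eq) (ℚ.*-zeroʳ gα)))
      X≢0 : X ≢ 0ℚ
      X≢0 = ι≢0 N′ {{ℕ.>-nonZero (ℕ.≤-<-trans z≤n N<N′)}}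
      D*i≡1 : D ℚ.* inv D ≡ 1ℚ
      D*i≡1 = *-inv (!≢0 d)
      X*i≡1 : pow X n ℚ.* (pow i m ℚ.* pow i d) ≡ 1ℚ
      X*i≡1 = begin
        pow X n ℚ.* (pow i m ℚ.* pow i d)   ≡⟨ cong (pow X n ℚ.*_) (pow-+ i m d) ⟨
        pow X n ℚ.* pow i (m ℕ.+ d)         ≡⟨ cong (λ k → pow X n ℚ.* pow i k) (size-+ α β β⊆α) ⟩
        pow X n ℚ.* pow i n                 ≡⟨ pow-* X i n ⟨
        pow (X ℚ.* i) n                     ≡⟨ cong (λ x → pow x n) (*-inv X≢0) ⟩
        pow 1ℚ n                            ≡⟨ pow-1 n ⟩
        1ℚ                                  ∎

  module _ {r′ r : ℝ} (0<r : 0ℝ < r) (0<r′ : 0ℝ < r′) {N′ N : ℕ → ℕ} (N≢0 : ∀ k → ℕ.NonZero (N k))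
           (N<N′ : ∀ k → N k ℕ.< N′ k) (N∞ : N ⟶∞)
           (ratio : (λ k → ι (N′ k) ℚ.* inv (ι (N k))) ⇝ seq (r′ ÷ r [ 0<r ])) where

    private
      t : ℕ → ℚ
      t = seq (r ÷ r′ [ 0<r′ ])

      X i : ℕ → ℚ
      X k = ι (N′ k)
      i k = inv (X k)

      N′≢0 : ∀ k → ℕ.NonZero (N′ k)
      N′≢0 k = ℕ.>-nonZero (ℕ.≤-<-trans z≤n (N<N′ k))

      X≢0 : ∀ k → X k ≢ 0ℚ
      X≢0 k = ι≢0 (N′ k) {{N′≢0 k}}

      0<i : ∀ k → 0ℚ ℚ.< i k
      0<i k = 0<inv (0<ι (N′ k) {{N′≢0 k}})

      N′∞ : N′ ⟶∞
      N′∞ M = let K , M≤N = N∞ M in K , λ k k≥ → ℕ.≤-trans (M≤N k k≥) (ℕ.<⇒≤ (N<N′ k))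

      L≤N : Eventually λ k → L ℕ.≤ N k
      L≤N = N∞ L

    -- The hypothesis concerns the reciprocal N′/N. As N < N′, the quotient N/N′ is at most 1, the
    -- bound that `⇝-inverse` asks for.
    N/N′⇝t : (λ k → ι (N k) ℚ.* i k) ⇝ t
    N/N′⇝t = ⇝-inverse (ℚ.positive⁻¹ 1ℚ) (0 , λ k _ → at-most-1 k , reciprocal k) ratio
      (⇝-cauchy (r ÷ r′ [ 0<r′ ])) (1⇝÷*÷ r′ r 0<r′ 0<r)
      where
      at-most-1 : ∀ k → ℚ.∣ ι (N k) ℚ.* i k ∣ ℚ.≤ 1ℚ
      at-most-1 k = begin
        ℚ.∣ ι (N k) ℚ.* i k ∣   ≡⟨ ℚ.0≤p⇒∣p∣≡p (ℚ.<⇒≤ (*-pos (0<ι (N k) {{N≢0 k}}) (0<i k))) ⟩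
        ι (N k) ℚ.* i k         ≤⟨ ℚ.*-monoʳ-≤-nonNeg (i k) {{ℚ.nonNegative (ℚ.<⇒≤ (0<i k))}}
          (ι-mono (ℕ.<⇒≤ (N<N′ k))) ⟩
        X k ℚ.* i k             ≡⟨ *-inv (X≢0 k) ⟩
        1ℚ                      ∎
        where open ℚ.≤-Reasoning
      reciprocal : ∀ k → ι (N k) ℚ.* i k ℚ.* (X k ℚ.* inv (ι (N k))) ≡ 1ℚ
      reciprocal k = begin
        ι (N k) ℚ.* i k ℚ.* (X k ℚ.* inv (ι (N k)))
          ≡⟨ solve 4 (λ a b c d → a :* b :* (c :* d) := a :* d :* (c :* b)) refl (ι (N k)) (i k)
            (X k) (inv (ι (N k))) ⟩
        ι (N k) ℚ.* inv (ι (N k)) ℚ.* (X k ℚ.* i k)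
          ≡⟨ cong₂ ℚ._*_ (*-inv (ι≢0 (N k) {{N≢0 k}})) (*-inv (X≢0 k)) ⟩
        1ℚ ∎
        where open ≡-Reasoning

    [N′-N]/N′⇝1-t : (λ k → ι (N′ k ℕ.∸ N k) ℚ.* i k) ⇝ (λ n → 1ℚ ℚ.- t n)
    [N′-N]/N′⇝1-t = ⇝-cong difference (λ _ → refl) (⇝-1- N/N′⇝t)
      where
      difference : ∀ k → 1ℚ ℚ.- ι (N k) ℚ.* i k ≡ ι (N′ k ℕ.∸ N k) ℚ.* i k
      difference k = begin
        1ℚ ℚ.- ι (N k) ℚ.* i k
          ≡⟨ cong (ℚ._- ι (N k) ℚ.* i k) (*-inv (X≢0 k)) ⟨
        X k ℚ.* i k ℚ.- ι (N k) ℚ.* i k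
          ≡⟨ cong (λ u → u ℚ.* i k ℚ.- ι (N k) ℚ.* i k)
               (trans (cong ι (sym (ℕ.m∸n+n≡m (ℕ.<⇒≤ (N<N′ k))))) (ι-+ (N′ k ℕ.∸ N k) (N k))) ⟩
        (ι (N′ k ℕ.∸ N k) ℚ.+ ι (N k)) ℚ.* i k ℚ.- ι (N k) ℚ.* i k
          ≡⟨ solve 3 (λ d n i → (d :+ n) :* i :- n :* i := d :* i) refl (ι (N′ k ℕ.∸ N k))
            (ι (N k)) (i k) ⟩
        ι (N′ k ℕ.∸ N k) ℚ.* i k ∎
        where open ≡-Reasoning

    rises-β⇝ : (λ k → ι (rises (N k) (β ‼_)) ℚ.* pow (i k) m) ⇝ (λ n → ι 1 ℚ.* pow (t n) m)
    rises-β⇝ = ⇝-squeeze-^ N′∞ N′≢0 (λ k → rises (N k) (β ‼_)) N 1 (ℓ β) (β ‼ 0) m N/N′⇝t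
      (proj₁ L≤N , λ k k≥ → let le = ℕ.≤-trans (ℕ.m≤n⊔m (ℓ α) (ℓ β)) (proj₂ L≤N k k≥) in
        subst (ℕ._≤ rises (N k) (β ‼_)) (sym (ℕ.*-identityˡ _)) (^≤rises (straight-skew β) le) ,
        subst (rises (N k) (β ‼_) ℕ.≤_) (sym (ℕ.*-identityˡ _)) (rises≤^ (straight-skew β) le))

    chains⇝ : (λ k → ι (d ! ℕ.* chainCount (N k) (N′ k)) ℚ.* pow (i k) d) ⇝
              (λ n → ι (skewDim α β) ℚ.* pow (1ℚ ℚ.- t n) d)
    chains⇝ = ⇝-squeeze-^ N′∞ N′≢0 (λ k → d ! ℕ.* chainCount (N k) (N′ k)) (λ k → N′ k ℕ.∸ N k)
      (skewDim α β) d d d [N′-N]/N′⇝1-t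
      (proj₁ L≤N , λ k k≥ → let le = ℕ.≤-trans (ℕ.m≤m⊔n (ℓ α) (ℓ β)) (proj₂ L≤N k k≥) in
        -- The bounds are stated for `sig (N′ k) (α ‼_)`, which is `signature α` by definition,
        -- since the proofs of monotonicity are irrelevant.
        subst (λ p → p ℕ.* (N′ k ℕ.∸ N k ℕ.∸ d) ℕ.^ d ℕ.≤ d ! ℕ.* chainCount (N k) (N′ k))
          (sym (skewDim≡paths α β))
          (^≤!*Dim₂ {b = β ‼_} {signature β} κ-β le (skew-skew α β β⊆α) (ℕ.<⇒≤ (N<N′ k))) ,
        subst (λ p → d ! ℕ.* chainCount (N k) (N′ k) ℕ.≤ p ℕ.* (N′ k ℕ.∸ N k ℕ.+ d) ℕ.^ d)
          (sym (skewDim≡paths α β))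
          (!*Dim₂≤^ {b = β ‼_} {signature β} κ-β le (skew-skew α β β⊆α) (ℕ.<⇒≤ (N<N′ k))))
      where
      κ-β : ∀ {N} i → signature {N} β ! i ≡ + (β ‼ toℕ i)
      κ-β = Vec.lookup∘tabulate (λ i → + (β ‼ toℕ i))

    rises-α⇝ : (λ k → ι (rises (N′ k) (α ‼_)) ℚ.* pow (i k) n) ⇝ (λ _ → 1ℚ)
    rises-α⇝ = ⇝-cong (λ _ → refl) (λ _ → trans (cong (ℚ._* pow 1ℚ n) ι-1)
      (trans (ℚ.*-identityˡ (pow 1ℚ n)) (pow-1 n)))
      (⇝-squeeze-^ N′∞ N′≢0 (λ k → rises (N′ k) (α ‼_)) N′ {λ _ → 1ℚ} 1 (ℓ α) (α ‼ 0) n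
        (⇝-cong (λ k → sym (*-inv (X≢0 k))) (λ _ → refl) (⇝-const 1ℚ))
        (proj₁ (N′∞ L) , λ k k≥ → let le = ℕ.≤-trans (ℕ.m≤m⊔n (ℓ α) (ℓ β)) (proj₂ (N′∞ L) k k≥) in
          subst (ℕ._≤ rises (N′ k) (α ‼_)) (sym (ℕ.*-identityˡ _)) (^≤rises (straight-skew α) le) ,
          subst (rises (N′ k) (α ‼_) ℕ.≤_) (sym (ℕ.*-identityˡ _)) (rises≤^ (straight-skew α) le)))

    -- The bound 2^n needed by `⇝-inverse` comes from `rises` being at least (N′ - ℓ α)^n and from
    -- N′ ≤ 2 (N′ - ℓ α) for large N′.
    inv-rises-α⇝ : (λ k → pow (X k) n ℚ.* inv (ι (rises (N′ k) (α ‼_)))) ⇝ (λ _ → 1ℚ)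
    inv-rises-α⇝ = ⇝-inverse {B = ι (2 ℕ.^ n)} (0<ι (2 ℕ.^ n) {{ℕ.m^n≢0 2 n}})
      (proj₁ large , λ k k≥ → bounds k (proj₂ large k k≥)) rises-α⇝ (⇝-const 1ℚ) (⇝-const 1ℚ)
      where
      -- From 2 ℓ α + 1 on, `gap` exceeds ℓ α. So it is positive, which makes `R` nonzero, and it is
      -- at least half of N′.
      large = N′∞ (suc (ℓ α ℕ.+ ℓ α))
      bounds : ∀ k → suc (ℓ α ℕ.+ ℓ α) ℕ.≤ N′ k →
        ℚ.∣ pow (X k) n ℚ.* inv (ι (rises (N′ k) (α ‼_))) ∣ ℚ.≤ ι (2 ℕ.^ n) ×
        pow (X k) n ℚ.* inv (ι (rises (N′ k) (α ‼_))) ℚ.*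
          (ι (rises (N′ k) (α ‼_)) ℚ.* pow (i k) n) ≡ 1ℚ
      bounds k le = bounded-by , reciprocal
        where
        R = rises (N′ k) (α ‼_)
        gap = N′ k ℕ.∸ ℓ α
        ℓ<gap : ℓ α ℕ.< gap
        ℓ<gap = subst (ℕ._≤ gap) (ℕ.m+n∸n≡m (suc (ℓ α)) (ℓ α)) (ℕ.∸-monoˡ-≤ (ℓ α) le)
        ℓ≤N′ : ℓ α ℕ.≤ N′ k
        ℓ≤N′ = ℕ.≤-trans (ℕ.m≤n+m (ℓ α) (suc (ℓ α))) le
        gap^≤R : gap ℕ.^ n ℕ.≤ R
        gap^≤R = ^≤rises (straight-skew α) ℓ≤N′
        R≢0 : ℕ.NonZero R
        R≢0 = ℕ.>-nonZero (ℕ.<-≤-trans (ℕ.m^n>0 gap {{ℕ.>-nonZero (ℕ.≤-<-trans z≤n ℓ<gap)}} n)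
          gap^≤R)
        0<R : 0ℚ ℚ.< ι R
        0<R = 0<ι R {{R≢0}}
        N′≤2*gap : N′ k ℕ.≤ 2 ℕ.* gap
        N′≤2*gap = subst (ℕ._≤ 2 ℕ.* gap) (ℕ.m∸n+n≡m ℓ≤N′)
          (ℕ.+-monoʳ-≤ gap (ℕ.≤-trans (ℕ.<⇒≤ ℓ<gap) (ℕ.≤-reflexive (sym (ℕ.+-identityʳ gap)))))
        N′^≤ : N′ k ℕ.^ n ℕ.≤ 2 ℕ.^ n ℕ.* R
        N′^≤ = ℕ.≤-trans (ℕ.^-monoˡ-≤ n N′≤2*gap) (ℕ.≤-trans (ℕ.≤-reflexive (^-distribʳ-* 2 gap n))
          (ℕ.*-monoʳ-≤ (2 ℕ.^ n) gap^≤R))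
        bounded-by : ℚ.∣ pow (X k) n ℚ.* inv (ι R) ∣ ℚ.≤ ι (2 ℕ.^ n)
        bounded-by = begin
          ℚ.∣ pow (X k) n ℚ.* inv (ι R) ∣
            ≡⟨ ℚ.0≤p⇒∣p∣≡p (ℚ.<⇒≤ (*-pos (pow-positive (0<ι (N′ k) {{N′≢0 k}}) n) (0<inv 0<R))) ⟩
          pow (X k) n ℚ.* inv (ι R)
            ≡⟨ cong (ℚ._* inv (ι R)) (ι-^ (N′ k) n) ⟨
          ι (N′ k ℕ.^ n) ℚ.* inv (ι R)
            ≤⟨ ℚ.*-monoʳ-≤-nonNeg (inv (ι R)) {{ℚ.nonNegative (ℚ.<⇒≤ (0<inv 0<R))}} (ι-mono N′^≤) ⟩
          ι (2 ℕ.^ n ℕ.* R) ℚ.* inv (ι R)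
            ≡⟨ cong (ℚ._* inv (ι R)) (ι-* (2 ℕ.^ n) R) ⟩
          ι (2 ℕ.^ n) ℚ.* ι R ℚ.* inv (ι R)
            ≡⟨ trans (ℚ.*-assoc (ι (2 ℕ.^ n)) (ι R) (inv (ι R)))
                 (trans (cong (ι (2 ℕ.^ n) ℚ.*_) (*-inv (>⇒≢0 0<R)))
                   (ℚ.*-identityʳ (ι (2 ℕ.^ n)))) ⟩
          ι (2 ℕ.^ n) ∎
          where open ℚ.≤-Reasoning
        reciprocal : pow (X k) n ℚ.* inv (ι R) ℚ.* (ι R ℚ.* pow (i k) n) ≡ 1ℚ
        reciprocal = begin
          pow (X k) n ℚ.* inv (ι R) ℚ.* (ι R ℚ.* pow (i k) n)
            ≡⟨ solve 4 (λ x j r y → x :* j :* (r :* y) := r :* j :* (x :* y)) refl (pow (X k) n)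
              (inv (ι R)) (ι R) (pow (i k) n) ⟩
          ι R ℚ.* inv (ι R) ℚ.* (pow (X k) n ℚ.* pow (i k) n)
            ≡⟨ cong₂ ℚ._*_ (*-inv (>⇒≢0 0<R)) (trans (sym (pow-* (X k) (i k) n))
              (trans (cong (λ x → pow x n) (*-inv (X≢0 k))) (pow-1 n))) ⟩
          1ℚ ∎
          where open ≡-Reasoning

    private
      -- Sums, products and powers in ℝ are termwise, so once the quotient of r and r′ is fixed as
      -- t, the limit agrees with the link term by term.
      seq-link : ∀ j → c ℚ.* (ι 1 ℚ.* pow (t j) m ℚ.* (ι (skewDim α β) ℚ.* pow (1ℚ ℚ.- t j) d) ℚ.*
        1ℚ) ≡ seq (link α β (r ÷ r′ [ 0<r′ ])) j
      seq-link j = begin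
        c ℚ.* (ι 1 ℚ.* x ℚ.* (s ℚ.* y) ℚ.* 1ℚ)
          ≡⟨ cong (λ u → c ℚ.* (u ℚ.* x ℚ.* (s ℚ.* y) ℚ.* 1ℚ)) ι-1 ⟩
        c ℚ.* (1ℚ ℚ.* x ℚ.* (s ℚ.* y) ℚ.* 1ℚ)
          ≡⟨ solve 4 (λ c x s y → c :* (con 1ℚ :* x :* (s :* y) :* con 1ℚ) := c :* s :* (x :* y))
            refl c x s y ⟩
        c ℚ.* s ℚ.* (x ℚ.* y)
          ≡⟨ cong (ℚ._* (x ℚ.* y)) constant ⟨
        ι (n C m) ℚ.* (ι (dim β ℕ.* skewDim α β) ℚ.* inv (ι (dim α))) ℚ.* (x ℚ.* y)
          ≡⟨ solve 4 (λ b f x y → b :* f :* (x :* y) := b :* x :* y :* f) refl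
               (ι (n C m)) (ι (dim β ℕ.* skewDim α β) ℚ.* inv (ι (dim α))) x y ⟩
        ι (n C m) ℚ.* x ℚ.* y ℚ.* (ι (dim β ℕ.* skewDim α β) ℚ.* inv (ι (dim α)))
          ≡⟨ cong₂ (λ u v → u ℚ.* x ℚ.* y ℚ.* v) (sym (fromℤ-/1 (+ (n C m))))
               (sym (/-inv (+ (dim β ℕ.* skewDim α β)) (dim α) {{dim-nonZero α}})) ⟩
        (+ (n C m) ℚ./ 1) ℚ.* x ℚ.* y ℚ.* f
          ≡⟨ cong₂ (λ u v → (+ (n C m) ℚ./ 1) ℚ.* u ℚ.* v ℚ.* f) (sym (seq-^ (r ÷ r′ [ 0<r′ ]) m j))
               (trans (cong (pow (1ℚ ℚ.- t j)) d≡)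
                 (sym (seq-^ (1ℝ - (r ÷ r′ [ 0<r′ ])) (n ℕ.∸ m) j))) ⟩
        seq (link α β (r ÷ r′ [ 0<r′ ])) j ∎
        where
        open ≡-Reasoning
        x = pow (t j) m
        y = pow (1ℚ ℚ.- t j) d
        s = ι (skewDim α β)
        f = ℚ._/_ (+ (dim β ℕ.* skewDim α β)) (dim α) {{dim-nonZero α}}
        d≡ : d ≡ n ℕ.∸ m
        d≡ = trans (sym (ℕ.m+n∸m≡n m d)) (cong (ℕ._∸ m) (size-+ α β β⊆α))

    Λ⟶link : (λ k → fromℚ (Λ {N′ k} {N k} (signature α) (signature β))) ⟶ link α β (r ÷ r′ [ 0<r′ ])
    Λ⟶link = ⇝⇒⟶ {λ k → Λ {N′ k} {N k} (signature α) (signature β)} {link α β (r ÷ r′ [ 0<r′ ])}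
      -- `Λ-factors` holds only from `L ≤ N k` on. Squeezing between two copies of the product
      -- carries the limit across an eventual equality.
      (⇝-squeeze product product
        (proj₁ L≤N , λ k k≥ → let eq = Λ-factors (N k) (N′ k) (proj₂ L≤N k k≥) (N<N′ k) in
          ℚ.≤-reflexive (sym eq) , ℚ.≤-reflexive eq))
      where
      product : (λ k → c ℚ.* (ι (rises (N k) (β ‼_)) ℚ.* pow (i k) m
                  ℚ.* (ι (d ! ℕ.* chainCount (N k) (N′ k)) ℚ.* pow (i k) d)
                  ℚ.* (pow (X k) n ℚ.* inv (ι (rises (N′ k) (α ‼_)))))) ⇝
                    seq (link α β (r ÷ r′ [ 0<r′ ]))
      product = ⇝-cong (λ _ → refl) seq-link
        (⇝-* (⇝-const c) (⇝-* (⇝-* rises-β⇝ chains⇝) inv-rises-α⇝))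

theorem7 : (r′ r : ℝ) (0<r : 0ℝ < r) (r<r′ : r < r′)
    (α β : YoungDiagram) → β ⊆ α →
    (N′ N : ℕ → ℕ) → .{{N≢0 : ∀ {k} → ℕ.NonZero (N k)}} →
    (∀ k → N k ℕ.< N′ k) → N ⟶∞ →
    (λ k → fromℚ (+ N′ k ℚ./ N k)) ⟶ r′ ÷ r [ 0<r ] →
    (λ k → fromℚ (Λ {N′ k} {N k} (signature α) (signature β))) ⟶ YBΛ r′ r 0<r r<r′ α β
theorem7 r′ r 0<r r<r′ α β β⊆α N′ N {{N≢0}} N<N′ N∞ ratio =
  subst ((λ k → fromℚ (Λ {N′ k} {N k} (signature α) (signature β))) ⟶_)
    (sym (YBΛ-⊆ r′ r 0<r r<r′ α β β⊆α)) limit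
  where
  N≢0′ : ∀ k → ℕ.NonZero (N k)
  N≢0′ k = recompute (ℕ.nonZero? (N k)) N≢0
  ratio⇝ : (λ k → + N′ k ℚ./ N k) ⇝ seq (r′ ÷ r [ 0<r ])
  ratio⇝ = ⟶⇒⇝ {λ k → + N′ k ℚ./ N k} {r′ ÷ r [ 0<r ]} ratio
  ratio⇝′ : (λ k → ι (N′ k) ℚ.* inv (ι (N k))) ⇝ seq (r′ ÷ r [ 0<r ])
  ratio⇝′ = ⇝-cong (λ k → /-inv (+ N′ k) (N k)) (λ _ → refl) ratio⇝
  limit : (λ k → fromℚ (Λ {N′ k} {N k} (signature α) (signature β))) ⟶
          link α β (r ÷ r′ [ <-trans {0ℝ} {r} {r′} 0<r r<r′ ])
  limit = Λ⟶link α β β⊆α {r′} {r} 0<r (<-trans {0ℝ} {r} {r′} 0<r r<r′) {N′} {N} N≢0′ N<N′ N∞ ratio⇝′
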